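{- Let $q$ be a prime power and $n\ge2$. Let $\mathcal P$ be the set of anisotropic points of the Hermitian variety $\mathcal H(n,q^2)$ in $\mathrm{PG}(n,q^2)$, with associated polarity $\perp$. Let $R_0$ be the identity relation on $\mathcal P$ and, for distinct $X,Y\in\mathcal P$, let - $(X,Y)\in R_1$ iff the line $\langle X,Y\rangle$ meets $\mathcal H(n,q^2)$ in exactly $1$ point, - $(X,Y)\in R_{2\perp}$ iff $\langle X,Y\rangle$ meets $\mathcal H(n,q^2)$ in exactly $q+1$ points and $X\in Y^\perp$, - $(X,Y)\in R_{2\not\perp}$ iff $\langle X,Y\rangle$ meets $\mathcal H(n,q^2)$ in exactly $q+1$ points and $X\notin Y^\perp$. Then $R_0,R_1,R_{2\perp},R_{2\not\perp}$ (omitting $R_{2\not\perp}$ when $q=2$, in which case it is empty) constitute an association scheme on $\mathcal P$.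
   Context: $\mathcal H(n,q^2)$ is the set of points of $\mathrm{PG}(n,q^2)$ whose coordinate vectors satisfy $B(x,x)=0$, where $B(x,y)=x_0y_0^q+\dots+x_ny_n^q$ on $\mathbb F_{q^2}^{n+1}$; the polarity is $W^\perp=\{x:B(x,y)=0\ \forall y\in W\}$. Points not on $\mathcal H(n,q^2)$ are anisotropic. Every line of $\mathrm{PG}(n,q^2)$ is contained in $\mathcal H(n,q^2)$ or meets it in $1$ or $q+1$ points. An association scheme on a finite set $\mathcal P$ is a partition of $\mathcal P\times\mathcal P$ into non-empty symmetric relations $R_0,\dots,R_d$, with $R_0$ the identity relation, such that for all $i,j,k$ the number $|\{Z\in\mathcal P:(X,Z)\in R_i,\ (Y,Z)\in R_j\}|$ is the same for all $(X,Y)\in R_k$. -}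

module Defs where

open import Level using (Level; _⊔_)
open import Algebra.Apartness.Bundles using (HeytingField; HeytingCommutativeRing)
open import Algebra.Bundles using (CommutativeRing)
open import Data.Fin.Base using (Fin; zero; suc)
open import Data.Nat.Base as ℕ using (ℕ)
open import Data.Nat.Primality using (Prime)
open import Data.Product.Base using (Σ; ∃; ∃₂; _×_; _,_; proj₁; proj₂)
open import Data.Vec.Functional using (Vector)
open import Function.Base using (_on_)
open import Function.Bundles using (Inverse; _⇔_)
open import Relation.Binary.Bundles using (Setoid)
open import Relation.Binary.Core using (Rel)
open import Relation.Binary.Definitions using (Symmetric; _Respects₂_)
import Relation.Binary.Construct.On as On
open import Relation.Binary.PropositionalEquality.Core using (_≡_)
import Relation.Binary.PropositionalEquality.Properties as ≡
open import Relation.Nullary.Negation.Core using (¬_)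
open import Relation.Unary using (Pred; _∈_; _∉_; _∩_; ∁)

private
  variable
    a p ℓ r : Level

IsPrimePower : ℕ → Set
IsPrimePower q = ∃₂ λ p k → Prime p × q ≡ p ℕ.^ ℕ.suc k

HasCardinality : Setoid a ℓ → ℕ → Set (a ⊔ ℓ)
HasCardinality S k = Inverse S (≡.setoid (Fin k))

-- The elements satisfying P, compared by the ambient equality; the proofs of
-- P play no role in that equality, so cardinalities are those of subsets.
Subset : (S : Setoid a ℓ) → Pred (Setoid.Carrier S) p → Setoid (a ⊔ p) ℓ
Subset S P = On.setoid {B = Σ (Setoid.Carrier S) P} S proj₁

-- The relations are indexed by 0, …, d. The underlying set is a setoid, so
-- they are also required to respect its equality.
record IsAssociationScheme (P : Setoid a ℓ) {d : ℕ}
                           (R : Fin (ℕ.suc d) → Rel (Setoid.Carrier P) r)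
                           : Set (a ⊔ ℓ ⊔ r) where
  open Setoid P
  field
    finite       : ∃ λ m → HasCardinality P m
    respects     : ∀ i → R i Respects₂ _≈_
    exhaustive   : ∀ X Y → ∃ λ i → R i X Y
    disjoint     : ∀ {i j X Y} → R i X Y → R j X Y → i ≡ j
    nonEmpty     : ∀ i → ∃₂ λ X Y → R i X Y
    symmetric    : ∀ i → Symmetric (R i)
    identity     : ∀ X Y → R zero X Y ⇔ X ≈ Y
    intersection : ∀ i j k → ∃ λ m → ∀ X Y → R k X Y →
                   HasCardinality (Subset P (λ Z → R i X Z × R j Y Z)) m

-- The intended F has q² elements. Its equality is then decidable and its
-- apartness x # y is equivalent to ¬ (x ≈ y), so that F is a field in the
-- classical sense and x # 0# says that x is nonzero.
module Hermitian {c ℓ₁ ℓ₂ : Level} (F : HeytingField c ℓ₁ ℓ₂) (q n : ℕ) where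

  open HeytingField F using (_#_; #⇒invertible; invertible⇒#)
  open CommutativeRing
    (HeytingCommutativeRing.commutativeRing (HeytingField.heytingCommutativeRing F))
  open import Algebra.Properties.Semiring.Exp semiring using (_^_)
  open import Algebra.Properties.Semiring.Sum semiring using (sum)
  open import Algebra.Properties.Ring ring using (-0#≈0#)
  open import Relation.Binary.Reasoning.Setoid setoid

  V : Set c
  V = Vector Carrier (ℕ.suc n)

  B : V → V → Carrier
  B x y = sum (λ i → x i * y i ^ q)

  infix 8 _⊥
  _⊥ : ∀ {w} → Pred V w → Pred V (c ⊔ ℓ₁ ⊔ w)
  (W ⊥) x = ∀ y → y ∈ W → B x y ≈ 0#

  record Point : Set (c ⊔ ℓ₂) where
    field
      coord   : V
      nonzero : ∃ λ i → coord i # 0#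

  open Point public

  infix 4 _∼_
  _∼_ : Rel Point (c ⊔ ℓ₁ ⊔ ℓ₂)
  X ∼ Y = ∃ λ s → s # 0# × (∀ i → coord X i ≈ s * coord Y i)

  private
    x-0≈x : ∀ x → x - 0# ≈ x
    x-0≈x x = trans (+-congˡ -0#≈0#) (+-identityʳ x)

    unit⇒#0 : ∀ s t → s * t ≈ 1# → s # 0#
    unit⇒#0 s t st≈1 = invertible⇒#
      ( t
      , trans (*-congˡ (x-0≈x s)) (trans (*-comm t s) st≈1)
      , trans (*-congʳ (x-0≈x s)) st≈1 )

    ∼-refl : ∀ {X} → X ∼ X
    ∼-refl = 1# , unit⇒#0 1# 1# (*-identityˡ 1#) , λ i → sym (*-identityˡ _)

    inverse : ∀ {s} → s # 0# → ∃ λ t → t * s ≈ 1#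
    inverse s#0 with #⇒invertible s#0
    ... | t , ts≈1 , _ = t , trans (*-congˡ (sym (x-0≈x _))) ts≈1

    ∼-sym : ∀ {X Y} → X ∼ Y → Y ∼ X
    ∼-sym {X} {Y} (s , s#0 , X≈sY) with inverse s#0
    ... | t , ts≈1 = t , unit⇒#0 t s ts≈1 , λ i → begin
      coord Y i             ≈⟨ *-identityˡ _ ⟨
      1# * coord Y i        ≈⟨ *-congʳ ts≈1 ⟨
      t * s * coord Y i     ≈⟨ *-assoc t s _ ⟩
      t * (s * coord Y i)   ≈⟨ *-congˡ (X≈sY i) ⟨
      t * coord X i         ∎

    ∼-trans : ∀ {X Y Z} → X ∼ Y → Y ∼ Z → X ∼ Z
    ∼-trans {X} {Y} {Z} (s , s#0 , X≈sY) (t , t#0 , Y≈tZ)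
      with inverse s#0 | inverse t#0
    ... | s′ , s′s≈1 | t′ , t′t≈1 = s * t , unit⇒#0 (s * t) (t′ * s′) stt′s′≈1 , λ i → begin
      coord X i             ≈⟨ X≈sY i ⟩
      s * coord Y i         ≈⟨ *-congˡ (Y≈tZ i) ⟩
      s * (t * coord Z i)   ≈⟨ *-assoc s t _ ⟨
      s * t * coord Z i     ∎
      where
      stt′s′≈1 : s * t * (t′ * s′) ≈ 1#
      stt′s′≈1 = begin
        s * t * (t′ * s′)     ≈⟨ *-comm (s * t) (t′ * s′) ⟩
        t′ * s′ * (s * t)     ≈⟨ *-assoc t′ s′ (s * t) ⟩
        t′ * (s′ * (s * t))   ≈⟨ *-congˡ (*-assoc s′ s t) ⟨
        t′ * (s′ * s * t)     ≈⟨ *-congˡ (*-congʳ s′s≈1) ⟩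
        t′ * (1# * t)         ≈⟨ *-congˡ (*-identityˡ t) ⟩
        t′ * t                ≈⟨ t′t≈1 ⟩
        1#                    ∎

  PG : Setoid (c ⊔ ℓ₂) (c ⊔ ℓ₁ ⊔ ℓ₂)
  PG = record
    { Carrier       = Point
    ; _≈_           = _∼_
    ; isEquivalence = record
      { refl  = λ {X} → ∼-refl {X}
      ; sym   = λ {X} {Y} → ∼-sym {X} {Y}
      ; trans = λ {X} {Y} {Z} → ∼-trans {X} {Y} {Z}
      }
    }

  ℋ : Pred Point ℓ₁
  ℋ X = B (coord X) (coord X) ≈ 0#

  ⟪_⟫ : Point → Pred V (c ⊔ ℓ₁)
  ⟪ X ⟫ v = ∃ λ s → ∀ i → v i ≈ s * coord X i

  ⟨_,_⟩ : Point → Point → Pred V (c ⊔ ℓ₁)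
  ⟨ X , Y ⟩ v = ∃₂ λ s t → ∀ i → v i ≈ s * coord X i + t * coord Y i

  pointsOf : ∀ {w} → Pred V w → Pred Point w
  pointsOf W Z = coord Z ∈ W

  LineMeetsℋIn : ℕ → Rel Point (c ⊔ ℓ₁ ⊔ ℓ₂)
  LineMeetsℋIn k X Y = HasCardinality (Subset PG (pointsOf ⟨ X , Y ⟩ ∩ ℋ)) k

  𝒫 : Setoid (c ⊔ ℓ₁ ⊔ ℓ₂) (c ⊔ ℓ₁ ⊔ ℓ₂)
  𝒫 = Subset PG (∁ ℋ)

  R₀ R₁ R₂⊥ R₂⊥̸ : Rel (Setoid.Carrier 𝒫) (c ⊔ ℓ₁ ⊔ ℓ₂)
  R₀  = _∼_ on proj₁
  R₁  = (λ X Y → ¬ X ∼ Y × LineMeetsℋIn 1 X Y) on proj₁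
  R₂⊥ = (λ X Y → ¬ X ∼ Y × LineMeetsℋIn (q ℕ.+ 1) X Y × X ∈ pointsOf (⟪ Y ⟫ ⊥)) on proj₁
  R₂⊥̸ = (λ X Y → ¬ X ∼ Y × LineMeetsℋIn (q ℕ.+ 1) X Y × X ∉ pointsOf (⟪ Y ⟫ ⊥)) on proj₁

{-# OPTIONS --safe #-}
module Submission where

-- For an anisotropic vector x, a vector z is proportional to x, or spans a
-- tangent line with x, or is orthogonal to x, according to the conditions
--   B x x * z = B z x * x,   norm (B z x) = B x x * B z z,   B z x = 0,
-- and the relations of the scheme are Boolean combinations of these. Up to
-- scalars the z tangent to x are the x + u with u isotropic in x^⊥. Hence all
-- intersection numbers are determined by the sizes of x^⊥ and x^⊥ ∩ y^⊥, by the
-- numbers of isotropic vectors in these spaces, and by the number of isotropic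
-- u in x^⊥ with B u y = 1. Linear relations between these numbers follow from
-- fibring a space over the complement of an anisotropic vector, and from
-- translating along an isotropic one; they involve the pair (x, y) only through
-- its tangency. The fibres are counted by the surjectivity of norm and trace
-- onto the subfield of order q, whose fibres have q + 1 and q elements.


-- The equation for tangency is the vanishing of the Gram determinant
-- `B x x * B z z - norm (B z x)`: it holds for independent x and z exactly when the form
-- degenerates on their span, and a degenerate line through an anisotropic point has a single
-- isotropic point. All the conditions are homogeneous in z, so a count of vectors is q² - 1 times a
-- count of points; the counting is done on vectors and divided once, at the end. Transitivity of
-- the unitary group on pairs is not invoked, and no closed formulas are computed. Every count is
-- the solution of linear equations whose coefficients depend on q alone, so constancy passes from
-- known counts to unknown ones by subtraction and exact division in ℕ. Tangent and secant pairs
-- obey different equations, but either set determines the same unknowns. For q = 2 the only nonzero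
-- element of the subfield of order q is 1. For anisotropic, non-orthogonal x and z both terms of
-- the Gram determinant are then 1, so x and z are proportional or tangent, and the last relation is
-- empty.

-- Ring identities with integer coefficients.

module RingSolver where

  open import Algebra.Bundles using (CommutativeRing; RawRing)
  import Algebra.Solver.Ring
  import Algebra.Solver.Ring.AlmostCommutativeRing as ACR
  open import Data.Maybe.Base using (Maybe; map)
  open import Data.Nat.Base as ℕ using (ℕ; zero; suc)
  open import Data.Nat.Properties using (_≟_)
  open import Data.Product.Base using (_×_; _,_)
  open import Data.Product.Properties using (≡-dec)
  open import Level using (0ℓ)
  open import Relation.Binary.PropositionalEquality.Core as ≡ using (_≡_)
  open import Relation.Nullary.Decidable.Core using (dec⇒maybe)

  -- Integers are written as differences m - n with m or n zero: the solver
  -- compares coefficients, and cancels terms, by the definitional equality of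
  -- these normal forms.
  reduce : ℕ × ℕ → ℕ × ℕ
  reduce (suc m , suc n) = reduce (m , n)
  reduce (m     , n)     = m , n

  differences : RawRing 0ℓ 0ℓ
  differences = record
    { Carrier = ℕ × ℕ
    ; _≈_ = _≡_
    ; _+_ = λ (a , b) (c , d) → reduce (a ℕ.+ c , b ℕ.+ d)
    ; _*_ = λ (a , b) (c , d) → reduce (a ℕ.* c ℕ.+ b ℕ.* d , a ℕ.* d ℕ.+ b ℕ.* c)
    ; -_ = λ (a , b) → b , a
    ; 0# = 0 , 0
    ; 1# = 1 , 0
    }

  module Solver {c ℓ} (R : CommutativeRing c ℓ) where
    open CommutativeRing R
    open import Algebra.Properties.Ring ring
    open import Algebra.Properties.AbelianGroup +-abelianGroup using (⁻¹-∙-comm)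
    open import Algebra.Properties.CommutativeSemigroup (CommutativeRing.+-commutativeSemigroup R) using (interchange)
    open import Algebra.Properties.Semiring.Mult semiring using (×-homo-+; ×1-homo-*) renaming (_×_ to _⋆_)
    open import Relation.Binary.Reasoning.Setoid setoid

    private
      ⟦_⟧ : ℕ × ℕ → Carrier
      ⟦ m , n ⟧ = m ⋆ 1# - n ⋆ 1#

      +-homo-raw : ∀ a b c d → ⟦ a ℕ.+ c , b ℕ.+ d ⟧ ≈ ⟦ a , b ⟧ + ⟦ c , d ⟧
      +-homo-raw a b c d = begin
        (a ℕ.+ c) ⋆ 1# - (b ℕ.+ d) ⋆ 1#               ≈⟨ +-cong (×-homo-+ 1# a c) (-‿cong (×-homo-+ 1# b d)) ⟩
        (a ⋆ 1# + c ⋆ 1#) - (b ⋆ 1# + d ⋆ 1#)         ≈⟨ +-congˡ (⁻¹-∙-comm _ _) ⟨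
        (a ⋆ 1# + c ⋆ 1#) + (- (b ⋆ 1#) - d ⋆ 1#)     ≈⟨ interchange _ _ _ _ ⟩
        (a ⋆ 1# - b ⋆ 1#) + (c ⋆ 1# - d ⋆ 1#)         ∎

      -- Each step of the reduction removes a summand 1 - 1.
      reduce-correct : ∀ p → ⟦ reduce p ⟧ ≈ ⟦ p ⟧
      reduce-correct (suc m , suc n) = begin
        ⟦ reduce (m , n) ⟧      ≈⟨ reduce-correct (m , n) ⟩
        ⟦ m , n ⟧               ≈⟨ +-identityˡ _ ⟨
        0# + ⟦ m , n ⟧          ≈⟨ +-congʳ (-‿inverseʳ (1 ⋆ 1#)) ⟨
        ⟦ 1 , 1 ⟧ + ⟦ m , n ⟧   ≈⟨ +-homo-raw 1 1 m n ⟨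
        ⟦ suc m , suc n ⟧       ∎
      reduce-correct (zero  , n)    = refl
      reduce-correct (suc m , zero) = refl

      *-homo-raw : ∀ a b c d →
        ⟦ a ℕ.* c ℕ.+ b ℕ.* d , a ℕ.* d ℕ.+ b ℕ.* c ⟧ ≈ ⟦ a , b ⟧ * ⟦ c , d ⟧
      *-homo-raw a b c d = begin
        ⟦ a ℕ.* c ℕ.+ b ℕ.* d , a ℕ.* d ℕ.+ b ℕ.* c ⟧         ≈⟨ +-homo-raw (a ℕ.* c) (a ℕ.* d) (b ℕ.* d) (b ℕ.* c) ⟩
        ⟦ a ℕ.* c , a ℕ.* d ⟧ + ⟦ b ℕ.* d , b ℕ.* c ⟧         ≈⟨ +-cong (left a c d) (trans (+-comm _ _) (trans (+-congˡ (sym (-‿involutive _)))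
                                                                (trans (⁻¹-∙-comm _ _) (-‿cong (left b c d))))) ⟩
        a ⋆ 1# * ⟦ c , d ⟧ - b ⋆ 1# * ⟦ c , d ⟧               ≈⟨ [y-z]x≈yx-zx _ _ _ ⟨
        ⟦ a , b ⟧ * ⟦ c , d ⟧                                 ∎
        where
        left : ∀ a c d → ⟦ a ℕ.* c , a ℕ.* d ⟧ ≈ a ⋆ 1# * ⟦ c , d ⟧
        left a c d = trans (+-cong (×1-homo-* a c) (-‿cong (×1-homo-* a d))) (sym (x[y-z]≈xy-xz _ _ _))

      homomorphism : differences ACR.-Raw-AlmostCommutative⟶ ACR.fromCommutativeRing R
      homomorphism = record
        { ⟦_⟧    = ⟦_⟧
        ; +-homo = λ (a , b) (c , d) → trans (reduce-correct (a ℕ.+ c , b ℕ.+ d)) (+-homo-raw a b c d)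
        ; *-homo = λ (a , b) (c , d) → trans (reduce-correct (a ℕ.* c ℕ.+ b ℕ.* d , a ℕ.* d ℕ.+ b ℕ.* c)) (*-homo-raw a b c d)
        ; -‿homo = λ (a , b) → trans (+-comm _ _) (trans (+-congˡ (sym (-‿involutive _))) (⁻¹-∙-comm _ _))
        ; 0-homo = -‿inverseʳ 0#
        ; 1-homo = trans (+-cong (+-identityʳ 1#) -0#≈0#) (+-identityʳ 1#)
        }

      _coeff≟_ : ∀ p q → Maybe (⟦ p ⟧ ≈ ⟦ q ⟧)
      p coeff≟ q = map (λ { ≡.refl → refl }) (dec⇒maybe (≡-dec _≟_ _≟_ p q))

    open Algebra.Solver.Ring differences (ACR.fromCommutativeRing R) homomorphism _coeff≟_ public
      using (solve; _:=_; _:+_; _:*_; _:-_; :-_)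

-- Counting in finite setoids: fibres, bijections, double counting.

module Counting where


  open import Defs
  open import Level using (Level; _⊔_) renaming (suc to lsuc)
  open import Data.Fin.Base as Fin using (Fin; zero; suc)
  import Data.Fin.Properties as Fin
  open import Data.Nat.Base using (ℕ; zero; suc; _+_; _*_; _≤_; z≤n; s≤s)
  open import Data.Nat.Properties hiding (_≟_)
  open import Algebra.Properties.Semiring.Sum +-*-semiring
    using (sum; sum-cong-≗; ∑-distrib-+; ∑-comm; *-distribʳ-sum; sum-replicate-zero)
  open import Data.Product.Base using (Σ; ∃; _×_; _,_; proj₁; proj₂)
  open import Function.Base using (_∘_)
  open import Function.Bundles using (Inverse)
  import Function.Construct.Composition as Compose
  import Function.Construct.Symmetry as Symmetry
  open import Data.Fin.Permutation using (↔⇒≡)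
  open import Relation.Binary.Bundles using (Setoid)
  open import Relation.Binary.Definitions using (_Respects_)
  open import Relation.Binary.PropositionalEquality.Core as ≡ using (_≡_; _≢_)
  import Relation.Binary.PropositionalEquality.Properties as ≡
  open import Relation.Nullary using (¬_; Dec; yes; no; ¬?; _×-dec_; contradiction)
  open import Relation.Nullary.Decidable using (map′)
  open import Relation.Unary using (Pred; Decidable)

  private
    variable
      a b c ℓ ℓ₁ ℓ₂ p r s : Level
      A : Set a
      B : Set b

  module _ {S : Setoid a ℓ₁} {T : Setoid b ℓ₂} where
    private
      module S = Setoid S
      module T = Setoid T

    mk-inverse : (to : S.Carrier → T.Carrier) (from : T.Carrier → S.Carrier) →
      (∀ {x y} → x S.≈ y → to x T.≈ to y) → (∀ {x y} → x T.≈ y → from x S.≈ from y) →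
      (∀ y → to (from y) T.≈ y) → (∀ x → from (to x) S.≈ x) → Inverse S T
    mk-inverse to from to-cong from-cong to∘from from∘to = record
      { to = to ; from = from ; to-cong = to-cong ; from-cong = from-cong
      ; inverse = (λ {y} x≈ → T.trans (to-cong x≈) (to∘from y))
                , (λ {x} y≈ → S.trans (from-cong y≈) (from∘to x)) }

  -- Because of this, the number of points in which a line meets the variety tells tangent lines
  -- from secant ones.
  HasCardinality-unique : {S : Setoid a ℓ} {k l : ℕ} →
    HasCardinality S k → HasCardinality S l → k ≡ l
  HasCardinality-unique S↔k S↔l = ↔⇒≡ (Compose.inverse (Symmetry.inverse S↔k) S↔l)

  χ : Dec A → ℕ
  χ (yes _) = 1
  χ (no  _) = 0

  χ-cong : (A → B) → (B → A) → (a? : Dec A) (b? : Dec B) → χ a? ≡ χ b?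
  χ-cong f g (yes a) (yes b) = ≡.refl
  χ-cong f g (yes a) (no ¬b) = contradiction (f a) ¬b
  χ-cong f g (no ¬a) (yes b) = contradiction (g b) ¬a
  χ-cong f g (no ¬a) (no ¬b) = ≡.refl

  χ-mono : (A → B) → (a? : Dec A) (b? : Dec B) → χ a? ≤ χ b?
  χ-mono f (yes a) (yes b) = s≤s z≤n
  χ-mono f (yes a) (no ¬b) = contradiction (f a) ¬b
  χ-mono f (no ¬a) _       = z≤n

  χ-yes : A → (a? : Dec A) → χ a? ≡ 1
  χ-yes a (yes _) = ≡.refl
  χ-yes a (no ¬a) = contradiction a ¬a

  χ-no : ¬ A → (a? : Dec A) → χ a? ≡ 0
  χ-no ¬a (yes a) = contradiction a ¬a
  χ-no ¬a (no _)  = ≡.refl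

  χ-split : (a? : Dec A) (b? : Dec B) → χ a? ≡ χ (a? ×-dec b?) + χ (a? ×-dec ¬? b?)
  χ-split (yes _) (yes _) = ≡.refl
  χ-split (yes _) (no  _) = ≡.refl
  χ-split (no  _) (yes _) = ≡.refl
  χ-split (no  _) (no  _) = ≡.refl

  sum-mono : ∀ {n} (f g : Fin n → ℕ) → (∀ i → f i ≤ g i) → sum f ≤ sum g
  sum-mono {zero}  f g f≤g = z≤n
  sum-mono {suc n} f g f≤g = +-mono-≤ (f≤g zero) (sum-mono (f ∘ suc) (g ∘ suc) (f≤g ∘ suc))

  -- A strict inequality at any index would make the sum of f strictly smaller than that of g.
  sum-≤-≡ : ∀ {n} (f g : Fin n → ℕ) → (∀ i → f i ≤ g i) → sum g ≤ sum f → ∀ i → f i ≡ g i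
  sum-≤-≡ {suc n} f g f≤g ∑g≤∑f = λ where
      zero    → f₀≡g₀
      (suc i) → sum-≤-≡ (f ∘ suc) (g ∘ suc) (f≤g ∘ suc)
        (+-cancelˡ-≤ (f zero) _ _ (≡.subst (λ x → x + _ ≤ _) (≡.sym f₀≡g₀) ∑g≤∑f)) i
    where
    f₀≡g₀ : f zero ≡ g zero
    f₀≡g₀ = ≤-antisym (f≤g zero) (+-cancelʳ-≤ _ _ _
      (≤-trans ∑g≤∑f (+-monoʳ-≤ (f zero) (sum-mono (f ∘ suc) (g ∘ suc) (f≤g ∘ suc)))))

  sum-zero : ∀ {n} (f : Fin n → ℕ) → (∀ i → f i ≡ 0) → sum f ≡ 0
  sum-zero {n} f f≡0 = ≡.trans (sum-cong-≗ f≡0) (sum-replicate-zero n)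

  sum-δ : ∀ {n} (f : Fin n → ℕ) i → f i ≡ 1 → (∀ j → i ≢ j → f j ≡ 0) → sum f ≡ 1
  sum-δ f zero    fi≡1 f≡0 = ≡.cong₂ _+_ fi≡1 (sum-zero (f ∘ suc) λ j → f≡0 (suc j) λ ())
  sum-δ f (suc i) fi≡1 f≡0 = ≡.cong₂ _+_ (f≡0 zero λ ())
    (sum-δ (f ∘ suc) i fi≡1 λ j i≢j → f≡0 (suc j) (i≢j ∘ Fin.suc-injective))

  sum-const : ∀ n k → sum {n} (λ _ → k) ≡ n * k
  sum-const zero    k = ≡.refl
  sum-const (suc n) k = ≡.cong (k +_) (sum-const n k)

  sum≢0 : ∀ {n} (f : Fin n → ℕ) → sum f ≢ 0 → ∃ λ i → f i ≢ 0
  sum≢0 {zero}  f ∑≢0 = contradiction ≡.refl ∑≢0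
  sum≢0 {suc n} f ∑≢0 with f zero in eq
  ... | suc _ = zero , λ f₀≡0 → 0≢1+n (≡.trans (≡.sym f₀≡0) eq)
  ... | zero  with i , fi≢0 ← sum≢0 (f ∘ suc) ∑≢0 = suc i , fi≢0

  -- Induction on n: `zero`, if it satisfies P, is put in front of the numbering of the rest. The
  -- proof of P attached to an element may change on the way there and back, which the equality of
  -- `Subset` ignores.
  Fin-subset : ∀ {n} {P : Pred (Fin n) p} (P? : Decidable P) →
    HasCardinality (Subset (≡.setoid (Fin n)) P) (sum (χ ∘ P?))
  Fin-subset {n = zero} P? = mk-inverse (λ ()) (λ ()) (λ { {() , _} }) (λ { {()} }) (λ ()) (λ ())
  Fin-subset {n = suc n} {P} P? with P? zero | Fin-subset (P? ∘ suc)
  ... | yes p₀ | rest = mk-inverse to from to-cong (λ { ≡.refl → ≡.refl }) to∘from from∘to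
    where
    module R = Inverse rest
    to : Σ (Fin (suc n)) P → Fin (suc (sum (χ ∘ P? ∘ suc)))
    to (zero  , _) = zero
    to (suc i , p) = suc (R.to (i , p))
    from : Fin (suc (sum (χ ∘ P? ∘ suc))) → Σ (Fin (suc n)) P
    from zero    = zero , p₀
    from (suc k) = suc (proj₁ (R.from k)) , proj₂ (R.from k)
    to-cong : ∀ {x y} → proj₁ x ≡ proj₁ y → to x ≡ to y
    to-cong {zero  , _} ≡.refl = ≡.refl
    to-cong {suc i , _} ≡.refl = ≡.cong suc (R.to-cong ≡.refl)
    to∘from : ∀ k → to (from k) ≡ k
    to∘from zero    = ≡.refl
    to∘from (suc k) = ≡.cong suc (R.strictlyInverseˡ k)
    from∘to : ∀ x → proj₁ (from (to x)) ≡ proj₁ x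
    from∘to (zero  , _) = ≡.refl
    from∘to (suc i , p) = ≡.cong suc (R.strictlyInverseʳ (i , p))
  ... | no ¬p₀ | rest = mk-inverse to from to-cong (λ { ≡.refl → ≡.refl }) R.strictlyInverseˡ from∘to
    where
    module R = Inverse rest
    to : Σ (Fin (suc n)) P → Fin (sum (χ ∘ P? ∘ suc))
    to (zero  , p) = contradiction p ¬p₀
    to (suc i , p) = R.to (i , p)
    from : Fin (sum (χ ∘ P? ∘ suc)) → Σ (Fin (suc n)) P
    from k = suc (proj₁ (R.from k)) , proj₂ (R.from k)
    to-cong : ∀ {x y} → proj₁ x ≡ proj₁ y → to x ≡ to y
    to-cong {zero  , p} ≡.refl = contradiction p ¬p₀
    to-cong {suc i , _} ≡.refl = R.to-cong ≡.refl
    from∘to : ∀ x → proj₁ (from (to x)) ≡ proj₁ x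
    from∘to (zero  , p) = contradiction p ¬p₀
    from∘to (suc i , p) = ≡.cong suc (R.strictlyInverseʳ (i , p))

  record FiniteSetoid a ℓ : Set (lsuc (a ⊔ ℓ)) where
    field
      setoid      : Setoid a ℓ
      size        : ℕ
      enumeration : HasCardinality setoid size
    open Setoid setoid public
    open Inverse enumeration public using ()
      renaming (to to index; from to element; to-cong to index-cong; from-cong to element-cong
               ; strictlyInverseˡ to index∘element; strictlyInverseʳ to element∘index)

    infix 4 _≟_
    _≟_ : ∀ x y → Dec (x ≈ y)
    x ≟ y = map′ (λ i≡j → trans (sym (element∘index x)) (trans (element-cong i≡j) (element∘index y)))
                 index-cong (index x Fin.≟ index y)

  module Count (S : FiniteSetoid a ℓ) where
    open FiniteSetoid S

    opaque
      ∑ : (Carrier → ℕ) → ℕ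
      ∑ f = sum (f ∘ element)

      ∑-cong : ∀ {f g : Carrier → ℕ} → (∀ x → f x ≡ g x) → ∑ f ≡ ∑ g
      ∑-cong f≗g = sum-cong-≗ (f≗g ∘ element)

      ∑-+ : ∀ f g → ∑ (λ x → f x + g x) ≡ ∑ f + ∑ g
      ∑-+ f g = ∑-distrib-+ (f ∘ element) (g ∘ element)

      ∑-* : ∀ f k → ∑ (λ x → f x * k) ≡ ∑ f * k
      ∑-* f k = ≡.sym (*-distribʳ-sum k (f ∘ element))

      # : {P : Pred Carrier p} → Decidable P → ℕ
      # P? = ∑ (λ x → χ (P? x))

      ∑-mono : ∀ {f g : Carrier → ℕ} → (∀ x → f x ≤ g x) → ∑ f ≤ ∑ g
      ∑-mono f≤g = sum-mono _ _ (f≤g ∘ element)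

      -- The equality is at the representative of x that the enumeration uses: f and g are not
      -- assumed to respect `_≈_`, and the sum sees only that member of the class.
      ∑-≤-≡ : ∀ {f g : Carrier → ℕ} → (∀ x → f x ≤ g x) → ∑ g ≤ ∑ f →
        ∀ x → f (element (index x)) ≡ g (element (index x))
      ∑-≤-≡ f≤g ∑g≤∑f x = sum-≤-≡ _ _ (f≤g ∘ element) ∑g≤∑f (index x)

    module _ {P : Pred Carrier p} (P? : Decidable P) where
      opaque
        unfolding ∑ #

        ∑χ-* : ∀ k → ∑ (λ x → χ (P? x) * k) ≡ # P? * k
        ∑χ-* = ∑-* (λ x → χ (P? x))

        #-none : (∀ x → ¬ P x) → # P? ≡ 0
        #-none ¬P = sum-zero _ λ i → χ-no (¬P _) (P? (element i))

        #-all : (∀ x → P x) → # P? ≡ size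
        #-all Px = ≡.trans (sum-cong-≗ λ i → χ-yes (Px _) (P? (element i)))
          (≡.trans (sum-const size 1) (*-identityʳ size))

        #-one : P Respects _≈_ → ∀ x → P x → (∀ y → P y → y ≈ x) → # P? ≡ 1
        #-one resp x px unique = sum-δ (λ i → χ (P? (element i))) (index x)
          (χ-yes (resp (sym (element∘index x)) px) (P? _))
          λ j x≢j → χ-no (λ pj → x≢j (≡.trans (≡.sym (index-cong (unique _ pj))) (index∘element j))) (P? _)

        #-witness : # P? ≢ 0 → ∃ P
        #-witness #≢0 with i , χ≢0 ← sum≢0 _ #≢0 with P? (element i)
        ... | yes p = element i , p
        ... | no  _ = contradiction ≡.refl χ≢0

        search : P Respects _≈_ → Dec (∃ P)
        search resp = map′ (λ (i , p) → element i , p)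
          (λ (x , p) → index x , resp (sym (element∘index x)) p) (Fin.any? (P? ∘ element))

        subset-card : P Respects _≈_ → HasCardinality (Subset setoid P) (# P?)
        subset-card resp = Compose.inverse
          (mk-inverse (λ (x , p) → index x , resp (sym (element∘index x)) p)
                   (λ (i , p) → element i , p)
                   index-cong element-cong
                   (λ (i , _) → index∘element i) (λ (x , _) → element∘index x))
          (Fin-subset (P? ∘ element))

    module _ {P : Pred Carrier p} (P? : Decidable P) {Q : Pred Carrier r} (Q? : Decidable Q) where
      opaque
        unfolding ∑ #

        #-cong : (∀ x → P x → Q x) → (∀ x → Q x → P x) → # P? ≡ # Q?
        #-cong f g = ∑-cong λ x → χ-cong (f x) (g x) (P? x) (Q? x)

        #-mono : (∀ x → P x → Q x) → # P? ≤ # Q?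
        #-mono f = ∑-mono λ x → χ-mono (f x) (P? x) (Q? x)

        #-split : # P? ≡ # (λ x → P? x ×-dec Q? x) + # (λ x → P? x ×-dec ¬? (Q? x))
        #-split = ≡.trans (∑-cong λ x → χ-split (P? x) (Q? x)) (∑-+ (λ x → χ (P? x ×-dec Q? x)) (λ x → χ (P? x ×-dec ¬? (Q? x))))

    opaque
      unfolding ∑ #

      -- One row of a double count: k entries if A holds and none otherwise. As a single product it
      -- can be summed over all rows.
      #-fibre : {P : Pred Carrier p} (P? : Decidable P) (a? : Dec A) {k : ℕ} →
        (A → # P? ≡ k) → (¬ A → ∀ x → ¬ P x) → # P? ≡ χ a? * k
      #-fibre P? (yes a) #≡k _  = ≡.trans (#≡k a) (≡.sym (+-identityʳ _))
      #-fibre P? (no ¬a) _ none = #-none P? (none ¬a)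

  module DoubleCount (S : FiniteSetoid a ℓ₁) (T : FiniteSetoid b ℓ₂) where
    private
      module S = FiniteSetoid S
      module T = FiniteSetoid T
      module CS = Count S
      module CT = Count T

    opaque
      unfolding CS.∑ CT.∑ CS.# CT.#

      ∑-swap : (f : S.Carrier → T.Carrier → ℕ) → CS.∑ (λ x → CT.∑ (f x)) ≡ CT.∑ (λ y → CS.∑ (λ x → f x y))
      ∑-swap f = ∑-comm (λ i j → f (S.element i) (T.element j))

      ∑-swap-# : {R : S.Carrier → T.Carrier → Set r} (R? : ∀ x y → Dec (R x y)) →
        CS.∑ (λ x → CT.# (R? x)) ≡ CT.∑ (λ y → CS.# (λ x → R? x y))
      ∑-swap-# R? = ∑-swap (λ x y → χ (R? x y))

    -- Both sides count the pairs in R.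
    double-count : {P : Pred S.Carrier p} (P? : Decidable P) {Q : Pred T.Carrier s} (Q? : Decidable Q)
      {R : S.Carrier → T.Carrier → Set r} (R? : ∀ x y → Dec (R x y)) {k l : ℕ} →
      (∀ {x y} → R x y → P x) → (∀ {x y} → R x y → Q y) →
      (∀ x → P x → CT.# (R? x) ≡ k) → (∀ y → Q y → CS.# (λ x → R? x y) ≡ l) →
      CS.# P? * k ≡ CT.# Q? * l
    double-count P? Q? R? {k} {l} R⇒P R⇒Q row column = begin
      CS.# P? * k                        ≡⟨ CS.∑χ-* P? k ⟨
      CS.∑ (λ x → χ (P? x) * k)          ≡⟨ CS.∑-cong (λ x → CT.#-fibre (R? x) (P? x) (row x) (λ ¬p y r → ¬p (R⇒P r))) ⟨
      CS.∑ (λ x → CT.# (R? x))           ≡⟨ ∑-swap-# R? ⟩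
      CT.∑ (λ y → CS.# (λ x → R? x y))   ≡⟨ CT.∑-cong (λ y → CS.#-fibre (λ x → R? x y) (Q? y) (column y) (λ ¬q x r → ¬q (R⇒Q r))) ⟩
      CT.∑ (λ y → χ (Q? y) * l)          ≡⟨ CT.∑χ-* Q? l ⟩
      CT.# Q? * l                        ∎
      where open ≡.≡-Reasoning

    -- Double counting of the graph of σ over P, in which every row and every column has one
    -- element.
    #-bijection : {P : Pred S.Carrier p} (P? : Decidable P) {Q : Pred T.Carrier r} (Q? : Decidable Q) →
      Q Respects T._≈_ → (σ : Inverse S.setoid T.setoid) →
      (∀ {x} → P x → Q (Inverse.to σ x)) → (∀ {x} → Q (Inverse.to σ x) → P x) → CS.# P? ≡ CT.# Q?
    #-bijection {P = P} P? Q? resp σ P⇒Q Q⇒P = ≡.trans (≡.sym (*-identityʳ _)) (≡.trans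
      (double-count P? Q? {R = λ x y → P x × to x T.≈ y} (λ x y → P? x ×-dec (to x T.≟ y))
        proj₁ (λ (px , eq) → resp eq (P⇒Q px))
        (λ x px → ≡.trans (CT.#-cong _ (λ y → to x T.≟ y) (λ _ → proj₂) (λ y eq → px , eq))
                          (CT.#-one _ (λ y≈z eq → T.trans eq y≈z) (to x) T.refl (λ _ → T.sym)))
        (λ y qy → ≡.trans (CS.#-cong _ (λ x → to x T.≟ y) (λ _ → proj₂) (λ x eq → Q⇒P (resp (T.sym eq) qy) , eq))
                          (CS.#-one _ (λ x≈z eq → T.trans (to-cong (S.sym x≈z)) eq)
                            (from y) (strictlyInverseˡ y) (λ x eq → S.sym (inverseʳ (T.sym eq))))))
      (*-identityʳ _))
      where open Inverse σ

    -- For maps that are mutually inverse only on P and Q, such as a projection and the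
    -- parametrisation of one of its fibres.
    #-subset-bijection : {P : Pred S.Carrier p} (P? : Decidable P) {Q : Pred T.Carrier r} (Q? : Decidable Q) →
      P Respects S._≈_ → Q Respects T._≈_ → (f : S.Carrier → T.Carrier) (g : T.Carrier → S.Carrier) →
      (∀ {x y} → x S.≈ y → f x T.≈ f y) → (∀ {x y} → x T.≈ y → g x S.≈ g y) →
      (∀ {x} → P x → Q (f x)) → (∀ {y} → Q y → P (g y)) →
      (∀ {x} → P x → g (f x) S.≈ x) → (∀ {y} → Q y → f (g y) T.≈ y) → CS.# P? ≡ CT.# Q?
    #-subset-bijection P? Q? P-resp Q-resp f g f-cong g-cong P⇒Q Q⇒P g∘f f∘g =
      HasCardinality-unique (CS.subset-card P? P-resp) (Compose.inverse
        (mk-inverse (λ (x , px) → f x , P⇒Q px) (λ (y , qy) → g y , Q⇒P qy) f-cong g-cong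
          (λ (y , qy) → f∘g qy) (λ (x , px) → g∘f px))
        (CT.subset-card Q? Q-resp))

    -- Double counting of the graph of f over C: each x has one image, each y has k preimages.
    #-fibres : {P : Pred S.Carrier p} (P? : Decidable P) {C : Pred T.Carrier r} (C? : Decidable C) →
      C Respects T._≈_ → (f : S.Carrier → T.Carrier) → {k : ℕ} →
      (∀ y → C y → CS.# (λ x → P? x ×-dec (f x T.≟ y)) ≡ k) →
      CS.# (λ x → P? x ×-dec C? (f x)) ≡ CT.# C? * k
    #-fibres {P = P} P? {C} C? resp f {k} fibre≡k = ≡.trans (≡.sym (*-identityʳ _))
      (double-count (λ x → P? x ×-dec C? (f x)) C?
        {R = λ x y → (P x × f x T.≈ y) × C y} (λ x y → (P? x ×-dec (f x T.≟ y)) ×-dec C? y)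
        (λ ((px , eq) , cy) → px , resp (T.sym eq) cy) proj₂
        (λ x (px , cfx) → ≡.trans (CT.#-cong _ (λ y → f x T.≟ y) (λ _ → proj₂ ∘ proj₁) (λ y eq → (px , eq) , resp eq cfx))
                                  (CT.#-one _ (λ y≈z eq → T.trans eq y≈z) (f x) T.refl (λ _ → T.sym)))
        (λ y cy → ≡.trans (CS.#-cong _ _ (λ _ → proj₁) (λ _ r → r , cy)) (fibre≡k y cy)))

    -- m fibres of size at most k can only hold m * k elements if all are full.
    pigeonhole : {P : Pred S.Carrier p} (P? : Decidable P) {C : Pred T.Carrier r} (C? : Decidable C) →
      C Respects T._≈_ → (f : S.Carrier → T.Carrier) → (∀ {x y} → P x → f x T.≈ y → C y) → {k m : ℕ} →
      CT.# C? ≤ m → (∀ y → C y → CS.# (λ x → P? x ×-dec (f x T.≟ y)) ≤ k) →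
      m * k ≤ CS.# P? → ∀ y → C y → CS.# (λ x → P? x ×-dec (f x T.≟ y)) ≡ k
    pigeonhole {P = P} P? C? resp f P⇒C {k} {m} #C≤m small full y cy = begin
      fibre y                               ≡⟨ CS.#-cong _ _ (λ _ (px , eq) → px , T.trans eq (T.sym y′≈y)) (λ _ (px , eq) → px , T.trans eq y′≈y) ⟩
      fibre y′                              ≡⟨ CT.∑-≤-≡ fibre≤ total y ⟩
      χ (C? y′) * k                         ≡⟨ ≡.cong (_* k) (χ-yes (resp (T.sym y′≈y) cy) (C? y′)) ⟩
      1 * k                                 ≡⟨ *-identityˡ k ⟩
      k                                     ∎
      where
      open ≡.≡-Reasoning
      fibre : T.Carrier → ℕ
      fibre y = CS.# (λ x → P? x ×-dec (f x T.≟ y))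
      y′ : T.Carrier
      y′ = T.element (T.index y)
      y′≈y : y′ T.≈ y
      y′≈y = T.element∘index y
      fibre≤ : ∀ y → fibre y ≤ χ (C? y) * k
      fibre≤ y with C? y
      ... | yes cy = ≤-trans (small y cy) (≤-reflexive (≡.sym (*-identityˡ k)))
      ... | no ¬cy = ≤-reflexive (CS.#-none _ λ x (px , eq) → ¬cy (P⇒C px eq))
      #P≡∑ : CS.# P? ≡ CT.∑ fibre
      #P≡∑ = ≡.trans (≡.trans (≡.sym (*-identityʳ _)) (≡.sym (CS.∑χ-* P? 1))) (≡.trans (CS.∑-cong λ x → ≡.sym (CT.#-fibre _ (P? x)
                (λ px → ≡.trans (CT.#-cong _ (λ y → f x T.≟ y) (λ _ → proj₂) (λ y eq → px , eq))
                          (CT.#-one _ (λ y≈z eq → T.trans eq y≈z) (f x) T.refl (λ _ → T.sym)))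
                (λ ¬px y (px , _) → ¬px px))) (∑-swap-# _))
      total : CT.∑ (λ y → χ (C? y) * k) ≤ CT.∑ fibre
      total = ≤-trans (≤-reflexive (CT.∑χ-* C? k)) (≤-trans (*-monoˡ-≤ k #C≤m) (≤-trans full (≤-reflexive #P≡∑)))

-- Finite fields: Fermat's theorem, roots of polynomials, the Frobenius map.

module FiniteField where

  open Counting
  open RingSolver
  open import Defs using (HasCardinality)
  open import Algebra.Bundles using (CommutativeMonoid; CommutativeRing)
  open import Data.Fin.Base as Fin using (Fin; zero; suc; toℕ; fromℕ)
  import Data.Fin.Properties as Fin
  open import Data.List.Base using (List; []; _∷_; length; replicate)
  open import Data.Nat.Base as ℕ using (ℕ; zero; suc; s≤s; z≤n; _≤_; _<_; _∸_; _!)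
  open import Data.Nat.Combinatorics using (_C_; nCn≡1; nCk≡n!/k![n-k]!; k![n∸k]!∣n!)
  open import Data.Nat.Divisibility using (_∣_; divides; ∣⇒≤; ∣m⇒∣m*n)
  open import Data.Nat.Primality using (Prime; euclidsLemma; ¬prime[0]; ¬prime[1])
  open import Data.Nat.DivMod using (m/n*n≡m)
  import Data.Nat.Properties as ℕ
  open import Data.Product.Base using (∃; _×_; _,_; proj₂)
  open import Data.Sum.Base using ([_,_]′)
  open import Function.Base using (_∘_; id)
  open import Function.Bundles using (Inverse)
  import Function.Construct.Composition as Compose
  import Function.Construct.Symmetry as Symmetry
  open import Level using (Level; _⊔_) renaming (suc to lsuc)
  open import Relation.Binary.PropositionalEquality.Core as ≡ using (_≡_; _≢_)
  import Relation.Binary.PropositionalEquality.Properties as ≡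
  open import Relation.Nullary using (¬_; yes; no; contradiction)

  private
    variable
      c ℓ : Level

  -- By Euclid's lemma p would divide one of the factors, and these are all smaller than p.
  prime∤! : ∀ {p} → Prime p → ∀ k → k < p → ¬ p ∣ k !
  prime∤! {p} pp zero    k<p p∣1 = ℕ.<⇒≱ (prime>1 pp) (∣⇒≤ p∣1)
    where
    prime>1 : ∀ {p} → Prime p → 1 < p
    prime>1 {zero}        pp = contradiction pp ¬prime[0]
    prime>1 {suc zero}    pp = contradiction pp ¬prime[1]
    prime>1 {suc (suc p)} pp = s≤s (s≤s z≤n)
  prime∤! {p} pp (suc k) k<p p∣ = [ (λ p∣k → ℕ.<⇒≱ k<p (∣⇒≤ p∣k)) , prime∤! pp k (ℕ.<⇒≤ k<p) ]′
    (euclidsLemma (suc k) (k !) pp p∣)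

  -- The prime p divides `p !`, which is the binomial coefficient times `k !` and `(p ∸ k) !`, but
  -- it divides neither of these factorials.
  prime∣C : ∀ {p} → Prime p → ∀ k → 0 < k → k < p → p ∣ p C k
  prime∣C {suc p-1} pp k 0<k k<p = [ id , (λ p∣ → contradiction ([ prime∤! pp k k<p , prime∤! pp (p ∸ k) p∸k<p ]′
      (euclidsLemma (k !) _ pp p∣)) id) ]′ (euclidsLemma (p C k) _ pp p∣p!)
    where
    p = suc p-1
    instance _ = k ℕ.!* (p ∸ k) !≢0
    p∸k<p : p ∸ k < p
    p∸k<p = ℕ.∸-monoʳ-< 0<k (ℕ.<⇒≤ k<p)
    p∣p! : p ∣ (p C k) ℕ.* (k ! ℕ.* (p ∸ k) !)
    p∣p! = ≡.subst (p ∣_) (≡.sym (≡.trans (≡.cong (ℕ._* (k ! ℕ.* (p ∸ k) !)) (nCk≡n!/k![n-k]! (ℕ.<⇒≤ k<p)))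
      (m/n*n≡m (k![n∸k]!∣n! (ℕ.<⇒≤ k<p))))) (∣m⇒∣m*n (p-1 !) (divides 1 (≡.sym (ℕ.*-identityˡ p))))

  module _ (M : CommutativeMonoid c ℓ) where
    open CommutativeMonoid M
    open import Algebra.Properties.CommutativeMonoid.Sum M using (sum; sum-cong-≋; sum-replicate-zero)

    sum-single : ∀ {n} (f : Fin n → Carrier) i {x} → f i ≈ x → (∀ j → i ≢ j → f j ≈ ε) → sum f ≈ x
    sum-single {suc n} f zero    fi≈x f≈ε = trans (∙-cong fi≈x
      (trans (sum-cong-≋ λ j → f≈ε (suc j) λ ()) (sum-replicate-zero n))) (identityʳ _)
    sum-single f (suc i) fi≈x f≈ε = trans (∙-cong (f≈ε zero λ ())
      (sum-single (f ∘ suc) i fi≈x λ j i≢j → f≈ε (suc j) (i≢j ∘ Fin.suc-injective))) (identityˡ _)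

  -- The classical axioms, with nonzero meaning `¬ x ≈ 0#`; apartness is translated into this once
  -- and does not occur in the counting.
  record IsFiniteField (R : CommutativeRing c ℓ) (size : ℕ) : Set (c ⊔ ℓ) where
    open CommutativeRing R
    field
      enumeration : HasCardinality setoid size
      inverse     : ∀ x → ¬ x ≈ 0# → ∃ λ y → y * x ≈ 1#
      1≉0         : ¬ 1# ≈ 0#

  module FiniteFieldProperties (R : CommutativeRing c ℓ) {size : ℕ} (isFiniteField : IsFiniteField R size) where
    open CommutativeRing R hiding (zero)
    open IsFiniteField isFiniteField
    open Solver R
    open import Algebra.Properties.Semiring.Exp semiring
    open import Algebra.Properties.Semiring.Mult semiring
      using (×-assoc-*; ×-congʳ; ×-homo-1; ×1-homo-*) renaming (_×_ to _⋆_)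
    open import Algebra.Properties.CommutativeMonoid.Sum +-commutativeMonoid
      using (sum; sum-cong-≋; ∑-distrib-+; sum-permute; sum-replicate)
    open import Algebra.Properties.CommutativeMonoid.Sum *-commutativeMonoid
      using () renaming (sum to product; sum-cong-≋ to product-cong; ∑-distrib-+ to ∏-distrib-*; sum-permute to product-permute; sum-replicate to product-replicate)
    open import Algebra.Properties.CommutativeSemiring.Binomial commutativeSemiring using (binomialTerm) renaming (theorem to binomial-theorem)
    open import Algebra.Properties.Ring ring public
      using (-0#≈0#; -‿involutive; +-cancelˡ; x∙y⁻¹≈ε⇒x≈y; x≈y⇒x∙y⁻¹≈ε)
    open import Relation.Binary.Reasoning.Setoid setoid

    finite : FiniteSetoid c ℓ
    finite = record { setoid = setoid ; size = size ; enumeration = enumeration }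

    open FiniteSetoid finite public using (_≟_; element; index; element∘index; index∘element; index-cong)
    open Count finite

    *-cancelˡ-≉0 : ∀ {x y z} → ¬ x ≈ 0# → x * y ≈ x * z → y ≈ z
    *-cancelˡ-≉0 {x} {y} {z} x≉0 xy≈xz with x⁻¹ , x⁻¹x≈1 ← inverse x x≉0 = begin
      y               ≈⟨ *-identityˡ y ⟨
      1# * y          ≈⟨ *-congʳ x⁻¹x≈1 ⟨
      x⁻¹ * x * y     ≈⟨ *-assoc _ _ _ ⟩
      x⁻¹ * (x * y)   ≈⟨ *-congˡ xy≈xz ⟩
      x⁻¹ * (x * z)   ≈⟨ *-assoc _ _ _ ⟨
      x⁻¹ * x * z     ≈⟨ *-congʳ x⁻¹x≈1 ⟩
      1# * z          ≈⟨ *-identityˡ z ⟩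
      z               ∎

    *≈0⇒≈0 : ∀ {x y} → ¬ x ≈ 0# → x * y ≈ 0# → y ≈ 0#
    *≈0⇒≈0 x≉0 xy≈0 = *-cancelˡ-≉0 x≉0 (trans xy≈0 (sym (zeroʳ _)))

    *≉0 : ∀ {x y} → ¬ x ≈ 0# → ¬ y ≈ 0# → ¬ x * y ≈ 0#
    *≉0 x≉0 y≉0 xy≈0 = y≉0 (*≈0⇒≈0 x≉0 xy≈0)

    ^≉0 : ∀ {x} → ¬ x ≈ 0# → ∀ n → ¬ x ^ n ≈ 0#
    ^≉0 x≉0 zero    = 1≉0
    ^≉0 x≉0 (suc n) = *≉0 x≉0 (^≉0 x≉0 n)

    product≉0 : ∀ {n} (f : Fin n → Carrier) → (∀ i → ¬ f i ≈ 0#) → ¬ product f ≈ 0#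
    product≉0 {zero}  f f≉0 = 1≉0
    product≉0 {suc n} f f≉0 = *≉0 (f≉0 zero) (product≉0 (f ∘ suc) (f≉0 ∘ suc))

    private
      permutation : Inverse setoid setoid → Inverse (≡.setoid (Fin size)) (≡.setoid (Fin size))
      permutation σ = Compose.inverse (Symmetry.inverse enumeration) (Compose.inverse σ enumeration)

      translation : Inverse setoid setoid
      translation = mk-inverse (_+ 1#) (_- 1#) +-congʳ +-congʳ
        (λ y → solve 2 (λ y a → y :- a :+ a := y) refl y 1#)
        (λ y → solve 2 (λ y a → y :+ a :- a := y) refl y 1#)

      scaling : ∀ x → ¬ x ≈ 0# → Inverse setoid setoid
      scaling x x≉0 with x⁻¹ , x⁻¹x≈1 ← inverse x x≉0 = mk-inverse (x *_) (x⁻¹ *_) *-congˡ *-congˡ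
        (λ y → trans (sym (*-assoc _ _ _)) (trans (*-congʳ (trans (*-comm _ _) x⁻¹x≈1)) (*-identityˡ y)))
        (λ y → trans (sym (*-assoc _ _ _)) (trans (*-congʳ x⁻¹x≈1) (*-identityˡ y)))

    -- Translation by 1 permutes the elements, so their sum equals itself plus size ⋆ 1.
    size⋆1≈0 : size ⋆ 1# ≈ 0#
    size⋆1≈0 = +-cancelˡ (sum element) _ _ (begin
      sum element + size ⋆ 1#                            ≈⟨ +-congˡ (sum-replicate size) ⟨
      sum element + sum {size} (λ _ → 1#)                ≈⟨ ∑-distrib-+ element (λ _ → 1#) ⟨
      sum (λ i → element i + 1#)                         ≈⟨ sum-cong-≋ {size} {λ i → element (index (element i + 1#))} {λ i → element i + 1#} (λ i → element∘index (element i + 1#)) ⟨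
      sum (λ i → element (index (element i + 1#)))       ≈⟨ sum-permute element (permutation translation) ⟨
      sum element                                        ≈⟨ +-identityʳ _ ⟨
      sum element + 0#                                   ∎)

    private
      size≢0 : size ≢ 0
      size≢0 size≡0 with () ← ≡.subst Fin size≡0 (index 0#)

      0^ : ∀ n → n ≢ 0 → 0# ^ n ≈ 0#
      0^ zero    n≢0 = contradiction ≡.refl n≢0
      0^ (suc n) _   = zeroˡ _

      -- Multiplication by x permutes the nonzero elements, so their product is
      -- unchanged by the factors x.
      fermat : ∀ x → ¬ x ≈ 0# → x ^ size ≈ x
      fermat x x≉0 = begin
        x ^ size                                        ≈⟨ product-replicate size ⟨
        product {size} (λ _ → x)                        ≈⟨ product-cong {size} {λ i → v (element i) * w (element i)} {λ _ → x} (λ i → v*w (element i)) ⟨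
        product (λ i → v (element i) * w (element i))   ≈⟨ ∏-distrib-* (v ∘ element) (w ∘ element) ⟩
        product (v ∘ element) * product (w ∘ element)   ≈⟨ *-cong ∏v≈1 (sum-single *-commutativeMonoid (w ∘ element) (index 0#) (w-zero (element∘index 0#)) (λ j 0≢j → w-nonzero λ j≈0 → 0≢j (≡.trans (≡.sym (index-cong j≈0)) (index∘element j)))) ⟩
        1# * x                                          ≈⟨ *-identityˡ x ⟩
        x                                               ∎
        where
        -- `u` replaces 0 by 1, so that its product runs over the nonzero elements. `v y` is the
        -- factor that `u y` acquires when y is multiplied by x: it is x except at 0. `w` makes up
        -- for that exception, so that `v y * w y` is always x and the product of `w` is a single x.
        u v w : Carrier → Carrier
        u y with y ≟ 0#
        ... | yes _ = 1#
        ... | no  _ = y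
        v y with y ≟ 0#
        ... | yes _ = 1#
        ... | no  _ = x
        w y with y ≟ 0#
        ... | yes _ = x
        ... | no  _ = 1#
        v*w : ∀ y → v y * w y ≈ x
        v*w y with y ≟ 0#
        ... | yes _ = *-identityˡ x
        ... | no  _ = *-identityʳ x
        w-zero : ∀ {y} → y ≈ 0# → w y ≈ x
        w-zero {y} y≈0 with y ≟ 0#
        ... | yes _  = refl
        ... | no y≉0 = contradiction y≈0 y≉0
        w-nonzero : ∀ {y} → ¬ y ≈ 0# → w y ≈ 1#
        w-nonzero {y} y≉0 with y ≟ 0#
        ... | yes y≈0 = contradiction y≈0 y≉0
        ... | no  _   = refl
        u≉0 : ∀ y → ¬ u y ≈ 0#
        u≉0 y with y ≟ 0#
        ... | yes _  = 1≉0
        ... | no y≉0 = y≉0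
        u-cong : ∀ {y z} → y ≈ z → u y ≈ u z
        u-cong {y} {z} y≈z with y ≟ 0# | z ≟ 0#
        ... | yes _   | yes _   = refl
        ... | yes y≈0 | no z≉0  = contradiction (trans (sym y≈z) y≈0) z≉0
        ... | no y≉0  | yes z≈0 = contradiction (trans y≈z z≈0) y≉0
        ... | no _    | no _    = y≈z
        u-scale : ∀ y → u (x * y) ≈ u y * v y
        u-scale y with y ≟ 0# | x * y ≟ 0#
        ... | yes _   | yes _    = sym (*-identityˡ 1#)
        ... | yes y≈0 | no xy≉0  = contradiction (trans (*-congˡ y≈0) (zeroʳ x)) xy≉0
        ... | no y≉0  | yes xy≈0 = contradiction xy≈0 (*≉0 x≉0 y≉0)
        ... | no _    | no _     = *-comm x y
        ∏v≈1 : product (v ∘ element) ≈ 1#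
        ∏v≈1 = *-cancelˡ-≉0 (product≉0 (u ∘ element) (u≉0 ∘ element)) (begin
          product (u ∘ element) * product (v ∘ element)   ≈⟨ ∏-distrib-* (u ∘ element) (v ∘ element) ⟨
          product (λ i → u (element i) * v (element i))   ≈⟨ product-cong {size} {λ i → u (x * element i)} {λ i → u (element i) * v (element i)} (λ i → u-scale (element i)) ⟨
          product (λ i → u (x * element i))               ≈⟨ product-cong {size} {λ i → u (element (index (x * element i)))} {λ i → u (x * element i)} (λ i → u-cong (element∘index (x * element i))) ⟨
          product (λ i → u (element (index (x * element i)))) ≈⟨ product-permute (u ∘ element) (permutation (scaling x x≉0)) ⟨
          product (u ∘ element)                           ≈⟨ *-identityʳ _ ⟨
          product (u ∘ element) * 1#                      ∎)

    x^size≈x : ∀ x → x ^ size ≈ x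
    x^size≈x x with x ≟ 0#
    ... | no x≉0  = fermat x x≉0
    ... | yes x≈0 = trans (^-congˡ size x≈0) (trans (0^ size size≢0) (sym x≈0))

    -- The monic polynomial whose lower coefficients, in ascending order, are listed.
    eval : List Carrier → Carrier → Carrier
    eval []       x = 1#
    eval (a ∷ as) x = a + x * eval as x

    private
      -- Synthetic division by X - r: the coefficients of the quotient are the values at r of the
      -- tails of the polynomial. The value at the constant polynomial 1 is a default.
      quotient : List Carrier → Carrier → List Carrier
      quotient []           r = []
      quotient (a ∷ [])     r = []
      quotient (a ∷ b ∷ bs) r = eval (b ∷ bs) r ∷ quotient (b ∷ bs) r

      length-quotient : ∀ a as r → length (quotient (a ∷ as) r) ≡ length as
      length-quotient a []       r = ≡.refl
      length-quotient a (b ∷ bs) r = ≡.cong suc (length-quotient b bs r)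

      quotient-correct : ∀ a as r x → eval (a ∷ as) x ≈ eval (a ∷ as) r + (x - r) * eval (quotient (a ∷ as) r) x
      quotient-correct a []       r x = solve 4 (λ a e r x → a :+ x :* e := a :+ r :* e :+ (x :- r) :* e) refl a 1# r x
      quotient-correct a (b ∷ bs) r x = trans (+-congˡ (*-congˡ (quotient-correct b bs r x)))
        (solve 5 (λ a e r x q → a :+ x :* (e :+ (x :- r) :* q) := a :+ r :* e :+ (x :- r) :* (e :+ x :* q)) refl
          a (eval (b ∷ bs) r) r x (eval (quotient (b ∷ bs) r) x))

    eval-cong : ∀ as {x y} → x ≈ y → eval as x ≈ eval as y
    eval-cong []       x≈y = refl
    eval-cong (a ∷ as) x≈y = +-congˡ (*-cong x≈y (eval-cong as x≈y))

    eval-replicate : ∀ n x → eval (replicate n 0#) x ≈ x ^ n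
    eval-replicate zero    x = refl
    eval-replicate (suc n) x = trans (+-identityˡ _) (*-congˡ (eval-replicate n x))

    -- Induction on the degree: given a root r, any other root is a root of the quotient by X - r,
    -- since there are no zero divisors.
    #roots≤ : ∀ d as → length as ≡ d → # (λ x → eval as x ≟ 0#) ≤ d
    #roots≤ d [] _ = ≡.subst (_≤ d) (≡.sym (#-none _ λ _ → 1≉0)) z≤n
    #roots≤ (suc d) (a ∷ as) ∣as∣≡d with search (λ x → eval (a ∷ as) x ≟ 0#) (λ x≈y → trans (eval-cong (a ∷ as) (sym x≈y)))
    ... | no ∄root      = ≡.subst (_≤ suc d) (≡.sym (#-none _ λ x x-root → ∄root (x , x-root))) z≤n
    ... | yes (r , r-root) = ≡.subst (_≤ suc d) (≡.sym (#-split _ (λ x → x ≟ r)))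
      (ℕ.+-mono-≤ (ℕ.≤-trans (#-mono _ (λ x → x ≟ r) λ _ → proj₂)
                             (ℕ.≤-reflexive (#-one (λ x → x ≟ r) (λ x≈y x≈r → trans (sym x≈y) x≈r) r refl λ _ → id)))
                  (ℕ.≤-trans (#-mono _ (λ x → eval (quotient (a ∷ as) r) x ≟ 0#) factor)
                             (#roots≤ d (quotient (a ∷ as) r) (≡.trans (length-quotient a as r) (ℕ.suc-injective ∣as∣≡d)))))
      where
      factor : ∀ x → eval (a ∷ as) x ≈ 0# × ¬ x ≈ r → eval (quotient (a ∷ as) r) x ≈ 0#
      factor x (x-root , x≉r) = *≈0⇒≈0 (λ x-r≈0 → x≉r (x∙y⁻¹≈ε⇒x≈y x r x-r≈0)) (begin
        (x - r) * eval (quotient (a ∷ as) r) x        ≈⟨ +-identityˡ _ ⟨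
        0# + (x - r) * eval (quotient (a ∷ as) r) x   ≈⟨ +-congʳ r-root ⟨
        eval (a ∷ as) r + (x - r) * eval (quotient (a ∷ as) r) x ≈⟨ quotient-correct a as r x ⟨
        eval (a ∷ as) x                               ≈⟨ x-root ⟩
        0#                                            ∎)

    module Frobenius {p : ℕ} (pp : Prime p) (m : ℕ) (size≡p^m : size ≡ p ℕ.^ m) where

      -- The field has p^m elements, so the m-th power of `p ⋆ 1#` vanishes; a nonzero element has
      -- no vanishing power.
      p⋆1≈0 : p ⋆ 1# ≈ 0#
      p⋆1≈0 with p ⋆ 1# ≟ 0#
      ... | yes p⋆1≈0 = p⋆1≈0
      ... | no  p⋆1≉0 = contradiction (trans (reflexive (≡.cong (_⋆ 1#) (≡.sym size≡p^m))) size⋆1≈0) (powers m)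
        where
        powers : ∀ m → ¬ (p ℕ.^ m) ⋆ 1# ≈ 0#
        powers zero    eq = 1≉0 (trans (sym (×-homo-1 1#)) eq)
        powers (suc m) eq = *≉0 p⋆1≉0 (powers m) (trans (sym (×1-homo-* p (p ℕ.^ m))) eq)

      p∣n⇒n⋆x≈0 : ∀ {n} → p ∣ n → ∀ x → n ⋆ x ≈ 0#
      p∣n⇒n⋆x≈0 (divides k ≡.refl) x = begin
        (k ℕ.* p) ⋆ x                ≈⟨ ×-congʳ (k ℕ.* p) (*-identityˡ x) ⟨
        (k ℕ.* p) ⋆ (1# * x)         ≈⟨ ×-assoc-* (k ℕ.* p) 1# x ⟨
        (k ℕ.* p) ⋆ 1# * x           ≈⟨ *-congʳ (×1-homo-* k p) ⟩
        k ⋆ 1# * p ⋆ 1# * x          ≈⟨ *-congʳ (*-congˡ p⋆1≈0) ⟩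
        k ⋆ 1# * 0# * x              ≈⟨ *-congʳ (zeroʳ _) ⟩
        0# * x                       ≈⟨ zeroˡ x ⟩
        0#                           ∎

      -- All binomial coefficients but the outer two are divisible by p and so vanish in the field.
      ^p-+ : ∀ x y → (x + y) ^ p ≈ x ^ p + y ^ p
      ^p-+ x y = go p ≡.refl
        where
        go : ∀ n → n ≡ p → (x + y) ^ n ≈ x ^ n + y ^ n
        go zero    ≡.refl = contradiction pp ¬prime[0]
        go n@(suc k) n≡p = begin
          (x + y) ^ n                                              ≈⟨ binomial-theorem n x y ⟩
          term zero + sum (term ∘ suc)                             ≈⟨ +-congˡ (sum-single +-commutativeMonoid (term ∘ suc) (fromℕ k) last middle) ⟩
          term zero + x ^ n                                        ≈⟨ +-congʳ (trans (+-identityʳ _) (*-identityˡ _)) ⟩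
          y ^ n + x ^ n                                            ≈⟨ +-comm _ _ ⟩
          x ^ n + y ^ n                                            ∎
          where
          term : Fin (suc n) → Carrier
          term = binomialTerm x y n
          last : term (suc (fromℕ k)) ≈ x ^ n
          last rewrite Fin.toℕ-fromℕ k | nCn≡1 n | ℕ.n∸n≡0 k = trans (+-identityʳ _) (*-identityʳ _)
          middle : ∀ j → fromℕ k ≢ j → term (suc j) ≈ 0#
          middle j k≢j = p∣n⇒n⋆x≈0 (≡.subst (λ l → p ∣ l C toℕ (suc j)) (≡.sym n≡p)
            (prime∣C pp (suc (toℕ j)) (s≤s z≤n) (≡.subst (suc (toℕ j) <_) n≡p
              (s≤s (ℕ.≤∧≢⇒< (ℕ.≤-pred (Fin.toℕ<n j)) λ j≡k →
                k≢j (Fin.toℕ-injective (≡.trans (Fin.toℕ-fromℕ k) (≡.sym j≡k)))))))) _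

      ^p^-+ : ∀ k x y → (x + y) ^ (p ℕ.^ k) ≈ x ^ (p ℕ.^ k) + y ^ (p ℕ.^ k)
      ^p^-+ zero    x y = distribʳ 1# x y
      ^p^-+ (suc k) x y = begin
        (x + y) ^ (p ℕ.* p ℕ.^ k)                   ≈⟨ ^-assocʳ (x + y) p (p ℕ.^ k) ⟨
        ((x + y) ^ p) ^ (p ℕ.^ k)                   ≈⟨ ^-congˡ (p ℕ.^ k) (^p-+ x y) ⟩
        (x ^ p + y ^ p) ^ (p ℕ.^ k)                 ≈⟨ ^p^-+ k (x ^ p) (y ^ p) ⟩
        (x ^ p) ^ (p ℕ.^ k) + (y ^ p) ^ (p ℕ.^ k)   ≈⟨ +-cong (^-assocʳ x p (p ℕ.^ k)) (^-assocʳ y p (p ℕ.^ k)) ⟩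
        x ^ (p ℕ.* p ℕ.^ k) + y ^ (p ℕ.* p ℕ.^ k)   ∎

-- Conjugation, norm and trace over the subfield of order q.

module Conjugation where

  open Counting
  open RingSolver
  open FiniteField
  open import Defs using (IsPrimePower)
  open import Algebra.Bundles using (CommutativeRing)
  open import Data.List.Base using (_∷_; replicate)
  open import Data.List.Properties using (length-replicate)
  open import Data.Nat.Base as ℕ using (ℕ; zero; suc; s≤s; z≤n; _≤_)
  open import Data.Nat.Primality using (Prime; ¬prime[0]; ¬prime[1])
  import Data.Nat.Properties as ℕ
  open import Data.Nat.Solver using (module +-*-Solver)
  open import Data.Product.Base using (_×_; _,_; proj₁; proj₂)
  open import Function.Base using (_∘_; id)
  open import Level using (Level)
  open import Relation.Binary.PropositionalEquality.Core as ≡ using (_≡_)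
  open import Relation.Nullary using (¬_; Dec; yes; no; ¬?; _×-dec_; contradiction)

  private
    variable
      c ℓ : Level

  prime-power≥2 : ∀ {q} → IsPrimePower q → 2 ≤ q
  prime-power≥2 (p , k , pp , ≡.refl) = ℕ.≤-trans (prime≥2 pp) (ℕ.m≤m*n p
      (p ℕ.^ k) {{ℕ.m^n≢0 p k {{ℕ.>-nonZero (ℕ.<-trans (s≤s z≤n) (prime≥2 pp))}}}})
    where
    prime≥2 : ∀ {p} → Prime p → 2 ≤ p
    prime≥2 {zero}        pp = contradiction pp ¬prime[0]
    prime≥2 {suc zero}    pp = contradiction pp ¬prime[1]
    prime≥2 {suc (suc p)} pp = s≤s (s≤s z≤n)

  -- The factorisation q² - 1 = (q - 1)(q + 1) for q = 2 + r, without subtraction: q - 1 norm fibres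
  -- of size q + 1 exhaust the nonzero elements.
  [q-1][q+1] : ∀ r → suc (suc r ℕ.* suc (2 ℕ.+ r)) ≡ (2 ℕ.+ r) ℕ.^ 2
  [q-1][q+1] = solve 1 (λ r → con 1 :+ (con 1 :+ r) :* (con 3 :+ r) := (con 2 :+ r) :* ((con 2 :+ r) :* con 1)) ≡.refl
    where open +-*-Solver

  module ConjugationProperties (R : CommutativeRing c ℓ) {q : ℕ} (pp : IsPrimePower q)
                               (isFiniteField : IsFiniteField R (q ℕ.^ 2)) where
    open CommutativeRing R hiding (zero)
    open IsFiniteField isFiniteField public using (inverse; 1≉0)
    open FiniteFieldProperties R isFiniteField public
    open Solver R
    open Count finite
    open DoubleCount finite finite using (pigeonhole)
    open import Algebra.Properties.Semiring.Exp semiring public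
    open import Algebra.Properties.CommutativeSemiring.Exp commutativeSemiring public using (^-distrib-*)
    open import Relation.Binary.Reasoning.Setoid setoid

    2≤q : 2 ≤ q
    2≤q = prime-power≥2 pp

    private
      -- The number of zeros that complete the coefficient lists below: X^q with two explicit lower
      -- coefficients, or X^(q-1) with one.
      r : ℕ
      r = q ℕ.∸ 2

      q≡2+r : q ≡ 2 ℕ.+ r
      q≡2+r = ≡.sym (ℕ.m+[n∸m]≡n 2≤q)

    conj norm trace : Carrier → Carrier
    conj x = x ^ q
    norm x = x * conj x
    trace x = x + conj x

    conj-cong : ∀ {x y} → x ≈ y → conj x ≈ conj y
    conj-cong = ^-congˡ q

    conj-* : ∀ x y → conj (x * y) ≈ conj x * conj y
    conj-* x y = ^-distrib-* x y q

    -- For q = p^(k+1), conjugation is the Frobenius map iterated k + 1 times.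
    conj-+ : ∀ x y → conj (x + y) ≈ conj x + conj y
    conj-+ x y = trans (^-congʳ (x + y) q≡)
      (trans (Frobenius.^p^-+ p-prime (suc k ℕ.* 2) (≡.trans (≡.cong (ℕ._^ 2) q≡) (ℕ.^-*-assoc p (suc k) 2)) (suc k) x y)
             (+-cong (^-congʳ x (≡.sym q≡)) (^-congʳ y (≡.sym q≡))))
      where
      p k : ℕ
      p = proj₁ pp
      k = proj₁ (proj₂ pp)
      p-prime : Prime p
      p-prime = proj₁ (proj₂ (proj₂ pp))
      q≡ : q ≡ p ℕ.^ suc k
      q≡ = proj₂ (proj₂ (proj₂ pp))

    conj-conj : ∀ x → conj (conj x) ≈ x
    conj-conj x = trans (^-assocʳ x q q) (trans (^-congʳ x (≡.cong (q ℕ.*_) (≡.sym (ℕ.*-identityʳ q)))) (x^size≈x x))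

    conj-0 : conj 0# ≈ 0#
    conj-0 = +-cancelˡ (conj 0#) _ _ (trans (sym (conj-+ 0# 0#)) (trans (conj-cong (+-identityʳ 0#)) (sym (+-identityʳ _))))

    conj-1 : conj 1# ≈ 1#
    conj-1 = go q
      where
      go : ∀ n → 1# ^ n ≈ 1#
      go zero    = refl
      go (suc n) = trans (*-identityˡ _) (go n)

    conj-neg : ∀ x → conj (- x) ≈ - conj x
    conj-neg x = +-cancelˡ (conj x) _ _ (trans (sym (conj-+ x (- x)))
      (trans (conj-cong (-‿inverseʳ x)) (trans conj-0 (sym (-‿inverseʳ _)))))

    conj-≉0 : ∀ {x} → ¬ x ≈ 0# → ¬ conj x ≈ 0#
    conj-≉0 x≉0 = ^≉0 x≉0 q

    norm-cong : ∀ {x y} → x ≈ y → norm x ≈ norm y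
    norm-cong x≈y = *-cong x≈y (conj-cong x≈y)

    norm-≉0 : ∀ {x} → ¬ x ≈ 0# → ¬ norm x ≈ 0#
    norm-≉0 x≉0 = *≉0 x≉0 (conj-≉0 x≉0)

    norm-≈0 : ∀ {x} → x ≈ 0# → norm x ≈ 0#
    norm-≈0 x≈0 = trans (*-congʳ x≈0) (zeroˡ _)

    norm≈0⇒≈0 : ∀ {x} → norm x ≈ 0# → x ≈ 0#
    norm≈0⇒≈0 {x} Nx≈0 with x ≟ 0#
    ... | yes x≈0 = x≈0
    ... | no x≉0  = contradiction Nx≈0 (norm-≉0 x≉0)

    norm-* : ∀ x y → norm (x * y) ≈ norm x * norm y
    norm-* x y = trans (*-congˡ (conj-* x y))
      (solve 4 (λ x y x′ y′ → x :* y :* (x′ :* y′) := x :* x′ :* (y :* y′)) refl x y (conj x) (conj y))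

    -- Membership in the fixed field of the conjugation, which is the subfield of order q.
    Real : Carrier → Set ℓ
    Real x = conj x ≈ x

    real? : ∀ x → Dec (Real x)
    real? x = conj x ≟ x

    Real-resp : ∀ {x y} → x ≈ y → Real x → Real y
    Real-resp x≈y rx = trans (conj-cong (sym x≈y)) (trans rx x≈y)

    norm-real : ∀ x → Real (norm x)
    norm-real x = trans (conj-* x (conj x)) (trans (*-congˡ (conj-conj x)) (*-comm _ _))

    trace-real : ∀ x → Real (trace x)
    trace-real x = trans (conj-+ x (conj x)) (trans (+-congˡ (conj-conj x)) (+-comm _ _))

    Real-* : ∀ {x y} → Real x → Real y → Real (x * y)
    Real-* rx ry = trans (conj-* _ _) (*-cong rx ry)

    Real-neg : ∀ {x} → Real x → Real (- x)
    Real-neg rx = trans (conj-neg _) (-‿cong rx)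

    Real-inverse : ∀ {x y} → y * x ≈ 1# → Real x → Real y
    Real-inverse {x} {y} yx≈1 rx = *-cancelˡ-≉0 x≉0 (begin
      x * conj y        ≈⟨ *-congʳ rx ⟨
      conj x * conj y   ≈⟨ conj-* x y ⟨
      conj (x * y)      ≈⟨ conj-cong (trans (*-comm x y) yx≈1) ⟩
      conj 1#           ≈⟨ conj-1 ⟩
      1#                ≈⟨ trans (*-comm x y) yx≈1 ⟨
      x * y             ∎)
      where
      x≉0 : ¬ x ≈ 0#
      x≉0 x≈0 = 1≉0 (trans (sym yx≈1) (trans (*-congˡ x≈0) (zeroʳ y)))

    #≉0 : suc (# (λ x → ¬? (x ≟ 0#))) ≡ q ℕ.^ 2
    #≉0 = ≡.trans (≡.cong (ℕ._+ # (λ x → ¬? (x ≟ 0#))) (≡.sym (#-one (_≟ 0#) (λ x≈y x≈0 → trans (sym x≈y) x≈0) 0# refl λ _ → id)))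
      (≡.trans (≡.cong₂ ℕ._+_ (#-cong _ _ (λ _ x≈0 → refl , x≈0) (λ _ → proj₂)) (#-cong _ _ (λ _ x≉0 → refl , x≉0) (λ _ → proj₂)))
      (≡.trans (≡.sym (#-split (λ x → x ≟ x) (_≟ 0#))) (#-all (λ x → x ≟ x) λ _ → refl)))

    private
      x^q : ∀ x → conj x ≈ x * (x * x ^ r)
      x^q x = ^-congʳ x q≡2+r

      -a+b≈0 : ∀ {a b} → a ≈ b → - a + b ≈ 0#
      -a+b≈0 a≈b = trans (+-congˡ (sym a≈b)) (-‿inverseˡ _)

      -- Real elements are roots of X^q - X.
      #real≤ : # real? ≤ q
      #real≤ = ℕ.≤-trans (#-mono real? _ root) (#roots≤ q (0# ∷ - 1# ∷ replicate r 0#)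
          (≡.trans (≡.cong (suc ∘ suc) (length-replicate r)) (≡.sym q≡2+r)))
        where
        root : ∀ x → Real x → 0# + x * (- 1# + x * eval (replicate r 0#) x) ≈ 0#
        root x rx = begin
          0# + x * (- 1# + x * eval (replicate r 0#) x)   ≈⟨ +-congˡ (*-congˡ (+-congˡ (*-congˡ (eval-replicate r x)))) ⟩
          0# + x * (- 1# + x * x ^ r)                     ≈⟨ trans (+-identityˡ _) (solve 3 (λ x o p → x :* (:- o :+ p) := :- (x :* o) :+ x :* p) refl x 1# _) ⟩
          - (x * 1#) + x * (x * x ^ r)                    ≈⟨ -a+b≈0 (trans (*-identityʳ x) (trans (sym rx) (x^q x))) ⟩
          0#                                              ∎

      -- Nonzero real elements are roots of X^(q-1) - 1.
      #real≉0≤ : # (λ x → ¬? (x ≟ 0#) ×-dec real? x) ≤ suc r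
      #real≉0≤ = ℕ.≤-trans (#-mono (λ x → ¬? (x ≟ 0#) ×-dec real? x) _ root) (#roots≤ (suc r) (- 1# ∷ replicate r 0#)
          (≡.cong suc (length-replicate r)))
        where
        root : ∀ x → ¬ x ≈ 0# × Real x → - 1# + x * eval (replicate r 0#) x ≈ 0#
        root x (x≉0 , rx) = trans (+-congˡ (*-congˡ (eval-replicate r x)))
          (-a+b≈0 (*-cancelˡ-≉0 x≉0 (trans (*-identityʳ x) (trans (sym rx) (x^q x)))))

    -- The norm maps the q² - 1 nonzero elements to the at most q - 1 nonzero real
    -- ones, with fibres of at most q + 1 elements, so all fibres are full.
    #norm≈ : ∀ {a} → Real a → ¬ a ≈ 0# → # (λ t → norm t ≟ a) ≡ suc q
    #norm≈ {a} ra a≉0 = ≡.trans (#-cong _ _ (λ t Nt≈a → (λ t≈0 → a≉0 (trans (sym Nt≈a) (norm-≈0 t≈0))) , Nt≈a) (λ _ → proj₂))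
      (pigeonhole (λ t → ¬? (t ≟ 0#)) (λ a → ¬? (a ≟ 0#) ×-dec real? a)
        (λ x≈y (x≉0 , rx) → (λ y≈0 → x≉0 (trans x≈y y≈0)) , Real-resp x≈y rx)
        norm (λ {x} x≉0 Nx≈y → (λ y≈0 → norm-≉0 x≉0 (trans Nx≈y y≈0)) , Real-resp Nx≈y (norm-real x))
        #real≉0≤
        (λ a _ → ℕ.≤-trans (#-mono (λ t → ¬? (t ≟ 0#) ×-dec (norm t ≟ a)) _ (root a)) (#roots≤ (suc q)
            (- a ∷ replicate q 0#) (≡.cong suc (length-replicate q))))
        (ℕ.≤-reflexive (ℕ.suc-injective (≡.trans count (≡.sym #≉0)))) a (a≉0 , ra))
      where
      root : ∀ a t → ¬ t ≈ 0# × norm t ≈ a → - a + t * eval (replicate q 0#) t ≈ 0#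
      root a t (_ , Nt≈a) = trans (+-congˡ (*-congˡ (eval-replicate q t))) (-a+b≈0 (sym Nt≈a))
      count : suc (suc r ℕ.* suc q) ≡ q ℕ.^ 2
      count = ≡.subst (λ q → suc (suc r ℕ.* suc q) ≡ q ℕ.^ 2) (≡.sym q≡2+r) ([q-1][q+1] r)

    -- The trace maps q² elements to at most q real ones. Its fibres consist of roots of X^q + X -
    -- a, hence have at most q elements, and so all of them are full.
    #trace≈ : ∀ {a} → Real a → # (λ t → trace t ≟ a) ≡ q
    #trace≈ {a} ra = ≡.trans (#-cong _ _ (λ t eq → refl , eq) (λ _ → proj₂))
      (pigeonhole (λ t → t ≟ t) real? Real-resp trace (λ {x} _ eq → Real-resp eq (trace-real x)) #real≤
        (λ a _ → ℕ.≤-trans (#-mono (λ t → (t ≟ t) ×-dec (trace t ≟ a)) _ (root a))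
          (#roots≤ q (- a ∷ 1# ∷ replicate r 0#) (≡.trans (≡.cong (suc ∘ suc) (length-replicate r)) (≡.sym q≡2+r))))
        (ℕ.≤-reflexive (≡.trans (≡.cong (q ℕ.*_) (≡.sym (ℕ.*-identityʳ q))) (≡.sym (#-all (λ t → t ≟ t) (λ _ → refl))))) a ra)
      where
      root : ∀ a t → t ≈ t × trace t ≈ a → - a + t * (1# + t * eval (replicate r 0#) t) ≈ 0#
      root a t (_ , tr≈a) = begin
        - a + t * (1# + t * eval (replicate r 0#) t)   ≈⟨ +-congˡ (*-congˡ (+-congˡ (*-congˡ (eval-replicate r t)))) ⟩
        - a + t * (1# + t * t ^ r)                     ≈⟨ +-congˡ (trans (distribˡ t _ _) (+-cong (*-identityʳ t) (sym (x^q t)))) ⟩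
        - a + trace t                                  ≈⟨ -a+b≈0 (sym tr≈a) ⟩
        0#                                             ∎

-- The Hermitian form on vectors, and isotropic vectors in subspaces.

module HermitianForm where

  open Counting
  open RingSolver
  open FiniteField
  open Conjugation
  open import Defs using (IsPrimePower)
  open import Algebra.Bundles using (CommutativeRing)
  open import Data.Fin.Base as Fin using (Fin; zero; suc)
  import Data.Fin.Properties as Fin
  open import Data.Nat.Base as ℕ using (ℕ; zero; suc)
  open import Data.Nat.Solver using (module +-*-Solver)
  open import Data.Product.Base using (_×_; _,_; proj₁; proj₂)
  open import Data.Vec.Functional using (Vector)
  import Data.Vec.Functional.Relation.Binary.Equality.Setoid as Pointwise
  open import Function.Base using (_∘_; id)
  open import Level using (Level)
  open import Relation.Binary.Bundles using (Setoid)
  open import Relation.Binary.Definitions using (_Respects_)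
  open import Relation.Binary.PropositionalEquality.Core as ≡ using (_≡_; _≢_)
  open import Relation.Nullary using (¬_; yes; no; ¬?; _×-dec_; contradiction)
  open import Relation.Unary using (Pred; Decidable)

  private
    variable
      a c ℓ p : Level

  vectors : FiniteSetoid a ℓ → ℕ → FiniteSetoid a ℓ
  vectors S n = record
    { setoid      = Pointwise.≋-setoid setoid n
    ; size        = size ℕ.^ n
    ; enumeration = mk-inverse (λ x → Fin.funToFin (index ∘ x)) (λ k i → element (Fin.finToFun {size} {n} k i))
        (λ x≋y → funToFin-cong (λ i → index-cong (x≋y i)))
        (λ { ≡.refl i → refl })
        (λ k → ≡.trans (funToFin-cong {n} {g = Fin.finToFun {size} {n} k} (λ i → index∘element _))
            (Fin.funToFin-finToFin {n} {size} k))
        (λ x i → trans (element-cong (Fin.finToFun-funToFin (index ∘ x) i)) (element∘index (x i)))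
    }
    where
    open FiniteSetoid S
    funToFin-cong : ∀ {n m} {f g : Fin n → Fin m} → (∀ i → f i ≡ g i) → Fin.funToFin f ≡ Fin.funToFin g
    funToFin-cong {zero}  f≗g = ≡.refl
    funToFin-cong {suc n} f≗g = ≡.cong₂ Fin.combine (f≗g zero) (funToFin-cong (f≗g ∘ suc))

  -- Here b isotropic vectors have fibres of size 1 and c anisotropic ones have fibres of size q +
  -- 1. Adding q * b raises all weights to q + 1, so that only the total b + c is left on the right.
  fibre-sum : ∀ b c q → b ℕ.* 1 ℕ.+ c ℕ.* suc q ℕ.+ q ℕ.* b ≡ suc q ℕ.* (b ℕ.+ c)
  fibre-sum = solve 3 (λ b c q → b :* con 1 :+ c :* (con 1 :+ q) :+ q :* b := (con 1 :+ q) :* (b :+ c)) ≡.refl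
    where open +-*-Solver

  module HermitianSpace (R : CommutativeRing c ℓ) {q : ℕ} (pp : IsPrimePower q)
                        (isFiniteField : IsFiniteField R (q ℕ.^ 2)) (n : ℕ) where
    open CommutativeRing R hiding (zero)
    open ConjugationProperties R pp isFiniteField public
    open Solver R
    open import Algebra.Properties.Semiring.Sum semiring using (sum; sum-cong-≋; ∑-distrib-+; *-distribˡ-sum)
    open import Relation.Binary.Reasoning.Setoid setoid

    space : FiniteSetoid c ℓ
    space = vectors finite (suc n)

    module V = FiniteSetoid space
    module CF = Count finite
    module CV = Count space
    module VF = DoubleCount space finite
    module VV = DoubleCount space space

    V : Set c
    V = Vector Carrier (suc n)

    infix 4 _≋_
    _≋_ : V → V → Set ℓ
    x ≋ y = ∀ i → x i ≈ y i

    infixl 7 _⊙_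
    _⊙_ : Carrier → V → V
    (s ⊙ x) i = s * x i

    infixl 6 _⊕_⊙_
    _⊕_⊙_ : V → Carrier → V → V
    (x ⊕ s ⊙ y) i = x i + s * y i

    basis : Fin (suc n) → V
    basis i j with i Fin.≟ j
    ... | yes _ = 1#
    ... | no  _ = 0#

    basis-≡ : ∀ i → basis i i ≈ 1#
    basis-≡ i with i Fin.≟ i
    ... | yes _  = refl
    ... | no i≢i = contradiction ≡.refl i≢i

    basis-≢ : ∀ {i j} → i ≢ j → basis i j ≈ 0#
    basis-≢ {i} {j} i≢j with i Fin.≟ j
    ... | yes i≡j = contradiction i≡j i≢j
    ... | no _    = refl

    conj-sum : ∀ {m} (f : Fin m → Carrier) → conj (sum f) ≈ sum (conj ∘ f)
    conj-sum {zero}  f = conj-0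
    conj-sum {suc m} f = trans (conj-+ (f zero) (sum (f ∘ suc))) (+-congˡ (conj-sum (f ∘ suc)))

    opaque
      B : V → V → Carrier
      B x y = sum (λ i → x i * conj (y i))

      B-definition : ∀ x y → B x y ≡ sum (λ i → x i * conj (y i))
      B-definition x y = ≡.refl

      B-cong : ∀ {x x′ y y′} → x ≋ x′ → y ≋ y′ → B x y ≈ B x′ y′
      B-cong x≋x′ y≋y′ = sum-cong-≋ {suc n} (λ i → *-cong (x≋x′ i) (conj-cong (y≋y′ i)))

      B-⊙ˡ : ∀ s x y → B (s ⊙ x) y ≈ s * B x y
      B-⊙ˡ s x y = begin
        sum (λ i → s * x i * conj (y i))     ≈⟨ sum-cong-≋ {suc n} (λ i → *-assoc s (x i) (conj (y i))) ⟩
        sum (λ i → s * (x i * conj (y i)))   ≈⟨ *-distribˡ-sum s (λ i → x i * conj (y i)) ⟨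
        s * B x y                            ∎

      B-⊕ˡ : ∀ x s y z → B (x ⊕ s ⊙ y) z ≈ B x z + s * B y z
      B-⊕ˡ x s y z = begin
        sum (λ i → (x i + s * y i) * conj (z i))                  ≈⟨ sum-cong-≋ {suc n} (λ i → distribʳ (conj (z i)) (x i) (s * y i)) ⟩
        sum (λ i → x i * conj (z i) + s * y i * conj (z i))       ≈⟨ ∑-distrib-+ (λ i → x i * conj (z i)) (λ i → s * y i * conj (z i)) ⟩
        B x z + B (s ⊙ y) z                                       ≈⟨ +-congˡ (B-⊙ˡ s y z) ⟩
        B x z + s * B y z                                         ∎

      conj-B : ∀ x y → conj (B x y) ≈ B y x
      conj-B x y = begin
        conj (B x y)                                 ≈⟨ conj-sum (λ i → x i * conj (y i)) ⟩
        sum (λ i → conj (x i * conj (y i)))          ≈⟨ sum-cong-≋ {suc n} (λ i → trans (conj-* (x i) (conj (y i))) (trans (*-congˡ (conj-conj (y i))) (*-comm (conj (x i)) (y i)))) ⟩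
        B y x                                        ∎

      B-basis : ∀ i x → B x (basis i) ≈ x i
      B-basis i x = sum-single +-commutativeMonoid (λ j → x j * conj (basis i j)) i
        (trans (*-congˡ (trans (conj-cong (basis-≡ i)) conj-1)) (*-identityʳ (x i)))
        (λ j i≢j → trans (*-congˡ (trans (conj-cong (basis-≢ i≢j)) conj-0)) (zeroʳ (x j)))

    B-congˡ : ∀ {x x′} y → x ≋ x′ → B x y ≈ B x′ y
    B-congˡ y x≋x′ = B-cong {y = y} x≋x′ (λ _ → refl)

    B-⊙ʳ : ∀ s x y → B y (s ⊙ x) ≈ conj s * B y x
    B-⊙ʳ s x y = trans (sym (conj-B (s ⊙ x) y)) (trans (conj-cong (B-⊙ˡ s x y))
      (trans (conj-* s (B x y)) (*-congˡ (conj-B x y))))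

    B-⊕ʳ : ∀ x s y z → B z (x ⊕ s ⊙ y) ≈ B z x + conj s * B z y
    B-⊕ʳ x s y z = trans (sym (conj-B (x ⊕ s ⊙ y) z)) (trans (conj-cong (B-⊕ˡ x s y z))
      (trans (conj-+ (B x z) (s * B y z)) (+-cong (conj-B x z) (trans (conj-* s (B y z)) (*-congˡ (conj-B y z))))))

    B-real : ∀ x → Real (B x x)
    B-real x = conj-B x x

    B-sym-≈0 : ∀ {x y} → B x y ≈ 0# → B y x ≈ 0#
    B-sym-≈0 {x} {y} Bxy≈0 = trans (sym (conj-B x y)) (trans (conj-cong Bxy≈0) conj-0)

    norm-B : ∀ x y → norm (B x y) ≈ B x y * B y x
    norm-B x y = *-congˡ (conj-B x y)

    norm-B-sym : ∀ x y → norm (B x y) ≈ norm (B y x)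
    norm-B-sym x y = trans (norm-B x y) (trans (*-comm _ _) (sym (norm-B y x)))

    B-⊙-⊙ : ∀ s x → B (s ⊙ x) (s ⊙ x) ≈ norm s * B x x
    B-⊙-⊙ s x = trans (B-⊙ˡ s x (s ⊙ x)) (trans (*-congˡ (B-⊙ʳ s x x)) (sym (*-assoc s (conj s) (B x x))))

    B-⊕-⊕ : ∀ x s y → B (x ⊕ s ⊙ y) (x ⊕ s ⊙ y) ≈ B x x + conj s * B x y + s * (B y x + conj s * B y y)
    B-⊕-⊕ x s y = trans (B-⊕ˡ x s y (x ⊕ s ⊙ y)) (+-cong (B-⊕ʳ x s y x) (*-congˡ (B-⊕ʳ x s y y)))

    B-⊕-⊥ : ∀ v μ y → B v y ≈ 0# → B (v ⊕ μ ⊙ y) (v ⊕ μ ⊙ y) ≈ B v v + norm μ * B y y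
    B-⊕-⊥ v μ y Bvy≈0 = begin
      B (v ⊕ μ ⊙ y) (v ⊕ μ ⊙ y)                             ≈⟨ B-⊕-⊕ v μ y ⟩
      B v v + conj μ * B v y + μ * (B y v + conj μ * B y y)  ≈⟨ +-cong (trans (+-congˡ (trans (*-congˡ Bvy≈0) (zeroʳ _))) (+-identityʳ _))
                                                                  (trans (*-congˡ (trans (+-congʳ (B-sym-≈0 {v} {y} Bvy≈0))
                                                                      (+-identityˡ _))) (sym (*-assoc μ (conj μ) (B y y)))) ⟩
      B v v + norm μ * B y y                                 ∎

    Iso : Pred V ℓ
    Iso x = B x x ≈ 0#

    Iso? : Decidable Iso
    Iso? x = B x x ≟ 0#

    Iso-resp : Iso Respects _≋_
    Iso-resp x≋y Bxx≈0 = trans (B-cong (sym ∘ x≋y) (sym ∘ x≋y)) Bxx≈0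

    -- Makes P, on nonzero vectors, a condition on projective points.
    Homogeneous : Pred V p → Set _
    Homogeneous P = ∀ {x s} → ¬ s ≈ 0# → P x → P (s ⊙ x)

    Iso-homogeneous : Homogeneous Iso
    Iso-homogeneous {x} {s} _ Bxx≈0 = trans (B-⊙-⊙ s x) (trans (*-congˡ Bxx≈0) (zeroʳ _))

    -- `L` is a function of degree one: pairing with a fixed vector, or the leading coordinate that
    -- normalises a point.
    module Slice {P : Pred V p} (P? : Decidable P) (P-resp : P Respects _≋_) (P-hom : Homogeneous P)
                 (L : V → Carrier) (L-cong : ∀ {x y} → x ≋ y → L x ≈ L y) (L-⊙ : ∀ {s x} → ¬ s ≈ 0# → L (s ⊙ x) ≈ s * L x) where

      #slice : Carrier → ℕ
      #slice a = CV.# (λ x → P? x ×-dec (L x ≟ a))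

      -- Scaling by the inverse of a carries the slice at a onto the slice at 1.
      #slice≡ : ∀ {a} → ¬ a ≈ 0# → #slice a ≡ #slice 1#
      #slice≡ {a} a≉0 with b , ba≈1 ← inverse a a≉0 =
        VV.#-subset-bijection _ _ (λ x≋y (px , Lx) → P-resp x≋y px , trans (L-cong (sym ∘ x≋y)) Lx)
          (λ x≋y (px , Lx) → P-resp x≋y px , trans (L-cong (sym ∘ x≋y)) Lx)
          (b ⊙_) (a ⊙_) (λ x≋y i → *-congˡ (x≋y i)) (λ x≋y i → *-congˡ (x≋y i))
          (λ (px , Lx≈a) → P-hom b≉0 px , trans (L-⊙ b≉0) (trans (*-congˡ Lx≈a) ba≈1))
          (λ (px , Lx≈1) → P-hom a≉0 px , trans (L-⊙ a≉0) (trans (*-congˡ Lx≈1) (*-identityʳ a)))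
          (λ {x} _ i → trans (sym (*-assoc a b (x i))) (trans (*-congʳ (trans (*-comm a b) ba≈1)) (*-identityˡ (x i))))
          (λ {x} _ i → trans (sym (*-assoc b a (x i))) (trans (*-congʳ ba≈1) (*-identityˡ (x i))))
        where
        b≉0 : ¬ b ≈ 0#
        b≉0 b≈0 = 1≉0 (trans (sym ba≈1) (trans (*-congʳ b≈0) (zeroˡ a)))

      #slices : {C : Pred Carrier a} (C? : Decidable C) → C Respects _≈_ → (∀ {x} → C x → ¬ x ≈ 0#) →
        CV.# (λ x → P? x ×-dec C? (L x)) ≡ CF.# C? ℕ.* #slice 1#
      #slices C? C-resp C⇒≉0 = VF.#-fibres P? C? C-resp L (λ y cy → #slice≡ (C⇒≉0 cy))

    module Subspace {U : Pred V p} (U? : Decidable U) (U-resp : U Respects _≋_)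
                    (U-closed : ∀ {x y} s → U x → U y → U (x ⊕ s ⊙ y)) where

      #U⊥ #UIso⊥ : V → ℕ
      #U⊥ y = CV.# (λ u → U? u ×-dec (B u y ≟ 0#))
      #UIso⊥ y = CV.# (λ u → U? u ×-dec (B u y ≟ 0#) ×-dec Iso? u)

      #UIso : ℕ
      #UIso = CV.# (λ u → U? u ×-dec Iso? u)

      -- Translation by the multiple of e whose product with y is a carries the kernel of the
      -- functional onto its fibre over a.
      #functional≡ : ∀ y e → U e → ¬ B e y ≈ 0# → ∀ a → CV.# (λ u → U? u ×-dec (B u y ≟ a)) ≡ #U⊥ y
      #functional≡ y e ue Bey≉0 a with d , d*Bey≈1 ← inverse (B e y) Bey≉0 =
        VV.#-subset-bijection _ _ (resp a) (resp 0#) (_⊕ - (a * d) ⊙ e) (_⊕ a * d ⊙ e)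
          (λ x≋y i → +-congʳ (x≋y i)) (λ x≋y i → +-congʳ (x≋y i))
          (λ {u} (uu , Buy≈a) → U-closed (- (a * d)) uu ue , (begin
            B (u ⊕ - (a * d) ⊙ e) y       ≈⟨ B-⊕ˡ u (- (a * d)) e y ⟩
            B u y + - (a * d) * B e y     ≈⟨ +-cong Buy≈a (solve 3 (λ a d b → :- (a :* d) :* b := :- (a :* (d :* b))) refl a d (B e y)) ⟩
            a - a * (d * B e y)           ≈⟨ +-congˡ (-‿cong (trans (*-congˡ d*Bey≈1) (*-identityʳ a))) ⟩
            a - a                         ≈⟨ -‿inverseʳ a ⟩
            0#                            ∎))
          (λ {u} (uu , Buy≈0) → U-closed (a * d) uu ue , (begin
            B (u ⊕ a * d ⊙ e) y       ≈⟨ B-⊕ˡ u (a * d) e y ⟩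
            B u y + a * d * B e y     ≈⟨ +-cong Buy≈0 (trans (*-assoc a d (B e y)) (trans (*-congˡ d*Bey≈1) (*-identityʳ a))) ⟩
            0# + a                    ≈⟨ +-identityˡ a ⟩
            a                         ∎))
          (λ {u} _ i → solve 3 (λ u s e → u :+ (:- s) :* e :+ s :* e := u) refl (u i) (a * d) (e i))
          (λ {u} _ i → solve 3 (λ u s e → u :+ s :* e :+ (:- s) :* e := u) refl (u i) (a * d) (e i))
        where
        resp : ∀ a → (λ u → U u × B u y ≈ a) Respects _≋_
        resp a x≋y (ux , Bxy) = U-resp x≋y ux , trans (B-congˡ y (sym ∘ x≋y)) Bxy

      #U≡q²*#U⊥ : ∀ y e → U e → ¬ B e y ≈ 0# → CV.# U? ≡ q ℕ.^ 2 ℕ.* #U⊥ y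
      #U≡q²*#U⊥ y e ue Bey≉0 = ≡.trans (CV.#-cong U? _ (λ _ u → u , refl) (λ _ → proj₁))
        (≡.trans (VF.#-fibres U? (λ a → a ≟ a) (λ _ _ → refl) (λ u → B u y) (λ a _ → #functional≡ y e ue Bey≉0 a))
                 (≡.cong (ℕ._* #U⊥ y) (CF.#-all _ (λ _ → refl))))

      -- Each u in U is v + μ y with v in U ∩ y^⊥, and it is isotropic iff
      -- B v v + norm μ * B y y ≈ 0: one μ for isotropic v, and q + 1 otherwise.
      module Anisotropic (y : V) (uy : U y) (aniso : ¬ Iso y) where
        private
          d = proj₁ (inverse (B y y) aniso)
          d*Byy≈1 = proj₂ (inverse (B y y) aniso)

          d≉0 : ¬ d ≈ 0#
          d≉0 d≈0 = 1≉0 (trans (sym d*Byy≈1) (trans (*-congʳ d≈0) (zeroˡ _)))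

          project : V → V
          project u = u ⊕ - (B u y * d) ⊙ y

          B-project : ∀ u → B (project u) y ≈ 0#
          B-project u = begin
            B (project u) y                  ≈⟨ B-⊕ˡ u (- (B u y * d)) y y ⟩
            B u y + - (B u y * d) * B y y    ≈⟨ solve 3 (λ b d e → b :+ (:- (b :* d)) :* e := b :- b :* (d :* e)) refl (B u y) d (B y y) ⟩
            B u y - B u y * (d * B y y)      ≈⟨ +-congˡ (-‿cong (trans (*-congˡ d*Byy≈1) (*-identityʳ _))) ⟩
            B u y - B u y                    ≈⟨ -‿inverseʳ _ ⟩
            0#                               ∎

          coefficient : ∀ v μ → B v y ≈ 0# → B (v ⊕ μ ⊙ y) y * d ≈ μ
          coefficient v μ Bvy≈0 = begin
            B (v ⊕ μ ⊙ y) y * d           ≈⟨ *-congʳ (trans (B-⊕ˡ v μ y y) (trans (+-congʳ Bvy≈0) (+-identityˡ _))) ⟩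
            μ * B y y * d                 ≈⟨ trans (*-assoc μ (B y y) d) (*-congˡ (trans (*-comm _ _) d*Byy≈1)) ⟩
            μ * 1#                        ≈⟨ *-identityʳ μ ⟩
            μ                             ∎

          -- The fibre of `project` over v consists of the v + μ y, and μ is recovered as
          -- `B u y * d`. Since d inverts `B y y`, isotropy becomes a condition on the norm of μ
          -- alone.
          fibre : ∀ v → U v → B v y ≈ 0# →
            CV.# (λ u → (U? u ×-dec Iso? u) ×-dec (project u V.≟ v)) ≡ CF.# (λ μ → norm μ ≟ - (B v v * d))
          fibre v uv Bvy≈0 = VF.#-subset-bijection _ _
            (λ x≋y ((ux , ix) , px) → (U-resp x≋y ux , Iso-resp x≋y ix) ,
              λ i → trans (+-cong (sym (x≋y i)) (*-congʳ (-‿cong (*-congʳ (B-congˡ y (sym ∘ x≋y)))))) (px i))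
            (λ μ≈ν Nμ → trans (norm-cong (sym μ≈ν)) Nμ)
            (λ u → B u y * d) (λ μ → v ⊕ μ ⊙ y) (λ x≋y → *-congʳ (B-congˡ y x≋y)) (λ μ≈ν i → +-congˡ (*-congʳ μ≈ν))
            (λ {u} ((uu , iu) , pu) → let μ = B u y * d in *-cancelˡ-≉0 aniso (begin
              B y y * norm μ                           ≈⟨ solve 3 (λ b e m → e :* m := b :+ e :* m :- b) refl (B v v) (B y y) (norm μ) ⟩
              B v v + B y y * norm μ - B v v           ≈⟨ +-congʳ (trans (+-congˡ (*-comm _ _)) (trans (sym (B-⊕-⊥ v μ y Bvy≈0)) (Iso-resp (λ i → trans (rebuild u i) (+-congʳ (pu i))) iu))) ⟩
              0# - B v v                               ≈⟨ trans (+-identityˡ _) (-‿cong (trans (sym (*-identityʳ _)) (*-congˡ (sym d*Byy≈1)))) ⟩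
              - (B v v * (d * B y y))                  ≈⟨ solve 3 (λ b d e → :- (b :* (d :* e)) := e :* (:- (b :* d))) refl (B v v) d (B y y) ⟩
              B y y * - (B v v * d)                    ∎))
            (λ {μ} Nμ → (U-closed μ uv uy , (begin
              B (v ⊕ μ ⊙ y) (v ⊕ μ ⊙ y)                ≈⟨ B-⊕-⊥ v μ y Bvy≈0 ⟩
              B v v + norm μ * B y y                   ≈⟨ +-congˡ (*-congʳ Nμ) ⟩
              B v v + - (B v v * d) * B y y            ≈⟨ solve 3 (λ b d e → b :+ (:- (b :* d)) :* e := b :- b :* (d :* e)) refl (B v v) d (B y y) ⟩
              B v v - B v v * (d * B y y)              ≈⟨ +-congˡ (-‿cong (trans (*-congˡ d*Byy≈1) (*-identityʳ _))) ⟩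
              B v v - B v v                            ≈⟨ -‿inverseʳ _ ⟩
              0#                                       ∎)) ,
              λ i → trans (+-congˡ (*-congʳ (-‿cong (coefficient v μ Bvy≈0))))
                (solve 3 (λ v μ y → v :+ μ :* y :+ (:- μ) :* y := v) refl (v i) μ (y i)))
            (λ {u} (_ , pu) i → trans (+-congʳ (sym (pu i))) (sym (rebuild u i)))
            (λ {μ} _ → coefficient v μ Bvy≈0)
            where
            rebuild : ∀ u i → u i ≈ project u i + B u y * d * y i
            rebuild u i = solve 3 (λ u μ y → u := u :+ (:- μ) :* y :+ μ :* y) refl (u i) (B u y * d) (y i)

          U⊥-resp : ∀ {x x′} → x ≋ x′ → U x × B x y ≈ 0# → U x′ × B x′ y ≈ 0#
          U⊥-resp x≋x′ (ux , Bxy) = U-resp x≋x′ ux , trans (B-congˡ y (sym ∘ x≋x′)) Bxy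

          U-project : ∀ {u} → U u → U (project u)
          U-project {u} uu = U-closed _ uu uy

          fibre-iso : ∀ v → U v × B v y ≈ 0# × Iso v →
            CV.# (λ u → (U? u ×-dec Iso? u) ×-dec (project u V.≟ v)) ≡ 1
          fibre-iso v (uv , Bvy≈0 , iv) = ≡.trans (fibre v uv Bvy≈0) (≡.trans
            (CF.#-cong _ (_≟ 0#) (λ μ Nμ → norm≈0⇒≈0 (trans Nμ a≈0)) (λ μ μ≈0 → trans (norm-≈0 μ≈0) (sym a≈0)))
            (CF.#-one (_≟ 0#) (λ x≈y x≈0 → trans (sym x≈y) x≈0) 0# refl (λ _ → id)))
            where
            a≈0 : - (B v v * d) ≈ 0#
            a≈0 = trans (-‿cong (trans (*-congʳ iv) (zeroˡ d))) -0#≈0#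

          fibre-aniso : ∀ v → (U v × B v y ≈ 0#) × ¬ Iso v →
            CV.# (λ u → (U? u ×-dec Iso? u) ×-dec (project u V.≟ v)) ≡ suc q
          fibre-aniso v ((uv , Bvy≈0) , ¬iv) = ≡.trans (fibre v uv Bvy≈0)
            (#norm≈ (Real-neg (Real-* (B-real v) (Real-inverse d*Byy≈1 (B-real y))))
                    (λ a≈0 → *≉0 ¬iv d≉0 (trans (sym (-‿involutive _)) (trans (-‿cong a≈0) -0#≈0#))))

        #UIso≡ : #UIso ℕ.+ q ℕ.* #UIso⊥ y ≡ suc q ℕ.* #U⊥ y
        #UIso≡ = combine (≡.trans (CV.#-split (λ u → U? u ×-dec Iso? u) (Iso? ∘ project)) (≡.cong₂ ℕ._+_
            (≡.trans (CV.#-cong _ _ (λ u ((uu , iu) , ip) → (uu , iu) , U-project uu , B-project u , ip)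
                (λ u (ui , _ , _ , ip) → ui , ip))
              (VV.#-fibres (λ u → U? u ×-dec Iso? u) (λ v → U? v ×-dec (B v y ≟ 0#) ×-dec Iso? v)
                (λ x≋x′ (ux , Bx , ix) → let (ux′ , Bx′) = U⊥-resp x≋x′ (ux , Bx) in ux′ , Bx′ , Iso-resp x≋x′ ix) project fibre-iso))
            (≡.trans (CV.#-cong _ _ (λ u ((uu , iu) , ¬ip) → (uu , iu) , (U-project uu , B-project u) , ¬ip)
                (λ u (ui , _ , ¬ip) → ui , ¬ip))
              (VV.#-fibres (λ u → U? u ×-dec Iso? u) (λ v → (U? v ×-dec (B v y ≟ 0#)) ×-dec ¬? (Iso? v))
                (λ x≋x′ (ux , ¬ix) → U⊥-resp x≋x′ ux , ¬ix ∘ Iso-resp (sym ∘ x≋x′)) project fibre-aniso))))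
          (≡.trans (CV.#-split (λ u → U? u ×-dec (B u y ≟ 0#)) Iso?)
            (≡.cong (ℕ._+ CV.# (λ u → (U? u ×-dec (B u y ≟ 0#)) ×-dec ¬? (Iso? u))) (CV.#-cong _ _
                (λ _ ((uu , Bu) , iu) → uu , Bu , iu) (λ _ (uu , Bu , iu) → (uu , Bu) , iu))))
          where
          combine : ∀ {a b c w} → a ≡ b ℕ.* 1 ℕ.+ c ℕ.* suc q → w ≡ b ℕ.+ c → a ℕ.+ q ℕ.* b ≡ suc q ℕ.* w
          combine {b = b} {c} ≡.refl ≡.refl = fibre-sum b c q

      -- For isotropic y and B u y ≈ 1, the vector u + t y is isotropic iff
      -- trace t ≈ - B u u, which has q solutions t.
      module Isotropic (y : V) (uy : U y) (iso : Iso y) where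
        private
          B-shift : ∀ u t → B (u ⊕ t ⊙ y) y ≈ B u y
          B-shift u t = trans (B-⊕ˡ u t y y) (trans (+-congˡ (trans (*-congˡ iso) (zeroʳ t))) (+-identityʳ _))

          B-shift-shift : ∀ u t → B u y ≈ 1# → B (u ⊕ t ⊙ y) (u ⊕ t ⊙ y) ≈ B u u + trace t
          B-shift-shift u t Buy≈1 = begin
            B (u ⊕ t ⊙ y) (u ⊕ t ⊙ y)                               ≈⟨ B-⊕-⊕ u t y ⟩
            B u u + conj t * B u y + t * (B y u + conj t * B y y)   ≈⟨ +-cong (+-congˡ (trans (*-congˡ Buy≈1) (*-identityʳ _)))
                (trans (*-congˡ (trans (+-cong (trans (sym (conj-B u y)) (trans (conj-cong Buy≈1) conj-1))
                    (trans (*-congˡ iso) (zeroʳ _))) (+-identityʳ _))) (*-identityʳ t)) ⟩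
            B u u + conj t + t                                      ≈⟨ solve 3 (λ b t t′ → b :+ t′ :+ t := b :+ (t :+ t′)) refl (B u u) t (conj t) ⟩
            B u u + trace t                                         ∎

        -- Double counting of the pairs (u, t) with u + t y isotropic. As y is isotropic,
        -- translation by t y preserves `B u y`, so every t accounts for as many u as there are
        -- isotropic vectors in the slice.
        #isotropic : CV.# (λ u → U? u ×-dec (B u y ≟ 1#)) ℕ.* q ≡
                     q ℕ.^ 2 ℕ.* CV.# (λ u → (U? u ×-dec Iso? u) ×-dec (B u y ≟ 1#))
        #isotropic = ≡.trans
          (VF.double-count (λ u → U? u ×-dec (B u y ≟ 1#)) (λ t → t ≟ t)
            {R = λ u t → (U u × B u y ≈ 1#) × Iso (u ⊕ t ⊙ y)} (λ u t → (U? u ×-dec (B u y ≟ 1#)) ×-dec Iso? (u ⊕ t ⊙ y))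
            proj₁ (λ _ → refl)
            (λ u (uu , Buy≈1) → ≡.trans
              (CF.#-cong _ (λ t → trace t ≟ - B u u)
                (λ t (_ , it) → trans (solve 2 (λ b t → t := b :+ t :- b) refl (B u u) (trace t)) (trans (+-congʳ (trans (sym (B-shift-shift u t Buy≈1)) it)) (+-identityˡ _)))
                (λ t eq → (uu , Buy≈1) , trans (B-shift-shift u t Buy≈1) (trans (+-congˡ eq) (-‿inverseʳ _))))
              (#trace≈ (Real-neg (B-real u))))
            (λ t _ → VV.#-subset-bijection _ (λ u → (U? u ×-dec Iso? u) ×-dec (B u y ≟ 1#))
              (λ x≋x′ ((ux , Bx) , ix) → (U-resp x≋x′ ux , trans (B-congˡ y (sym ∘ x≋x′)) Bx) , Iso-resp
                  (λ i → +-congʳ {t * y i} (x≋x′ i)) ix)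
              (λ x≋x′ ((ux , ix) , Bx) → (U-resp x≋x′ ux , Iso-resp x≋x′ ix) , trans (B-congˡ y (sym ∘ x≋x′)) Bx)
              (_⊕ t ⊙ y) (_⊕ - t ⊙ y) (λ x≋x′ i → +-congʳ (x≋x′ i)) (λ x≋x′ i → +-congʳ (x≋x′ i))
              (λ {u} ((uu , Bu) , iu) → (U-closed t uu uy , iu) , trans (B-shift u t) Bu)
              (λ {u} ((uu , iu) , Bu) → (U-closed (- t) uu uy , trans (B-shift u (- t)) Bu) , Iso-resp
                  (λ i → sym (cancelʳ u t i)) iu)
              (λ {u} _ i → solve 3 (λ u t y → u :+ t :* y :+ (:- t) :* y := u) refl (u i) t (y i))
              (λ {u} _ i → cancelʳ u t i)))
          (≡.cong (ℕ._* CV.# (λ u → (U? u ×-dec Iso? u) ×-dec (B u y ≟ 1#))) (CF.#-all (λ t → t ≟ t) (λ _ → refl)))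
          where
          cancelʳ : ∀ u t i → u i + - t * y i + t * y i ≈ u i
          cancelʳ u t i = solve 3 (λ u t y → u :+ (:- t) :* y :+ t :* y := u) refl (u i) t (y i)

-- The equations between the counts, and constancy of the vector counts.

module Constancy where

  open Counting
  open RingSolver
  open FiniteField
  open HermitianForm
  open import Defs using (IsPrimePower)
  open import Algebra.Bundles using (CommutativeRing)
  open import Data.Fin.Base as Fin using (Fin; suc)
  import Data.Fin.Properties as Fin
  open import Data.Fin.Patterns using (0F; 1F; 2F; 3F)
  open import Data.Nat.Base as ℕ using (ℕ; suc; s≤s; z≤n)
  import Data.Nat.DivMod as ℕ
  import Data.Nat.Properties as ℕ
  open import Data.Product.Base using (∃; _×_; _,_; proj₁; proj₂)
  open import Data.Unit.Base using (⊤; tt)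
  open import Function.Base using (_∘_; id)
  open import Level using (Level; _⊔_) renaming (suc to lsuc)
  open import Relation.Binary.Core using (Rel)
  open import Relation.Binary.Definitions using (_Respects_; Symmetric) renaming (Decidable to Decidable₂)
  open import Relation.Binary.PropositionalEquality.Core as ≡ using (_≡_)
  open import Relation.Nullary using (¬_; Dec; yes; ¬?; _×-dec_)
  open import Relation.Unary using (Pred; Decidable)

  private
    variable
      a c ℓ p : Level
      A : Set a
      K : Rel A p
      f g h : A → A → ℕ

  Constant : {A : Set a} → Rel A p → (A → A → ℕ) → Set (a ⊔ p)
  Constant K f = ∃ λ m → ∀ {x y} → K x y → f x y ≡ m

  constant-⊆ : {K L : Rel A p} → (∀ {x y} → K x y → L x y) → Constant L f → Constant K f
  constant-⊆ K⊆L (m , f≡m) = m , f≡m ∘ K⊆L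

  constant-≡ : Constant K f → (∀ {x y} → K x y → g x y ≡ f x y) → Constant K g
  constant-≡ (m , f≡m) g≡f = m , λ kxy → ≡.trans (g≡f kxy) (f≡m kxy)

  constant-+ : Constant K f → Constant K g → Constant K (λ x y → f x y ℕ.+ g x y)
  constant-+ (m , f≡m) (n , g≡n) = m ℕ.+ n , λ kxy → ≡.cong₂ ℕ._+_ (f≡m kxy) (g≡n kxy)

  constant-* : ∀ k → Constant K f → Constant K (λ x y → k ℕ.* f x y)
  constant-* k (m , f≡m) = k ℕ.* m , λ kxy → ≡.cong (k ℕ.*_) (f≡m kxy)

  -- Solves f + g = h for g. Truncation cannot matter: the equation holds at every pair in K, and if
  -- there is none the value is arbitrary.
  constant-∸ : Constant K f → Constant K h → (∀ {x y} → K x y → f x y ℕ.+ g x y ≡ h x y) → Constant K g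
  constant-∸ {f = f} (m , f≡m) (n , h≡n) f+g≡h = n ℕ.∸ m , λ {x} {y} kxy →
    ≡.trans (≡.sym (ℕ.m+n∸m≡n (f x y) _)) (≡.cong₂ ℕ._∸_ (≡.trans (f+g≡h kxy) (h≡n kxy)) (f≡m kxy))

  -- Solves k * g = h for g; the division is exact as soon as K holds for some pair.
  constant-/ : ∀ k .{{_ : ℕ.NonZero k}} → Constant K h → (∀ {x y} → K x y → k ℕ.* g x y ≡ h x y) → Constant K g
  constant-/ {g = g} k (m , h≡m) kg≡h = m ℕ./ k , λ {x} {y} kxy → ≡.trans (≡.sym (ℕ.m*n/n≡m (g x y) k))
    (≡.cong (ℕ._/ k) (≡.trans (ℕ.*-comm (g x y) k) (≡.trans (kg≡h kxy) (h≡m kxy))))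

  module HermitianScheme (R : CommutativeRing c ℓ) {q : ℕ} (pp : IsPrimePower q)
                         (isFiniteField : IsFiniteField R (q ℕ.^ 2)) (n : ℕ) where
    open CommutativeRing R hiding (zero)
    open HermitianSpace R pp isFiniteField n public
    open Solver R
    open import Relation.Binary.Reasoning.Setoid setoid

    #units : ℕ
    #units = CF.# (λ s → ¬? (s ≟ 0#))

    instance
      q≢0 : ℕ.NonZero q
      q≢0 = ℕ.>-nonZero (ℕ.≤-trans (s≤s z≤n) 2≤q)

      q²≢0 : ℕ.NonZero (q ℕ.^ 2)
      q²≢0 = ℕ.m^n≢0 q 2

      #≉0≢0 : ℕ.NonZero #units
      #≉0≢0 = ℕ.≢-nonZero λ #≡0 → ℕ.<⇒≢ (ℕ.<-≤-trans 2≤q (ℕ.m≤m*n q (q ℕ.* 1) {{ℕ.m*n≢0 q 1}}))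
        (≡.trans (≡.cong suc (≡.sym #≡0)) #≉0)

    -- A relation between anisotropic points, in terms of coordinate vectors.
    record Relation : Set (c ⊔ lsuc ℓ) where
      field
        holds   : Rel V ℓ
        dec     : Decidable₂ holds
        resp    : ∀ x → holds x Respects _≋_
        hom     : ∀ x → Homogeneous (holds x)
        sym-rel : ∀ {x z} → ¬ Iso x → ¬ Iso z → holds x z → holds z x

    open Relation

    infixl 6 _∖_
    _∖_ : Relation → Relation → Relation
    P ∖ Q = record
      { holds   = λ x z → holds P x z × ¬ holds Q x z
      ; dec     = λ x z → dec P x z ×-dec ¬? (dec Q x z)
      ; resp    = λ x z≋z′ (pxz , ¬qxz) → resp P x z≋z′ pxz , ¬qxz ∘ resp Q x (sym ∘ z≋z′)
      ; hom     = λ x s≉0 (pxz , ¬qxz) → hom P x s≉0 pxz , ¬qxz ∘ unscale x s≉0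
      ; sym-rel = λ ax az (pxz , ¬qxz) → sym-rel P ax az pxz , ¬qxz ∘ sym-rel Q az ax
      }
      where
      unscale : ∀ x {s z} → ¬ s ≈ 0# → holds Q x (s ⊙ z) → holds Q x z
      unscale x {s} {z} s≉0 qsz with t , ts≈1 ← inverse s s≉0 =
        resp Q x (λ i → trans (sym (*-assoc t s (z i))) (trans (*-congʳ ts≈1) (*-identityˡ (z i))))
          (hom Q x (λ t≈0 → 1≉0 (trans (sym ts≈1) (trans (*-congʳ t≈0) (zeroˡ s)))) qsz)

    -- `𝟙` is the full relation. `T` is the vanishing of the Gram determinant, which proportional
    -- vectors satisfy too, so that proper tangency requires removing `E`.
    𝟙 E T O : Relation
    𝟙 = record { holds = λ _ _ → 0# ≈ 0# ; dec = λ _ _ → yes refl ; resp = λ _ _ _ → refl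
               ; hom = λ _ _ _ → refl ; sym-rel = λ _ _ _ → refl }
    E = record
      { holds   = λ x z → ∀ i → B x x * z i ≈ B z x * x i
      ; dec     = λ x z → Fin.all? (λ i → B x x * z i ≟ B z x * x i)
      ; resp    = λ x z≋z′ exz i → trans (*-congˡ (sym (z≋z′ i))) (trans (exz i) (*-congʳ (B-congˡ x z≋z′)))
      ; hom     = λ x {z} {s} _ exz i → trans (solve 3 (λ b s z → b :* (s :* z) := s :* (b :* z)) refl (B x x) s (z i))
          (trans (*-congˡ (exz i)) (trans (sym (*-assoc s (B z x) (x i))) (*-congʳ (sym (B-⊙ˡ s z x)))))
      ; sym-rel = λ {x} {z} ax _ exz i → *-cancelˡ-≉0 ax (begin
          B x x * (B z z * x i)   ≈⟨ *-assoc (B x x) (B z z) (x i) ⟨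
          B x x * B z z * x i     ≈⟨ *-congʳ (E-gram exz) ⟨
          B z x * B x z * x i     ≈⟨ solve 3 (λ b b′ x → b :* b′ :* x := b′ :* (b :* x)) refl (B z x) (B x z) (x i) ⟩
          B x z * (B z x * x i)   ≈⟨ *-congˡ (exz i) ⟨
          B x z * (B x x * z i)   ≈⟨ solve 3 (λ b b′ x → b :* (b′ :* x) := b′ :* (b :* x)) refl (B x z) (B x x) (z i) ⟩
          B x x * (B x z * z i)   ∎)
      }
      where
      E-gram : ∀ {x z} → (∀ i → B x x * z i ≈ B z x * x i) → B z x * B x z ≈ B x x * B z z
      E-gram {x} {z} exz = trans (sym (B-⊙ˡ (B z x) x z)) (trans (B-congˡ z (sym ∘ exz)) (B-⊙ˡ (B x x) z z))
    T = record
      { holds   = λ x z → norm (B z x) ≈ B x x * B z z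
      ; dec     = λ x z → norm (B z x) ≟ B x x * B z z
      ; resp    = λ x z≋z′ txz → trans (norm-cong (B-congˡ x (sym ∘ z≋z′))) (trans txz (*-congˡ (B-cong z≋z′ z≋z′)))
      ; hom     = λ x {z} {s} _ txz → begin
          norm (B (s ⊙ z) x)             ≈⟨ trans (norm-cong (B-⊙ˡ s z x)) (norm-* s (B z x)) ⟩
          norm s * norm (B z x)          ≈⟨ *-congˡ txz ⟩
          norm s * (B x x * B z z)       ≈⟨ solve 3 (λ a b c → a :* (b :* c) := b :* (a :* c)) refl (norm s) (B x x) (B z z) ⟩
          B x x * (norm s * B z z)       ≈⟨ *-congˡ (B-⊙-⊙ s z) ⟨
          B x x * B (s ⊙ z) (s ⊙ z)      ∎
      ; sym-rel = λ {x} {z} _ _ txz → trans (norm-B-sym x z) (trans txz (*-comm (B x x) (B z z)))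
      }
    O = record
      { holds   = λ x z → B z x ≈ 0#
      ; dec     = λ x z → B z x ≟ 0#
      ; resp    = λ x z≋z′ oxz → trans (B-congˡ x (sym ∘ z≋z′)) oxz
      ; hom     = λ x {z} {s} _ oxz → trans (B-⊙ˡ s z x) (trans (*-congˡ oxz) (zeroʳ s))
      ; sym-rel = λ {x} {z} _ _ → B-sym-≈0 {z} {x}
      }

    E⇒T : ∀ {x z} → holds E x z → holds T x z
    E⇒T {x} {z} exz = trans (norm-B z x) (trans (sym (B-⊙ˡ (B z x) x z)) (trans (B-congˡ z (sym ∘ exz)) (B-⊙ˡ (B x x) z z)))

    O⇒¬T : ∀ {x z} → ¬ Iso x → ¬ Iso z → holds O x z → ¬ holds T x z
    O⇒¬T ax az oxz txz = *≉0 ax az (trans (sym txz) (norm-≈0 oxz))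

    proportional : ∀ {x z} → ¬ Iso x → ¬ Iso z → holds E x z → ∃ λ s → ¬ s ≈ 0# × (z ≋ s ⊙ x)
    proportional {x} {z} ax az exz with d , dBxx≈1 ← inverse (B x x) ax = d * B z x , s≉0 , z≋
      where
      z≋ : z ≋ (d * B z x) ⊙ x
      z≋ i = begin
        z i                     ≈⟨ trans (*-congʳ dBxx≈1) (*-identityˡ (z i)) ⟨
        d * B x x * z i         ≈⟨ trans (*-assoc d (B x x) (z i)) (*-congˡ (exz i)) ⟩
        d * (B z x * x i)       ≈⟨ *-assoc d (B z x) (x i) ⟨
        d * B z x * x i         ∎
      s≉0 : ¬ d * B z x ≈ 0#
      s≉0 s≈0 = az (Iso-resp (sym ∘ z≋) (trans (B-⊙-⊙ _ x) (trans (*-congʳ (norm-≈0 s≈0)) (zeroˡ _))))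

    multiple⇒E : ∀ {x z} s → z ≋ s ⊙ x → holds E x z
    multiple⇒E {x} {z} s z≋sx i = begin
      B x x * z i            ≈⟨ *-congˡ (z≋sx i) ⟩
      B x x * (s * x i)      ≈⟨ solve 3 (λ b s x → b :* (s :* x) := s :* b :* x) refl (B x x) s (x i) ⟩
      s * B x x * x i        ≈⟨ *-congʳ (trans (B-congˡ x z≋sx) (B-⊙ˡ s x x)) ⟨
      B z x * x i            ∎

    E-invariantʳ : ∀ (Q : Relation) {x z} y → ¬ Iso x → ¬ Iso z → holds E x z → holds Q y x → holds Q y z
    E-invariantʳ Q y ax az exz qyx with s , s≉0 , z≋sx ← proportional ax az exz = resp Q y (sym ∘ z≋sx) (hom Q y s≉0 qyx)

    E-invariantˡ : ∀ (Q : Relation) {x y z} → ¬ Iso x → ¬ Iso y → ¬ Iso z → holds E x y → holds Q x z → holds Q y z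
    E-invariantˡ Q {z = z} ax ay az exy qxz = sym-rel Q az ay (E-invariantʳ Q z ax ay exy (sym-rel Q ax az qxz))

    -- An intersection number multiplied by `#units`, as every projective point occurs with all its
    -- coordinate vectors.
    count : Relation → Relation → V → V → ℕ
    count P Q x y = CV.# (λ z → ¬? (Iso? z) ×-dec (dec P x z ×-dec dec Q y z))

    module _ {K : Rel V ℓ} (K-sym : Symmetric K) where
      constant-swap : ∀ P Q → Constant K (count P Q) → Constant K (count Q P)
      constant-swap P Q (m , count≡m) = m , λ kxy →
        ≡.trans (CV.#-cong _ _ (λ _ (az , p , q) → az , q , p) (λ _ (az , q , p) → az , p , q)) (count≡m (K-sym kxy))

    module _ {K : Rel V ℓ} (K⇒aniso : ∀ {x y} → K x y → ¬ Iso x) where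
      -- The inclusion is asked of anisotropic vectors only, since an isotropic z orthogonal to x
      -- satisfies both `O` and `T`.
      constant-∖ : ∀ P P′ Q → (∀ {x z} → ¬ Iso x → ¬ Iso z → holds P′ x z → holds P x z) →
        Constant K (count P Q) → Constant K (count P′ Q) → Constant K (count (P ∖ P′) Q)
      constant-∖ P P′ Q P′⊆P cP cP′ = constant-∸ cP′ cP λ {x} {y} kxy → ≡.sym (≡.trans
        (CV.#-split (λ z → ¬? (Iso? z) ×-dec (dec P x z ×-dec dec Q y z)) (dec P′ x))
        (≡.cong₂ ℕ._+_
          (CV.#-cong _ _ (λ z ((az , _ , q) , p′) → az , p′ , q) (λ z (az , p′ , q) → (az , P′⊆P (K⇒aniso kxy) az p′ , q) , p′))
          (CV.#-cong _ _ (λ z ((az , p , q) , ¬p′) → az , (p , ¬p′) , q) (λ z (az , (p , ¬p′) , q) → (az , p , q) , ¬p′))))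

    module Total = Subspace {U = λ _ → ⊤} (λ _ → yes tt) (λ _ _ → tt) (λ _ _ _ → tt)

    ⊥-resp : ∀ {x} → (λ u → B u x ≈ 0#) Respects _≋_
    ⊥-resp {x} u≋v Bux≈0 = trans (B-congˡ x (sym ∘ u≋v)) Bux≈0

    ⊥-closed : ∀ {x u v} s → B u x ≈ 0# → B v x ≈ 0# → B (u ⊕ s ⊙ v) x ≈ 0#
    ⊥-closed {x} {u} {v} s Bux≈0 Bvx≈0 =
      trans (B-⊕ˡ u s v x) (trans (+-cong Bux≈0 (trans (*-congˡ Bvx≈0) (zeroʳ s))) (+-identityˡ 0#))

    module Perp (x : V) = Subspace {U = λ u → B u x ≈ 0#} (λ u → B u x ≟ 0#) ⊥-resp ⊥-closed

    PerpIso? : ∀ x u → Dec (B u x ≈ 0# × Iso u)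
    PerpIso? x u = (B u x ≟ 0#) ×-dec Iso? u

    w₁ i₁ : V → ℕ
    w₁ x = CV.# (λ u → B u x ≟ 0#)
    i₁ x = CV.# (PerpIso? x)

    -- `w` counts all vectors of the intersection of the perps and `i` the isotropic ones. `a₂`
    -- counts the isotropic u in x^⊥ with `B u y` equal to 1, or equally to any other nonzero value.
    w₂ i₂ a₂ : V → V → ℕ
    w₂ x y = CV.# (λ u → (B u x ≟ 0#) ×-dec (B u y ≟ 0#))
    i₂ x y = CV.# (λ u → PerpIso? x u ×-dec (B u y ≟ 0#))
    a₂ x y = CV.# (λ u → PerpIso? x u ×-dec (B u y ≟ 1#))

    Aniso₁ : Rel V ℓ
    Aniso₁ x _ = ¬ Iso x

    constant-w₁ : Constant Aniso₁ (λ x _ → w₁ x)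
    constant-w₁ = constant-/ (q ℕ.^ 2) (CV.# (λ _ → yes tt) , λ _ → ≡.refl) λ {x} ax →
      ≡.sym (≡.trans (Total.#U≡q²*#U⊥ x x tt ax) (≡.cong (q ℕ.^ 2 ℕ.*_) (CV.#-cong _ _ (λ _ → proj₂) (λ _ Bux → tt , Bux))))

    -- Solves `#UIso + q * i₁ x = (q + 1) * w₁ x`, the fibration of the whole space over x^⊥.
    constant-i₁ : Constant Aniso₁ (λ x _ → i₁ x)
    constant-i₁ = constant-/ q (constant-∸ (Total.#UIso , λ _ → ≡.refl) (constant-* (suc q) constant-w₁) λ {x} ax →
      ≡.trans (Total.Anisotropic.#UIso≡ x tt ax) (≡.cong (suc q ℕ.*_) (CV.#-cong _ _ (λ _ → proj₂) (λ _ Bux → tt , Bux))))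
      λ {x} _ → ≡.cong (q ℕ.*_) (CV.#-cong _ _ (λ _ Bux → tt , Bux) (λ _ → proj₂))

    PerpIso-resp : ∀ {x} → (λ u → B u x ≈ 0# × Iso u) Respects _≋_
    PerpIso-resp u≋v (Bux , iu) = ⊥-resp u≋v Bux , Iso-resp u≋v iu

    PerpIso-homogeneous : ∀ {x} → Homogeneous (λ u → B u x ≈ 0# × Iso u)
    PerpIso-homogeneous {x} {u} {s} s≉0 (Bux , iu) = hom O x {u} s≉0 Bux , Iso-homogeneous {u} s≉0 iu

    module PerpIsoSlice (x y : V) = Slice {P = λ u → B u x ≈ 0# × Iso u} (PerpIso? x) PerpIso-resp PerpIso-homogeneous
      (λ u → B u y) (B-congˡ y) (λ _ → B-⊙ˡ _ _ y)

    -- Slices the isotropic vectors of x^⊥ by `B u y`: the slice at 0, and equal slices at the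
    -- nonzero values.
    i₁≡ : ∀ x y → i₂ x y ℕ.+ #units ℕ.* a₂ x y ≡ i₁ x
    i₁≡ x y = ≡.sym (≡.trans (CV.#-split (PerpIso? x) (λ u → B u y ≟ 0#))
      (≡.cong (i₂ x y ℕ.+_) (PerpIsoSlice.#slices x y (λ s → ¬? (s ≟ 0#)) (λ a≈b a≉0 b≈0 → a≉0 (trans a≈b b≈0)) id)))

    module Pair {x y : V} (ax : ¬ Iso x) (ay : ¬ Iso y) (¬exy : ¬ holds E x y) where
      d : Carrier
      d = proj₁ (inverse (B x x) ax)

      dBxx≈1 : d * B x x ≈ 1#
      dBxx≈1 = proj₂ (inverse (B x x) ax)

      private
        project : V → V
        project u = u ⊕ - (B u x * d) ⊙ x

        B-project : ∀ u → B (project u) x ≈ 0#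
        B-project u = begin
          B (project u) x                  ≈⟨ B-⊕ˡ u (- (B u x * d)) x x ⟩
          B u x + - (B u x * d) * B x x    ≈⟨ solve 3 (λ b d e → b :+ (:- (b :* d)) :* e := b :- b :* (d :* e)) refl (B u x) d (B x x) ⟩
          B u x - B u x * (d * B x x)      ≈⟨ +-congˡ (-‿cong (trans (*-congˡ dBxx≈1) (*-identityʳ _))) ⟩
          B u x - B u x                    ≈⟨ -‿inverseʳ _ ⟩
          0#                               ∎

      -- Lies in x^⊥ and induces there the same functional as y, so that counts within the subspace
      -- x^⊥ apply to y.
      y′ : V
      y′ = project y

      B-y′-x : B y′ x ≈ 0#
      B-y′-x = B-project y

      B-y′ : ∀ {u} → B u x ≈ 0# → B u y′ ≈ B u y
      B-y′ {u} Bux≈0 = trans (B-⊕ʳ y _ x u) (trans (+-congˡ (trans (*-congˡ Bux≈0) (zeroʳ _))) (+-identityʳ _))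

      -- Replacing y by y′ preserves the Gram determinant, which for the orthogonal pair x, y′ is
      -- the product of the diagonal entries.
      Bxx*By′y′ : B x x * B y′ y′ ≈ B x x * B y y - norm (B y x)
      Bxx*By′y′ = begin
        B x x * B y′ y′                                   ≈⟨ *-congˡ (trans (B-y′ {y′} (B-project y)) (B-⊕ˡ y _ x y)) ⟩
        B x x * (B y y + - (B y x * d) * B x y)           ≈⟨ solve 5 (λ a b c d e → a :* (b :+ (:- (c :* d)) :* e) := a :* b :- (d :* a) :* (c :* e)) refl (B x x) (B y y) (B y x) d (B x y) ⟩
        B x x * B y y - d * B x x * (B y x * B x y)       ≈⟨ +-congˡ (-‿cong (trans (*-congʳ dBxx≈1) (*-identityˡ _))) ⟩
        B x x * B y y - B y x * B x y                     ≈⟨ +-congˡ (-‿cong (norm-B y x)) ⟨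
        B x x * B y y - norm (B y x)                      ∎

      y′-iso : holds T x y → Iso y′
      y′-iso txy = *≈0⇒≈0 ax (trans Bxx*By′y′ (x≈y⇒x∙y⁻¹≈ε (sym txy)))

      y′-aniso : ¬ holds T x y → ¬ Iso y′
      y′-aniso ¬txy iy′ = ¬txy (sym (x∙y⁻¹≈ε⇒x≈y _ _ (trans (sym Bxx*By′y′) (trans (*-congˡ iy′) (zeroʳ _)))))

      y′≉0 : ∃ λ i → ¬ y′ i ≈ 0#
      y′≉0 = Fin.¬∀⟶∃¬ (suc n) _ (λ i → y′ i ≟ 0#) λ y′≈0 → ¬exy (multiple⇒E (B y x * d)
        λ i → trans (solve 2 (λ y m → y := y :+ :- m :+ m) refl (y i) (B y x * d * x i))
          (trans (+-congʳ (trans (+-congˡ (solve 2 (λ m x → :- (m :* x) := (:- m) :* x) refl (B y x * d) (x i))) (y′≈0 i))) (+-identityˡ _)))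

      -- The y′ + μ x represent the points of the line other than x, which is anisotropic, so the
      -- isotropic points of the line are counted here. With y′ isotropic the condition reduces to
      -- norm μ = 0.
      #isotropic-tangent : holds T x y → CF.# (λ μ → Iso? (y′ ⊕ μ ⊙ x)) ≡ 1
      #isotropic-tangent txy = ≡.trans
        (CF.#-cong _ (_≟ 0#)
          (λ μ i → norm≈0⇒≈0 (*≈0⇒≈0 ax (trans (*-comm _ _) (trans (sym (+-identityˡ _)) (trans (+-congʳ (sym (y′-iso txy)))
              (trans (sym (B-⊕-⊥ y′ μ x B-y′-x)) i))))))
          (λ μ μ≈0 → trans (B-⊕-⊥ y′ μ x B-y′-x) (trans (+-cong (y′-iso txy) (trans (*-congʳ (norm-≈0 μ≈0)) (zeroˡ _)))
              (+-identityˡ 0#))))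
        (CF.#-one (_≟ 0#) (λ s≈t s≈0 → trans (sym s≈t) s≈0) 0# refl (λ _ → id))

      #isotropic-secant : ¬ holds T x y → CF.# (λ μ → Iso? (y′ ⊕ μ ⊙ x)) ≡ suc q
      #isotropic-secant ¬txy = ≡.trans
        (CF.#-cong _ (λ μ → norm μ ≟ - (B y′ y′ * d))
          (λ μ i → *-cancelˡ-≉0 ax (trans (solve 3 (λ b m y → b :* m := y :+ m :* b :- y) refl (B x x) (norm μ) (B y′ y′))
            (trans (+-congʳ (trans (sym (B-⊕-⊥ y′ μ x B-y′-x)) i)) (trans (+-identityˡ _) (trans (-‿cong (sym (By′y′d))) (solve 3 (λ d b y → :- (d :* b :* y) := b :* (:- (y :* d))) refl d (B x x) (B y′ y′)))))))
          (λ μ Nμ → trans (B-⊕-⊥ y′ μ x B-y′-x) (trans (+-congˡ (trans (*-congʳ Nμ)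
            (trans (solve 3 (λ d b y → (:- (y :* d)) :* b := :- (d :* b :* y)) refl d (B x x) (B y′ y′)) (-‿cong By′y′d)))) (-‿inverseʳ _))))
        (#norm≈ (Real-neg (Real-* (B-real y′) (Real-inverse dBxx≈1 (B-real x))))
          (λ a≈0 → *≉0 (y′-aniso ¬txy) (λ d≈0 → 1≉0 (trans (sym dBxx≈1) (trans (*-congʳ d≈0) (zeroˡ _))))
            (trans (sym (-‿involutive _)) (trans (-‿cong a≈0) -0#≈0#))))
        where
        By′y′d : d * B x x * B y′ y′ ≈ B y′ y′
        By′y′d = trans (*-congʳ dBxx≈1) (*-identityˡ _)

      private
        -- Shows that y induces a nonzero functional on x^⊥. At an index where y′ is nonzero, the
        -- basis vector is not orthogonal to y′, and projecting it to x^⊥ does not change that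
        -- product because y′ is orthogonal to x.
        e : V
        e = project (basis (proj₁ y′≉0))

        Bey≉0 : ¬ B e y ≈ 0#
        Bey≉0 Bey≈0 = conj-≉0 (proj₂ y′≉0) (begin
          conj (y′ i)                       ≈⟨ conj-cong (B-basis i y′) ⟨
          conj (B y′ (basis i))             ≈⟨ conj-B y′ (basis i) ⟩
          B (basis i) y′                    ≈⟨ +-identityʳ _ ⟨
          B (basis i) y′ + 0#               ≈⟨ +-congˡ (trans (*-congˡ (B-sym-≈0 {y′} {x} (B-project y))) (zeroʳ _)) ⟨
          B (basis i) y′ + _ * B x y′       ≈⟨ B-⊕ˡ (basis i) _ x y′ ⟨
          B e y′                            ≈⟨ B-y′ {e} (B-project (basis i)) ⟩
          B e y                             ≈⟨ Bey≈0 ⟩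
          0#                                ∎)
          where i = proj₁ y′≉0

      w₁≡ : q ℕ.^ 2 ℕ.* w₂ x y ≡ w₁ x
      w₁≡ = ≡.sym (Perp.#U≡q²*#U⊥ x y e (B-project _) Bey≉0)

      -- The line is secant: the projection of y to x^⊥ is anisotropic.
      secant : ¬ holds T x y → i₁ x ℕ.+ q ℕ.* i₂ x y ≡ suc q ℕ.* w₂ x y
      secant ¬txy = ≡.trans
        (≡.cong (λ i → i₁ x ℕ.+ q ℕ.* i) (CV.#-cong _ _ (λ u ((Bux , iu) , Buy) → Bux , trans (B-y′ {u} Bux) Buy , iu)
                                                       (λ u (Bux , Buy′ , iu) → (Bux , iu) , trans (sym (B-y′ {u} Bux)) Buy′)))
        (≡.trans (Perp.Anisotropic.#UIso≡ x y′ (B-project y) (y′-aniso ¬txy))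
          (≡.cong (suc q ℕ.*_) (CV.#-cong _ _ (λ u (Bux , Buy′) → Bux , trans (sym (B-y′ {u} Bux)) Buy′)
                                              (λ u (Bux , Buy) → Bux , trans (B-y′ {u} Bux) Buy))))

      -- The line is tangent: the projection of y to x^⊥ is isotropic.
      tangent : holds T x y → q ℕ.^ 2 ℕ.* a₂ x y ≡ q ℕ.* w₂ x y
      tangent txy = ≡.trans
        (≡.cong (q ℕ.^ 2 ℕ.*_) (CV.#-cong _ _ (λ u ((Bux , iu) , Buy) → (Bux , iu) , trans (B-y′ {u} Bux) Buy)
                                              (λ u ((Bux , iu) , Buy′) → (Bux , iu) , trans (sym (B-y′ {u} Bux)) Buy′)))
        (≡.trans (≡.sym (Perp.Isotropic.#isotropic x y′ (B-project y) (y′-iso txy)))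
          (≡.trans (ℕ.*-comm _ q) (≡.cong (q ℕ.*_)
            (≡.trans (CV.#-cong _ _ (λ u (Bux , Buy′) → Bux , trans (sym (B-y′ {u} Bux)) Buy′)
                                    (λ u (Bux , Buy) → Bux , trans (B-y′ {u} Bux) Buy))
                     (Perp.#functional≡ x y e (B-project _) Bey≉0 1#)))))

    B-u+x : ∀ {x} u → B u x ≈ 0# → B (u ⊕ 1# ⊙ x) (u ⊕ 1# ⊙ x) ≈ B x x + B u u
    B-u+x {x} u Bux = trans (B-⊕-⊕ u 1# x) (trans (+-cong
      (trans (+-congˡ (trans (*-congˡ Bux) (zeroʳ _))) (+-identityʳ _))
      (trans (*-identityˡ _) (trans (+-cong (B-sym-≈0 {u} {x} Bux) (trans (*-congʳ conj-1) (*-identityˡ _)))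
          (+-identityˡ _)))) (+-comm _ _))

    -- Every z tangent to x is a multiple of x + u for a unique isotropic u in x^⊥.
    #tangent : ∀ {x} → ¬ Iso x → {Q : Pred V ℓ} (Q? : Decidable Q) → Q Respects _≋_ → Homogeneous Q →
      CV.# (λ z → ¬? (Iso? z) ×-dec (dec T x z ×-dec Q? z)) ≡
      #units ℕ.* CV.# (λ u → PerpIso? x u ×-dec Q? (u ⊕ 1# ⊙ x))
    #tangent {x} ax {Q} Q? Q-resp Q-hom = ≡.trans
        (CV.#-cong _ _ (λ z (az , txz , qz) → (az , txz , qz) , Lz≉0 az txz) (λ _ → proj₁))
        (≡.trans (S.#slices (λ s → ¬? (s ≟ 0#)) (λ a≈b a≉0 b≈0 → a≉0 (trans a≈b b≈0)) id)
          (≡.cong (#units ℕ.*_) (VV.#-subset-bijection _ _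
            (λ z≋z′ (P , Lz) → P-resp z≋z′ P , trans (*-congˡ (B-congˡ x (sym ∘ z≋z′))) Lz)
            (λ u≋v ((Bux , iu) , qu) → (trans (B-congˡ x (sym ∘ u≋v)) Bux , Iso-resp u≋v iu) , Q-resp (λ i → +-congʳ (u≋v i)) qu)
            (_⊕ - 1# ⊙ x) (_⊕ 1# ⊙ x) (λ z≋z′ i → +-congʳ (z≋z′ i)) (λ z≋z′ i → +-congʳ (z≋z′ i))
            -- With z = u + x and `B z x` equal to `B x x`, tangency reads
            -- `B x x * (B x x + B u u) ≈ B x x * B x x`, hence u is isotropic.
            (λ {z} ((az , txz , qz) , Lz) → let u = z ⊕ - 1# ⊙ x ; Bux = B-u z Lz in
              (Bux , *≈0⇒≈0 ax (+-cancelˡ (B x x * B x x) _ _ (begin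
                B x x * B x x + B x x * B u u            ≈⟨ distribˡ _ _ _ ⟨
                B x x * (B x x + B u u)                  ≈⟨ *-congˡ (B-u+x u Bux) ⟨
                B x x * B (u ⊕ 1# ⊙ x) (u ⊕ 1# ⊙ x)      ≈⟨ *-congˡ (B-cong (restore z) (restore z)) ⟨
                B x x * B z z                            ≈⟨ txz ⟨
                norm (B z x)                             ≈⟨ norm-cong (Lz≈1⇒ z Lz) ⟩
                B x x * conj (B x x)                     ≈⟨ *-congˡ (B-real x) ⟩
                B x x * B x x                            ≈⟨ +-identityʳ _ ⟨
                B x x * B x x + 0#                       ∎)))
              , Q-resp (restore z) qz)
            (λ {u} ((Bux , iu) , qu) → let Bzz≈Bxx = trans (B-u+x u Bux) (trans (+-congˡ iu) (+-identityʳ _))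
                                           Bzx≈Bxx = trans (B-⊕ˡ u 1# x x) (trans (+-cong Bux (*-identityˡ _)) (+-identityˡ _)) in
              ( (λ iz → ax (trans (sym Bzz≈Bxx) iz))
              , trans (norm-cong Bzx≈Bxx) (trans (*-congˡ (B-real x)) (*-congˡ (sym Bzz≈Bxx)))
              , qu) , trans (*-congˡ Bzx≈Bxx) dBxx≈1)
            (λ {z} _ i → sym (restore z i))
            (λ {u} _ i → solve 3 (λ u o x → u :+ o :* x :+ (:- o) :* x := u) refl (u i) 1# (x i)))))
      where
      d = proj₁ (inverse (B x x) ax)
      dBxx≈1 = proj₂ (inverse (B x x) ax)
      d≉0 : ¬ d ≈ 0#
      d≉0 d≈0 = 1≉0 (trans (sym dBxx≈1) (trans (*-congʳ d≈0) (zeroˡ _)))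
      Lz≉0 : ∀ {z} → ¬ Iso z → holds T x z → ¬ d * B z x ≈ 0#
      Lz≉0 az txz = *≉0 d≉0 λ Bzx≈0 → O⇒¬T ax az Bzx≈0 txz
      P-resp : (λ z → ¬ Iso z × holds T x z × Q z) Respects _≋_
      P-resp z≋z′ (az , txz , qz) = az ∘ Iso-resp (sym ∘ z≋z′) , resp T x z≋z′ txz , Q-resp z≋z′ qz
      P-hom : Homogeneous (λ z → ¬ Iso z × holds T x z × Q z)
      P-hom {z} {s} s≉0 (az , txz , qz) = (λ isz → *≉0 (norm-≉0 s≉0) az
          (trans (sym (B-⊙-⊙ s z)) isz)) , hom T x {z} s≉0 txz , Q-hom s≉0 qz
      -- `L z ≈ 1#` selects the multiple of z whose component along x is x itself. Tangent z have
      -- `L z` nonzero because they are not orthogonal to x.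
      L : V → Carrier
      L z = d * B z x
      L-⊙ : ∀ {s z} → ¬ s ≈ 0# → L (s ⊙ z) ≈ s * L z
      L-⊙ {s} {z} _ = trans (*-congˡ (B-⊙ˡ s z x)) (solve 3 (λ d s b → d :* (s :* b) := s :* (d :* b)) refl d s (B z x))
      module S = Slice {P = λ z → ¬ Iso z × holds T x z × Q z} (λ z → ¬? (Iso? z) ×-dec (dec T x z ×-dec Q? z)) P-resp P-hom
        L (λ z≋z′ → *-congˡ (B-congˡ x z≋z′)) L-⊙
      Lz≈1⇒ : ∀ z → d * B z x ≈ 1# → B z x ≈ B x x
      Lz≈1⇒ z Lz = *-cancelˡ-≉0 d≉0 (trans Lz (sym dBxx≈1))
      restore : ∀ z i → z i ≈ z i + - 1# * x i + 1# * x i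
      restore z i = solve 3 (λ u o x → u := u :+ (:- o) :* x :+ o :* x) refl (z i) 1# (x i)
      B-u : ∀ z → d * B z x ≈ 1# → B (z ⊕ - 1# ⊙ x) x ≈ 0#
      B-u z Lz = trans (B-⊕ˡ z (- 1#) x x) (trans (+-cong (Lz≈1⇒ z Lz) (trans (solve 2 (λ o b → (:- o) :* b := :- (o :* b)) refl 1# (B x x)) (-‿cong (*-identityˡ _)))) (-‿inverseʳ _))

    count-T : ∀ (Q : Relation) {x y} → ¬ Iso x → count T Q x y ≡
      #units ℕ.* CV.# (λ u → PerpIso? x u ×-dec dec Q y (u ⊕ 1# ⊙ x))
    count-T Q {y = y} ax = #tangent ax (dec Q y) (resp Q y) (hom Q y)

    private
      B-u+x-y : ∀ u x y → B (u ⊕ 1# ⊙ x) y ≈ B u y + B x y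
      B-u+x-y u x y = trans (B-⊕ˡ u 1# x y) (+-congˡ (*-identityˡ _))

    count-T-O-⊥ : ∀ {x y} → ¬ Iso x → holds O x y → count T O x y ≡ #units ℕ.* i₂ x y
    count-T-O-⊥ {x} {y} ax Byx≈0 = ≡.trans (count-T O ax) (≡.cong (#units ℕ.*_) (CV.#-cong _ _
      (λ u (P , Q) → P , trans (sym (B≈ u)) Q) (λ u (P , Q) → P , trans (B≈ u) Q)))
      where
      B≈ : ∀ u → B (u ⊕ 1# ⊙ x) y ≈ B u y
      B≈ u = trans (B-u+x-y u x y) (trans (+-congˡ (B-sym-≈0 {y} {x} Byx≈0)) (+-identityʳ _))

    -- Orthogonality of x + u to y means that `B u y` is `- B x y`, a nonzero value, and slices at
    -- nonzero values all have size `a₂`.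
    count-T-O-¬⊥ : ∀ {x y} → ¬ Iso x → ¬ holds O x y → count T O x y ≡ #units ℕ.* a₂ x y
    count-T-O-¬⊥ {x} {y} ax Byx≉0 = ≡.trans (count-T O ax) (≡.cong (#units ℕ.*_) (≡.trans (CV.#-cong _ _
      (λ u (P , Q) → P , trans (solve 2 (λ a b → a := a :+ b :- b) refl (B u y) (B x y)) (trans (+-congʳ (trans (sym (B-u+x-y u x y)) Q)) (+-identityˡ _)))
      (λ u (P , Q) → P , trans (B-u+x-y u x y) (trans (+-congʳ Q) (-‿inverseˡ _))))
      (PerpIsoSlice.#slice≡ x y λ -Bxy≈0 → Byx≉0 (B-sym-≈0 {x} {y} (trans (sym (-‿involutive _)) (trans (-‿cong -Bxy≈0) -0#≈0#))))))

    -- The values B u y for which x + u is tangent to y, where u is in x^⊥ and isotropic.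
    module TangentValues {x y : V} (ax : ¬ Iso x) (ay : ¬ Iso y) where
      C : Pred Carrier ℓ
      C s = norm (s + B x y) ≈ B y y * B x x

      C? : Decidable C
      C? s = norm (s + B x y) ≟ B y y * B x x

      C-resp : C Respects _≈_
      C-resp s≈t cs = trans (norm-cong (+-congʳ (sym s≈t))) cs

      -- The value 0 is that of u = 0, for which x + u is x itself.
      C0⇒T : ∀ {s} → s ≈ 0# → C s → holds T x y
      C0⇒T s≈0 cs = trans (norm-B-sym y x) (trans (norm-cong (sym (trans (+-congʳ s≈0) (+-identityˡ _)))) (trans cs (*-comm _ _)))

      T⇒C0 : ∀ {s} → s ≈ 0# → holds T x y → C s
      T⇒C0 s≈0 txy = trans (norm-cong (trans (+-congʳ s≈0) (+-identityˡ _))) (trans (norm-B-sym x y) (trans txy (*-comm _ _)))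

      -- The shift by `B x y` makes this a fibre of the norm over a nonzero real element.
      #C : CF.# C? ≡ suc q
      #C = ≡.trans (DoubleCount.#-bijection finite finite C? (λ t → norm t ≟ B y y * B x x) (λ s≈t Ns → trans
          (norm-cong (sym s≈t)) Ns)
          (mk-inverse (_+ B x y) (_- B x y) +-congʳ +-congʳ
            (λ t → solve 2 (λ t b → t :- b :+ b := t) refl t (B x y)) (λ t → solve 2 (λ t b → t :+ b :- b := t) refl t (B x y))) id id)
        (#norm≈ (Real-* (B-real y) (B-real x)) (*≉0 ay ax))

      count-T-T : count T T x y ≡ #units ℕ.* CV.# (λ u → PerpIso? x u ×-dec C? (B u y))
      count-T-T = ≡.trans (count-T T ax) (≡.cong (#units ℕ.*_) (CV.#-cong _ _
        (λ u (P , t) → P , trans (norm-cong (sym (B-u+x-y u x y))) (trans t (*-congˡ (B-u+x-u+x u P))))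
        (λ u (P , t) → P , trans (norm-cong (B-u+x-y u x y)) (trans t (*-congˡ (sym (B-u+x-u+x u P)))))))
        where
        B-u+x-u+x : ∀ u → B u x ≈ 0# × Iso u → B (u ⊕ 1# ⊙ x) (u ⊕ 1# ⊙ x) ≈ B x x
        B-u+x-u+x u (Bux , iu) = trans (B-u+x u Bux) (trans (+-congˡ iu) (+-identityʳ _))

      #C≉0 : CF.# (λ s → C? s ×-dec ¬? (s ≟ 0#)) ℕ.* a₂ x y ≡ CV.# (λ u → (PerpIso? x u ×-dec C? (B u y)) ×-dec ¬? (B u y ≟ 0#))
      #C≉0 = ≡.trans (≡.sym (PerpIsoSlice.#slices x y (λ s → C? s ×-dec ¬? (s ≟ 0#))
          (λ s≈t (cs , s≉0) → C-resp s≈t cs , s≉0 ∘ trans s≈t) proj₂))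
        (CV.#-cong _ _ (λ _ (P , cs , s≉0) → (P , cs) , s≉0) (λ _ ((P , cs) , s≉0) → P , cs , s≉0))

      private
        split : CV.# (λ u → PerpIso? x u ×-dec C? (B u y)) ≡
          CV.# (λ u → (PerpIso? x u ×-dec C? (B u y)) ×-dec (B u y ≟ 0#)) ℕ.+ CF.# (λ s → C? s ×-dec ¬? (s ≟ 0#)) ℕ.* a₂ x y
        split = ≡.trans (CV.#-split (λ u → PerpIso? x u ×-dec C? (B u y)) (λ u → B u y ≟ 0#))
          (≡.cong (CV.# (λ u → (PerpIso? x u ×-dec C? (B u y)) ×-dec (B u y ≟ 0#)) ℕ.+_) (≡.sym #C≉0))

      -- None of the q + 1 admissible values is 0, so each contributes `a₂`.
      count-T-T-secant : ¬ holds T x y → count T T x y ≡ #units ℕ.* (suc q ℕ.* a₂ x y)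
      count-T-T-secant ¬txy = ≡.trans count-T-T (≡.cong (#units ℕ.*_) (≡.trans split (≡.cong₂ ℕ._+_
        (CV.#-none _ λ u ((_ , cu) , u≈0) → ¬txy (C0⇒T u≈0 cu))
        (≡.cong (ℕ._* a₂ x y) (≡.trans (CF.#-cong _ C? (λ _ → proj₁) (λ _ cs → cs , λ s≈0 → ¬txy (C0⇒T s≈0 cs))) #C)))))

      -- One of the q + 1 admissible values is 0 and contributes `i₂` in place of `a₂`.
      count-T-T-tangent : holds T x y → count T T x y ≡ #units ℕ.* (i₂ x y ℕ.+ q ℕ.* a₂ x y)
      count-T-T-tangent txy = ≡.trans count-T-T (≡.cong (#units ℕ.*_) (≡.trans split (≡.cong₂ ℕ._+_
        (CV.#-cong _ _ (λ u ((P , _) , u≈0) → P , u≈0) (λ u (P , u≈0) → (P , T⇒C0 u≈0 txy) , u≈0))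
        (≡.cong (ℕ._* a₂ x y) (ℕ.suc-injective (≡.trans (≡.sym #C≡) #C))))))
        where
        #C≡ : CF.# C? ≡ suc (CF.# (λ s → C? s ×-dec ¬? (s ≟ 0#)))
        #C≡ = ≡.trans (CF.#-split C? (_≟ 0#)) (≡.cong (ℕ._+ CF.# (λ s → C? s ×-dec ¬? (s ≟ 0#)))
          (≡.trans (CF.#-cong _ (_≟ 0#) (λ _ → proj₂) (λ _ s≈0 → T⇒C0 s≈0 txy , s≈0))
                   (CF.#-one (_≟ 0#) (λ s≈t s≈0 → trans (sym s≈t) s≈0) 0# refl (λ _ → id))))

    constant-T-𝟙 : Constant Aniso₁ (count T 𝟙)
    constant-T-𝟙 = constant-≡ (constant-* #units constant-i₁) λ {_} {y} ax →
      ≡.trans (count-T 𝟙 {y = y} ax) (≡.cong (#units ℕ.*_) (CV.#-cong _ _ (λ _ → proj₁) (λ _ P → P , refl)))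

    constant-O-𝟙 : Constant Aniso₁ (count O 𝟙)
    constant-O-𝟙 = constant-∸ constant-i₁ constant-w₁ λ {x} ax → ≡.sym (≡.trans
      (CV.#-split (λ u → B u x ≟ 0#) Iso?)
      (≡.cong (i₁ x ℕ.+_) (CV.#-cong _ _ (λ _ (Bux , au) → au , Bux , refl) (λ _ (au , Bux , _) → Bux , au))))

    count-O-O : ∀ {x y} → i₂ x y ℕ.+ count O O x y ≡ w₂ x y
    count-O-O {x} {y} = ≡.sym (≡.trans
      (CV.#-split (λ u → (B u x ≟ 0#) ×-dec (B u y ≟ 0#)) Iso?)
      (≡.cong₂ ℕ._+_ (CV.#-cong _ _ (λ _ ((Bux , Buy) , iu) → (Bux , iu) , Buy) (λ _ ((Bux , iu) , Buy) → (Bux , Buy) , iu))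
        (CV.#-cong _ _ (λ _ (B , au) → au , B) (λ _ (au , B) → B , au))))

    module _ {K : Rel V ℓ} (K⇒aniso : ∀ {x y} → K x y → ¬ Iso x × ¬ Iso y) where

      -- The z in question are the nonzero multiples of x, and they inherit from x its relation to
      -- y.
      constant-E-always : ∀ Q → (∀ {x y} → K x y → holds Q y x) → Constant K (count E Q)
      constant-E-always Q K⇒Q = #units , λ {x} {y} kxy →
        let ax = proj₁ (K⇒aniso kxy)
            d , dBxx≈1 = inverse (B x x) ax
            Lz≈s : ∀ {z s} → z ≋ s ⊙ x → B z x * d ≈ s
            Lz≈s = λ {z} {s} z≋sx → trans (*-congʳ (trans (B-congˡ x z≋sx) (B-⊙ˡ s x x)))
              (trans (*-assoc s (B x x) d) (trans (*-congˡ (trans (*-comm _ d) dBxx≈1)) (*-identityʳ s)))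
        in VF.#-subset-bijection _ _
          (λ z≋z′ (az , ez , qz) → az ∘ Iso-resp (sym ∘ z≋z′) , resp E x z≋z′ ez , resp Q y z≋z′ qz)
          (λ s≈t s≉0 → s≉0 ∘ trans s≈t)
          (λ z → B z x * d) (_⊙ x) (λ z≋z′ → *-congʳ (B-congˡ x z≋z′)) (λ s≈t i → *-congʳ s≈t)
          (λ (az , ez , _) → let (s , s≉0 , z≋sx) = proportional ax az ez in s≉0 ∘ trans (sym (Lz≈s z≋sx)))
          (λ {s} s≉0 → (λ isx → *≉0 (norm-≉0 s≉0) ax (trans (sym (B-⊙-⊙ s x)) isx))
                     , multiple⇒E s (λ _ → refl) , hom Q y s≉0 (K⇒Q kxy))
          (λ (az , ez , _) i → let (s , s≉0 , z≋sx) = proportional ax az ez in trans (*-congʳ (Lz≈s z≋sx)) (sym (z≋sx i)))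
          (λ _ → Lz≈s (λ _ → refl))

      constant-E-never : ∀ Q → (∀ {x y} → K x y → ¬ holds Q y x) → Constant K (count E Q)
      constant-E-never Q K⇒¬Q = 0 , λ {x} {y} kxy → CV.#-none _ λ z (az , ez , qz) →
        let ax = proj₁ (K⇒aniso kxy) in K⇒¬Q kxy (E-invariantʳ Q y az ax (sym-rel E ax az ez) qz)

      module _ (K⇒¬E : ∀ {x y} → K x y → ¬ holds E x y) where
        constant-w₂ : Constant K w₂
        constant-w₂ = constant-/ (q ℕ.^ 2) (constant-⊆ (proj₁ ∘ K⇒aniso) constant-w₁) λ kxy →
          let (ax , ay) = K⇒aniso kxy in Pair.w₁≡ ax ay (K⇒¬E kxy)

        module _ (K⇒T : ∀ {x y} → K x y → holds T x y) where
          -- For tangent pairs the translation argument yields `a₂`, and slicing then yields `i₂`.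
          -- For secant pairs the order is reversed, as the fibration yields `i₂`.
          constant-a₂-tangent : Constant K a₂
          constant-a₂-tangent = constant-/ (q ℕ.^ 2) (constant-* q constant-w₂) λ kxy →
            let (ax , ay) = K⇒aniso kxy in Pair.tangent ax ay (K⇒¬E kxy) (K⇒T kxy)

          constant-i₂-tangent : Constant K i₂
          constant-i₂-tangent = constant-∸ (constant-* #units constant-a₂-tangent)
            (constant-⊆ (proj₁ ∘ K⇒aniso) constant-i₁) λ {x} {y} _ → ≡.trans (ℕ.+-comm _ (i₂ x y)) (i₁≡ x y)

        module _ (K⇒¬T : ∀ {x y} → K x y → ¬ holds T x y) where
          constant-i₂-secant : Constant K i₂
          constant-i₂-secant = constant-/ q
            (constant-∸ (constant-⊆ (proj₁ ∘ K⇒aniso) constant-i₁) (constant-* (suc q) constant-w₂) λ kxy →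
              let (ax , ay) = K⇒aniso kxy in Pair.secant ax ay (K⇒¬E kxy) (K⇒¬T kxy)) λ _ → ≡.refl

          constant-a₂-secant : Constant K a₂
          constant-a₂-secant = constant-/ #units
            (constant-∸ constant-i₂-secant (constant-⊆ (proj₁ ∘ K⇒aniso) constant-i₁) λ {x} {y} _ → i₁≡ x y) λ _ → ≡.refl

    relation : Fin 4 → Relation
    relation 0F                   = E
    relation 1F             = T ∖ E
    relation 2F       = O
    relation 3F = 𝟙 ∖ T ∖ O

    -- The counts are made for these relations, which are single equations; those of the scheme
    -- arise from them by removing one from a larger one.
    base : Fin 4 → Relation
    base 0F                   = E
    base 1F             = T
    base 2F       = O
    base 3F = 𝟙

    Related : Fin 4 → Rel V ℓ
    Related k x y = ¬ Iso x × ¬ Iso y × holds (relation k) x y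

    Related-sym : ∀ k → Symmetric (Related k)
    Related-sym k (ax , ay , rxy) = ay , ax , sym-rel (relation k) ax ay rxy

    module _ {K : Rel V ℓ} (K-sym : Symmetric K) (K⇒aniso : ∀ {x y} → K x y → ¬ Iso x × ¬ Iso y) where
      private
        cut : ∀ P P′ Q → (∀ {x z} → ¬ Iso x → ¬ Iso z → holds P′ x z → holds P x z) →
          Constant K (count P Q) → Constant K (count P′ Q) → Constant K (count (P ∖ P′) Q)
        cut = constant-∖ (proj₁ ∘ K⇒aniso)

        refine : ∀ Q → (∀ b → Constant K (count (base b) Q)) → ∀ i → Constant K (count (relation i) Q)
        refine Q const 0F                   = const 0F
        refine Q const 1F             = cut T E Q (λ _ _ → E⇒T) (const 1F) (const 0F)
        refine Q const 2F       = const 2F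
        refine Q const 3F = cut (𝟙 ∖ T) O Q (λ ax az oxz → refl , O⇒¬T ax az oxz)
          (cut 𝟙 T Q (λ _ _ _ → refl) (const 3F) (const 1F)) (const 2F)

      -- `refine` treats the first argument of `count`; symmetry of K makes it available for the
      -- second.
      constant-relation : (∀ b b′ → Constant K (count (base b) (base b′))) →
        ∀ i j → Constant K (count (relation i) (relation j))
      constant-relation const i j = refine (relation j) (λ b → constant-swap K-sym (relation j) (base b)
        (refine (base b) (λ b′ → const b′ b) j)) i

      -- Counts against `𝟙` depend on one of the two vectors at most and are constant in any case,
      -- so what remains is `E` and the three combinations of `T` and `O`.
      constant-base : (∀ b → Constant K (count E (base b))) →
        Constant K (count T T) → Constant K (count T O) → Constant K (count O O) →
        ∀ b b′ → Constant K (count (base b) (base b′))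
      constant-base cE cTT cTO cOO = λ where
          0F                   b′                     → cE b′
          b                      0F                   → constant-swap K-sym E (base b) (cE b)
          1F             1F             → cTT
          1F             2F       → cTO
          1F             3F → cT
          2F       1F             → constant-swap K-sym T O cTO
          2F       2F       → cOO
          2F       3F → cO
          3F 1F             → constant-swap K-sym T 𝟙 cT
          3F 2F       → constant-swap K-sym O 𝟙 cO
          3F 3F → CV.# (λ z → ¬? (Iso? z) ×-dec (dec 𝟙 z z ×-dec dec 𝟙 z z)) ,
            λ _ → CV.#-cong _ _ (λ _ → id) (λ _ → id)
        where
        cT : Constant K (count T 𝟙)
        cT = constant-⊆ (proj₁ ∘ K⇒aniso) constant-T-𝟙
        cO : Constant K (count O 𝟙)
        cO = constant-⊆ (proj₁ ∘ K⇒aniso) constant-O-𝟙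

    private
      Related-aniso : ∀ k {x y} → Related k x y → ¬ Iso x × ¬ Iso y
      Related-aniso k (ax , ay , _) = ax , ay

    constant-count : ∀ k i j → Constant (Related k) (count (relation i) (relation j))
    constant-count 0F = constant-relation (Related-sym 0F) K⇒aniso
      (constant-base (Related-sym 0F) K⇒aniso
        (λ { 0F → constant-E-always K⇒aniso E K⇒E
           ; 1F → constant-E-always K⇒aniso T (λ k → E⇒T (K⇒E k))
           ; 2F → constant-E-never K⇒aniso O (λ (ax , ay , e) oyx → O⇒¬T ay ax oyx (E⇒T (sym-rel E ax ay e)))
           ; 3F → constant-E-always K⇒aniso 𝟙 (λ _ → refl) })
        (constant-≡ (constant-⊆ proj₁ constant-T-𝟙) (merge T))
        (0 , λ (ax , ay , e) → CV.#-none _ λ z (az , tz , oz) → O⇒¬T ay az oz (E-invariantˡ T ax ay az e tz))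
        (constant-≡ (constant-⊆ proj₁ constant-O-𝟙) (merge O)))
      where
      K⇒aniso = Related-aniso 0F
      K⇒E : ∀ {x y} → Related 0F x y → holds E y x
      K⇒E (ax , ay , e) = sym-rel E ax ay e
      merge : ∀ P {x y} → Related 0F x y → count P P x y ≡ count P 𝟙 x y
      merge P (ax , ay , e) = CV.#-cong _ _ (λ z (az , pz , _) → az , pz , refl)
        (λ z (az , pz , _) → az , pz , E-invariantˡ P ax ay az e pz)
    constant-count 1F = constant-relation (Related-sym 1F) K⇒aniso
      (constant-base (Related-sym 1F) K⇒aniso
        (λ { 0F → constant-E-never K⇒aniso E λ (ax , ay , _ , ¬e) e → ¬e (sym-rel E ay ax e)
           ; 1F → constant-E-always K⇒aniso T λ (ax , ay , t , _) → sym-rel T ax ay t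
           ; 2F → constant-E-never K⇒aniso O λ (ax , ay , t , _) o → O⇒¬T ay ax o (sym-rel T ax ay t)
           ; 3F → constant-E-always K⇒aniso 𝟙 λ _ → refl })
        (constant-≡ (constant-* #units (constant-+ i₂-const (constant-* q a₂-const)))
          λ (ax , ay , t , _) → TangentValues.count-T-T-tangent ax ay t)
        (constant-≡ (constant-* #units a₂-const) λ (ax , ay , t , _) → count-T-O-¬⊥ ax λ o → O⇒¬T ax ay o t)
        (constant-∸ i₂-const (constant-w₂ K⇒aniso K⇒¬E) λ _ → count-O-O))
      where
      K⇒aniso = Related-aniso 1F
      K⇒¬E : ∀ {x y} → Related 1F x y → ¬ holds E x y
      K⇒¬E (_ , _ , _ , ¬e) = ¬e
      K⇒T : ∀ {x y} → Related 1F x y → holds T x y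
      K⇒T (_ , _ , t , _) = t
      a₂-const = constant-a₂-tangent K⇒aniso K⇒¬E K⇒T
      i₂-const = constant-i₂-tangent K⇒aniso K⇒¬E K⇒T
    constant-count 2F = constant-relation (Related-sym 2F) K⇒aniso
      (constant-base (Related-sym 2F) K⇒aniso
        (λ { 0F → constant-E-never K⇒aniso E λ (ax , ay , o) e → O⇒¬T ax ay o (E⇒T (sym-rel E ay ax e))
           ; 1F → constant-E-never K⇒aniso T λ (ax , ay , o) t → O⇒¬T ax ay o (sym-rel T ay ax t)
           ; 2F → constant-E-always K⇒aniso O λ (ax , ay , o) → sym-rel O ax ay o
           ; 3F → constant-E-always K⇒aniso 𝟙 λ _ → refl })
        (constant-≡ (constant-* #units (constant-* (suc q) (constant-a₂-secant K⇒aniso K⇒¬E K⇒¬T)))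
          λ k@(ax , ay , _) → TangentValues.count-T-T-secant ax ay (K⇒¬T k))
        (constant-≡ (constant-* #units i₂-const) λ (ax , _ , o) → count-T-O-⊥ ax o)
        (constant-∸ i₂-const (constant-w₂ K⇒aniso K⇒¬E) λ _ → count-O-O))
      where
      K⇒aniso = Related-aniso 2F
      K⇒¬T : ∀ {x y} → Related 2F x y → ¬ holds T x y
      K⇒¬T (ax , ay , o) = O⇒¬T ax ay o
      K⇒¬E : ∀ {x y} → Related 2F x y → ¬ holds E x y
      K⇒¬E k e = K⇒¬T k (E⇒T e)
      i₂-const = constant-i₂-secant K⇒aniso K⇒¬E K⇒¬T
    constant-count 3F = constant-relation (Related-sym 3F) K⇒aniso
      (constant-base (Related-sym 3F) K⇒aniso
        (λ { 0F → constant-E-never K⇒aniso E λ k@(ax , ay , _) e → K⇒¬T k (E⇒T (sym-rel E ay ax e))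
           ; 1F → constant-E-never K⇒aniso T λ k@(ax , ay , _) t → K⇒¬T k (sym-rel T ay ax t)
           ; 2F → constant-E-never K⇒aniso O λ (ax , ay , _ , ¬o) o → ¬o (sym-rel O ay ax o)
           ; 3F → constant-E-always K⇒aniso 𝟙 λ _ → refl })
        (constant-≡ (constant-* #units (constant-* (suc q) a₂-const))
          λ k@(ax , ay , _) → TangentValues.count-T-T-secant ax ay (K⇒¬T k))
        (constant-≡ (constant-* #units a₂-const) λ (ax , _ , _ , ¬o) → count-T-O-¬⊥ ax ¬o)
        (constant-∸ (constant-i₂-secant K⇒aniso K⇒¬E K⇒¬T) (constant-w₂ K⇒aniso K⇒¬E) λ _ → count-O-O))
      where
      K⇒aniso = Related-aniso 3F
      K⇒¬T : ∀ {x y} → Related 3F x y → ¬ holds T x y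
      K⇒¬T (_ , _ , (_ , ¬t) , _) = ¬t
      K⇒¬E : ∀ {x y} → Related 3F x y → ¬ holds E x y
      K⇒¬E k e = K⇒¬T k (E⇒T e)
      a₂-const = constant-a₂-secant K⇒aniso K⇒¬E K⇒¬T

-- From vectors to projective points and lines.

module Points where

  open Counting
  open RingSolver
  open FiniteField
  open Conjugation
  open HermitianForm
  open Constancy
  open import Defs
  open import Algebra.Apartness.Bundles using (HeytingField; HeytingCommutativeRing)
  open import Algebra.Bundles using (CommutativeRing)
  open import Data.Fin.Base as Fin using (Fin; zero; suc; inject₁)
  open import Data.Fin.Patterns using (0F; 1F; 2F; 3F)
  import Data.Fin.Properties as Fin
  open import Data.Nat.Base as ℕ using (ℕ; zero; suc; s≤s; z≤n; _≤_; _<_)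
  import Data.Nat.Properties as ℕ
  open import Data.Product.Base using (Σ; ∃; ∃₂; _×_; _,_; proj₁; proj₂)
  open import Data.Vec.Functional using (Vector; []; _∷_)
  open import Function.Base using (_∘_; id)
  open import Function.Bundles using (Inverse; mk⇔)
  import Function.Construct.Composition as Compose
  open import Level using (Level; _⊔_)
  open import Relation.Binary.Bundles using (Setoid)
  open import Relation.Binary.Core using (Rel)
  open import Relation.Binary.Definitions using (_Respects_)
  open import Relation.Binary.PropositionalEquality.Core as ≡ using (_≡_; _≢_)
  open import Relation.Nullary using (¬_; yes; no; ¬?; _×-dec_; contradiction)
  open import Relation.Unary using (Pred; Decidable; _∈_; _∩_)

  private
    variable
      a c ℓ ℓ₁ ℓ₂ p r : Level

  -- Intersection numbers count subsets of `𝒫`, itself a subset of `PG`; flattening lets them be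
  -- counted among all points.
  Subset-Subset : {S : Setoid a ℓ} {P : Pred (Setoid.Carrier S) p} {Q : Pred (Setoid.Carrier (Subset S P)) r} →
    Inverse (Subset (Subset S P) Q) (Subset S (λ x → Σ (P x) (λ px → Q (x , px))))
  Subset-Subset {S = S} = mk-inverse (λ ((x , px) , qx) → x , px , qx) (λ (x , px , qx) → (x , px) , qx)
    id id (λ _ → Setoid.refl S) (λ _ → Setoid.refl S)

  module _ (F : HeytingField c ℓ₁ ℓ₂) where
    open HeytingField F using (_#_; tight; #⇒invertible; invertible⇒#; #-irrefl)

    private
      R : CommutativeRing c ℓ₁
      R = HeytingCommutativeRing.commutativeRing (HeytingField.heytingCommutativeRing F)

    open CommutativeRing R hiding (zero)
    open import Algebra.Properties.Ring ring using (-0#≈0#)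

    x-0≈x : ∀ x → x - 0# ≈ x
    x-0≈x x = trans (+-congˡ -0#≈0#) (+-identityʳ x)

    #0⇒inverse : ∀ {x} → x # 0# → ∃ λ y → y * x ≈ 1#
    #0⇒inverse x#0 with #⇒invertible x#0
    ... | y , y*x≈1 , _ = y , trans (*-congˡ (sym (x-0≈x _))) y*x≈1

    inverse⇒#0 : ∀ {x y} → y * x ≈ 1# → x # 0#
    inverse⇒#0 {x} {y} yx≈1 = invertible⇒# (y , trans (*-congˡ (x-0≈x x)) yx≈1 , trans (*-congʳ (x-0≈x x))
        (trans (*-comm x y) yx≈1))

    #0⇒≉0 : ∀ {x} → x # 0# → ¬ x ≈ 0#
    #0⇒≉0 x#0 x≈0 = #-irrefl x≈0 x#0

    -- Finiteness allows an exhaustive search for an inverse. If it fails, `x # 0#` is refuted and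
    -- tightness gives `x ≈ 0#`. If 1 were 0 there would be only one element.
    isFiniteField : ∀ {size} → HasCardinality setoid size → 2 ≤ size → IsFiniteField R size
    isFiniteField {size} card 2≤size = record { enumeration = card ; inverse = inverse ; 1≉0 = 1≉0 }
      where
      finite : FiniteSetoid c ℓ₁
      finite = record { setoid = setoid ; size = size ; enumeration = card }
      open FiniteSetoid finite using (_≟_; index-cong; index∘element; element)
      inverse : ∀ x → ¬ x ≈ 0# → ∃ λ y → y * x ≈ 1#
      inverse x x≉0 with Count.search finite (λ y → y * x ≟ 1#) (λ y≈z yx≈1 → trans (*-congʳ (sym y≈z)) yx≈1)
      ... | yes y = y
      ... | no ∄y = contradiction (proj₁ (tight x 0#) (∄y ∘ #0⇒inverse)) x≉0
      1≉0 : ¬ 1# ≈ 0#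
      1≉0 1≈0 = absurd (≡.trans (≡.sym (index∘element i)) (≡.trans (index-cong (trans (all≈0 (element i))
          (sym (all≈0 (element j))))) (index∘element j)))
        where
        all≈0 : ∀ x → x ≈ 0#
        all≈0 x = trans (sym (*-identityˡ x)) (trans (*-congʳ 1≈0) (zeroˡ x))
        i j : Fin size
        i = Fin.fromℕ< (ℕ.<-trans (s≤s z≤n) 2≤size)
        j = Fin.fromℕ< 2≤size
        absurd : i ≢ j
        absurd i≡j with () ← ≡.trans (≡.sym (Fin.toℕ-fromℕ< (ℕ.<-trans (s≤s z≤n) 2≤size))) (≡.trans (≡.cong Fin.toℕ i≡j)
            (Fin.toℕ-fromℕ< 2≤size))

  module Projective (F : HeytingField c ℓ₁ ℓ₂) (q n : ℕ) (pp : IsPrimePower q)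
                    (card : HasCardinality (HeytingField.setoid F) (q ℕ.^ 2)) where
    open HeytingField F using (_#_)

    R : CommutativeRing c ℓ₁
    R = HeytingCommutativeRing.commutativeRing (HeytingField.heytingCommutativeRing F)

    2≤q² : 2 ≤ q ℕ.^ 2
    2≤q² = ℕ.≤-trans (prime-power≥2 pp) (ℕ.m≤m*n q (q ℕ.* 1) {{ℕ.>-nonZero (ℕ.≤-trans (s≤s z≤n)
        (ℕ.≤-trans (prime-power≥2 pp) (ℕ.≤-reflexive (≡.sym (ℕ.*-identityʳ q)))))}})

    opaque
      finiteField : IsFiniteField R (q ℕ.^ 2)
      finiteField = isFiniteField F card 2≤q²

    open CommutativeRing R hiding (zero)
    open HermitianScheme R pp finiteField n
    open Relation
    open Solver R
    open import Relation.Binary.Reasoning.Setoid setoid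

    module H = Hermitian F q n
    open H using (Point; coord; nonzero; _∼_; PG; ℋ; 𝒫; ⟪_⟫; ⟨_,_⟩; pointsOf; LineMeetsℋIn; R₀; R₁; R₂⊥; R₂⊥̸)

    H-B≈B : ∀ x y → H.B x y ≈ B x y
    H-B≈B x y = reflexive (≡.sym (B-definition x y))

    Nonzero : Pred V ℓ₁
    Nonzero x = ∃ λ i → ¬ x i ≈ 0#

    ¬Iso⇒Nonzero : ∀ {x} → ¬ Iso x → Nonzero x
    ¬Iso⇒Nonzero {x} ax = Fin.¬∀⟶∃¬ (suc n) _ (λ i → x i ≟ 0#) λ x≈0 → ax (begin
      B x x           ≈⟨ B-congˡ x (λ i → trans (x≈0 i) (sym (zeroˡ (x i)))) ⟩
      B (0# ⊙ x) x    ≈⟨ B-⊙ˡ 0# x x ⟩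
      0# * B x x      ≈⟨ zeroˡ _ ⟩
      0#              ∎)

    point : ∀ x → Nonzero x → Point
    point x (i , xi≉0) = record { coord = x ; nonzero = i , inverse⇒#0 F (proj₂ (inverse (x i) xi≉0)) }

    nonzero′ : ∀ X → Nonzero (coord X)
    nonzero′ X = proj₁ (nonzero X) , #0⇒≉0 F (proj₂ (nonzero X))

    scalar#0 : ∀ {s} → ¬ s ≈ 0# → s # 0#
    scalar#0 s≉0 = inverse⇒#0 F (proj₂ (inverse _ s≉0))

    opaque
      -- The first nonzero coordinate. The default 0 at the zero vector keeps it homogeneous of
      -- degree one everywhere.
      lead : ∀ {m} → Vector Carrier m → Carrier
      lead {zero}  x = 0#
      lead {suc m} x with x zero ≟ 0#
      ... | yes _ = lead (x ∘ suc)
      ... | no  _ = x zero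

      lead-cong : ∀ {m} {x y : Vector Carrier m} → (∀ i → x i ≈ y i) → lead x ≈ lead y
      lead-cong {zero}  x≋y = refl
      lead-cong {suc m} {x} {y} x≋y with x zero ≟ 0# | y zero ≟ 0#
      ... | yes _    | yes _    = lead-cong (x≋y ∘ suc)
      ... | yes x₀≈0 | no y₀≉0  = contradiction (trans (sym (x≋y zero)) x₀≈0) y₀≉0
      ... | no x₀≉0  | yes y₀≈0 = contradiction (trans (x≋y zero) y₀≈0) x₀≉0
      ... | no _     | no _     = x≋y zero

      lead-⊙ : ∀ {m s} (x : Vector Carrier m) → ¬ s ≈ 0# → lead (λ i → s * x i) ≈ s * lead x
      lead-⊙ {zero}      x s≉0 = sym (zeroʳ _)
      lead-⊙ {suc m} {s} x s≉0 with x zero ≟ 0# | s * x zero ≟ 0#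
      ... | yes _    | yes _     = lead-⊙ (x ∘ suc) s≉0
      ... | yes x₀≈0 | no sx₀≉0  = contradiction (trans (*-congˡ x₀≈0) (zeroʳ s)) sx₀≉0
      ... | no x₀≉0  | yes sx₀≈0 = contradiction sx₀≈0 (*≉0 s≉0 x₀≉0)
      ... | no _     | no _      = refl

      lead≈0⇒≈0 : ∀ {m} (x : Vector Carrier m) → lead x ≈ 0# → ∀ i → x i ≈ 0#
      lead≈0⇒≈0 {suc m} x lead≈0 i with x zero ≟ 0#
      ... | no x₀≉0 = contradiction lead≈0 x₀≉0
      lead≈0⇒≈0 {suc m} x lead≈0 zero    | yes x₀≈0 = x₀≈0
      lead≈0⇒≈0 {suc m} x lead≈0 (suc i) | yes x₀≈0 = lead≈0⇒≈0 (x ∘ suc) lead≈0 i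

      ≈0⇒lead≈0 : ∀ {m} (x : Vector Carrier m) → (∀ i → x i ≈ 0#) → lead x ≈ 0#
      ≈0⇒lead≈0 {zero}  x x≈0 = refl
      ≈0⇒lead≈0 {suc m} x x≈0 with x zero ≟ 0#
      ... | yes _   = ≈0⇒lead≈0 (x ∘ suc) (x≈0 ∘ suc)
      ... | no x₀≉0 = contradiction (x≈0 zero) x₀≉0

    lead≉0 : ∀ {x} → Nonzero x → ¬ lead x ≈ 0#
    lead≉0 {x} (i , xi≉0) lead≈0 = xi≉0 (lead≈0⇒≈0 x lead≈0 i)

    module _ {P : Pred V p} (P? : Decidable P) (P-resp : P Respects _≋_) (P-hom : Homogeneous P)
             (P⇒Nonzero : ∀ {x} → P x → Nonzero x) where

      #points : ℕ
      #points = CV.# (λ x → P? x ×-dec (lead x ≟ 1#))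

      -- Slicing by the leading coordinate: its values on P are nonzero, and each slice has one
      -- vector for every point.
      #vectors : #units ℕ.* #points ≡ CV.# P?
      #vectors = ≡.sym (≡.trans (CV.#-cong P? _ (λ x px → px , lead≉0 (P⇒Nonzero px)) (λ _ → proj₁))
        (Slice.#slices P? P-resp P-hom lead lead-cong (λ {s} {x} s≉0 → lead-⊙ x s≉0)
          (λ s → ¬? (s ≟ 0#)) (λ s≈t s≉0 → s≉0 ∘ trans s≈t) id))

      -- Every point has exactly one coordinate vector with leading coordinate 1.
      points-card : {A : Pred Point a} → (∀ {X} → A X → P (coord X)) → (∀ {X} → P (coord X) → A X) →
        HasCardinality (Subset PG A) #points
      points-card {A = A} A⇒P P⇒A = Compose.inverse
        (mk-inverse {S = Subset PG A} {T = Subset V.setoid (λ x → P x × lead x ≈ 1#)}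
          (λ (X , aX) → normalise X , normal X (A⇒P aX))
          (λ (x , px , _) → point x (P⇒Nonzero px) , P⇒A px)
          (λ { {X , _} {Y , _} → normalise-cong X Y })
          (λ x≋y → 1# , scalar#0 1≉0 , λ i → trans (x≋y i) (sym (*-identityˡ _)))
          (λ (x , px , lx≈1) i → trans (*-congʳ (trans (sym (*-identityʳ _)) (trans (*-congˡ (sym lx≈1))
              (unit (point x (P⇒Nonzero px)))))) (*-identityˡ (x i)))
          (λ (X , _) → proj₁ (lead⁻¹ X) , scalar#0 (lead⁻¹≉0 X) , λ _ → refl))
        (CV.subset-card (λ x → P? x ×-dec (lead x ≟ 1#)) (λ x≋y (px , lx) → P-resp x≋y px , trans (lead-cong (sym ∘ x≋y)) lx))
        where
        lead⁻¹ : ∀ X → ∃ λ t → t * lead (coord X) ≈ 1#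
        lead⁻¹ X = inverse (lead (coord X)) (lead≉0 (nonzero′ X))
        unit : ∀ X → proj₁ (lead⁻¹ X) * lead (coord X) ≈ 1#
        unit X = proj₂ (lead⁻¹ X)
        lead⁻¹≉0 : ∀ X → ¬ proj₁ (lead⁻¹ X) ≈ 0#
        lead⁻¹≉0 X t≈0 = 1≉0 (trans (sym (unit X)) (trans (*-congʳ t≈0) (zeroˡ _)))
        normalise : Point → V
        normalise X = proj₁ (lead⁻¹ X) ⊙ coord X
        leading-1 : ∀ X → lead (normalise X) ≈ 1#
        leading-1 X = trans (lead-⊙ (coord X) (lead⁻¹≉0 X)) (unit X)
        normal : ∀ X → P (coord X) → P (normalise X) × lead (normalise X) ≈ 1#
        normal X pX = P-hom (lead⁻¹≉0 X) pX , leading-1 X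
        unique : ∀ {x y t} → lead x ≈ 1# → lead y ≈ 1# → x ≋ t ⊙ y → x ≋ y
        unique {x} {y} {t} lx≈1 ly≈1 x≋ty i = trans (x≋ty i) (trans (*-congʳ t≈1) (*-identityˡ (y i)))
          where
          t≉0 : ¬ t ≈ 0#
          t≉0 t≈0 = 1≉0 (trans (sym lx≈1) (≈0⇒lead≈0 x λ i → trans (x≋ty i) (trans (*-congʳ t≈0) (zeroˡ _))))
          t≈1 : t ≈ 1#
          t≈1 = trans (sym (*-identityʳ t)) (trans (*-congˡ (sym ly≈1)) (trans (sym (lead-⊙ y t≉0))
              (trans (sym (lead-cong x≋ty)) lx≈1)))
        normalise-cong : ∀ X Y → X ∼ Y → normalise X ≋ normalise Y
        normalise-cong X Y (s , _ , X≈sY) = unique {t = t * (s * l)} (leading-1 X) (leading-1 Y) λ i → begin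
          t * coord X i                        ≈⟨ *-congˡ (X≈sY i) ⟩
          t * (s * coord Y i)                  ≈⟨ *-identityʳ _ ⟨
          t * (s * coord Y i) * 1#             ≈⟨ *-congˡ (unit Y) ⟨
          t * (s * coord Y i) * (b * l)        ≈⟨ solve 5 (λ a s y b l → a :* (s :* y) :* (b :* l) := a :* (s :* l) :* (b :* y)) refl t s (coord Y i) b l ⟩
          t * (s * l) * (b * coord Y i)        ∎
          where
          t = proj₁ (lead⁻¹ X)
          b = proj₁ (lead⁻¹ Y)
          l = lead (coord Y)

    module Line (X Y : Point) (ax : ¬ Iso (coord X)) (ay : ¬ Iso (coord Y)) (¬exy : ¬ holds E (coord X) (coord Y)) where
      open Pair ax ay ¬exy

      private
        x y : V
        x = coord X
        y = coord Y

        w : Carrier → V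
        w μ = y′ ⊕ μ ⊙ x

        w-nonzero : ∀ μ → Nonzero (w μ)
        w-nonzero μ = Fin.¬∀⟶∃¬ (suc n) _ (λ i → w μ i ≟ 0#) λ w≈0 → ¬exy (multiple⇒E (B y x * d - μ) λ i → begin
          y i                              ≈⟨ solve 4 (λ y b m x → y := y :+ (:- b) :* x :+ m :* x :+ (b :- m) :* x) refl (y i) (B y x * d) μ (x i) ⟩
          w μ i + (B y x * d - μ) * x i    ≈⟨ trans (+-congʳ (w≈0 i)) (+-identityˡ _) ⟩
          (B y x * d - μ) * x i            ∎)

        -- Pairing with x gives a μ = b ν because y′ is orthogonal to x; a coordinate at which y′ is
        -- nonzero then gives a = b.
        w-unique : ∀ {a b μ ν} → ¬ a ≈ 0# → (∀ i → a * w μ i ≈ b * w ν i) → μ ≈ ν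
        w-unique {a} {b} {μ} {ν} a≉0 aw≈bw = *-cancelˡ-≉0 a≉0 (trans aμ≈bν (*-congʳ (sym a≈b)))
          where
          B-w : ∀ a μ → B (a ⊙ w μ) x ≈ B x x * (a * μ)
          B-w a μ = begin
            B (a ⊙ w μ) x                ≈⟨ B-⊙ˡ a (w μ) x ⟩
            a * B (w μ) x                ≈⟨ *-congˡ (trans (B-⊕ˡ y′ μ x x) (trans (+-congʳ B-y′-x) (+-identityˡ _))) ⟩
            a * (μ * B x x)              ≈⟨ solve 3 (λ a m b → a :* (m :* b) := b :* (a :* m)) refl a μ (B x x) ⟩
            B x x * (a * μ)              ∎
          aμ≈bν : a * μ ≈ b * ν
          aμ≈bν = *-cancelˡ-≉0 ax (trans (sym (B-w a μ)) (trans (B-congˡ x aw≈bw) (B-w b ν)))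
          i = proj₁ y′≉0
          a≈b : a ≈ b
          a≈b = *-cancelˡ-≉0 (proj₂ y′≉0) (begin
            y′ i * a                               ≈⟨ solve 4 (λ y a m x → y :* a := a :* (y :+ m :* x) :- a :* m :* x) refl (y′ i) a μ (x i) ⟩
            a * w μ i - a * μ * x i                ≈⟨ +-cong (aw≈bw i) (-‿cong (*-congʳ aμ≈bν)) ⟩
            b * w ν i - b * ν * x i                ≈⟨ solve 4 (λ y a m x → y :* a := a :* (y :+ m :* x) :- a :* m :* x) refl (y′ i) b ν (x i) ⟨
            y′ i * b                               ∎)

        -- The coefficient t of y is nonzero: otherwise Z would be a nonzero multiple of the
        -- anisotropic x.
        parameter : ∀ Z → coord Z ∈ ⟨ X , Y ⟩ → Iso (coord Z) → ∃₂ λ t μ → ¬ t ≈ 0# × coord Z ≋ t ⊙ w μ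
        parameter Z (s , t , Z≈) iz = t , t⁻¹ * s + B y x * d , t≉0 , λ i → begin
            coord Z i                                         ≈⟨ Z≈ i ⟩
            s * x i + t * y i                                 ≈⟨ +-congʳ (*-congʳ (trans (sym (*-identityˡ s)) (*-congʳ (sym t⁻¹t≈1)))) ⟩
            t⁻¹ * t * s * x i + t * y i                       ≈⟨ solve 6 (λ t′ t s x y b → t′ :* t :* s :* x :+ t :* y := t :* (y :+ (:- b) :* x :+ (t′ :* s :+ b) :* x)) refl t⁻¹ t s (x i) (y i) (B y x * d) ⟩
            t * w (t⁻¹ * s + B y x * d) i                     ∎
          where
          t≉0 : ¬ t ≈ 0#
          t≉0 t≈0 = proj₂ (nonzero′ Z) (trans (Z≈sx _) (trans (*-congʳ s≈0) (zeroˡ _)))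
            where
            Z≈sx : coord Z ≋ s ⊙ x
            Z≈sx i = trans (Z≈ i) (trans (+-congˡ (trans (*-congʳ t≈0) (zeroˡ _))) (+-identityʳ _))
            s≈0 : s ≈ 0#
            s≈0 = norm≈0⇒≈0 (*≈0⇒≈0 ax (trans (*-comm _ _) (trans (sym (B-⊙-⊙ s x)) (Iso-resp Z≈sx iz))))
          t⁻¹ = proj₁ (inverse t t≉0)
          t⁻¹t≈1 = proj₂ (inverse t t≉0)

        w∈line : ∀ μ → w μ ∈ ⟨ X , Y ⟩
        w∈line μ = μ - B y x * d , 1# , λ i → trans
          (solve 4 (λ y b m x → y :+ (:- b) :* x :+ m :* x := (m :- b) :* x :+ y) refl (y i) (B y x * d) μ (x i))
          (+-congˡ (sym (*-identityˡ _)))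

      line-card : HasCardinality (Subset PG (pointsOf ⟨ X , Y ⟩ ∩ ℋ)) (CF.# (λ μ → Iso? (y′ ⊕ μ ⊙ x)))
      line-card = Compose.inverse
        (mk-inverse {S = Subset PG (pointsOf ⟨ X , Y ⟩ ∩ ℋ)} {T = Subset setoid (Iso ∘ w)}
          (λ (Z , z∈ , hz) → let (t , μ , t≉0 , Z≈) = parameter Z z∈ (ℋ⇒Iso Z hz) in
            μ , *≈0⇒≈0 (norm-≉0 t≉0) (trans (sym (B-⊙-⊙ t (w μ))) (Iso-resp Z≈ (ℋ⇒Iso Z hz))))
          (λ (μ , iw) → point (w μ) (w-nonzero μ) , w∈line μ , trans (H-B≈B _ _) iw)
          (λ { {Z , z∈ , hz} {Z′ , z′∈ , hz′} (s , _ , Z≈sZ′) →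
            let (t , μ , t≉0 , Z≈) = parameter Z z∈ (ℋ⇒Iso Z hz)
                (t′ , μ′ , _ , Z′≈) = parameter Z′ z′∈ (ℋ⇒Iso Z′ hz′) in
            w-unique t≉0 (λ i → trans (sym (Z≈ i)) (trans (Z≈sZ′ i) (trans (*-congˡ (Z′≈ i)) (sym (*-assoc s t′ _))))) })
          (λ μ≈ν → 1# , scalar#0 1≉0 , λ i → trans (+-congˡ (*-congʳ μ≈ν)) (sym (*-identityˡ _)))
          (λ (μ , iw) → let (t , μ′ , t≉0 , w≈) = parameter (point (w μ) (w-nonzero μ)) (w∈line μ) (ℋ⇒Iso (point (w μ) (w-nonzero μ)) (trans (H-B≈B _ _) iw)) in
            w-unique t≉0 (λ i → trans (sym (w≈ i)) (sym (*-identityˡ _))))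
          (λ (Z , z∈ , hz) → let (t , μ , t≉0 , Z≈) = parameter Z z∈ (ℋ⇒Iso Z hz) in
            Setoid.sym PG {Z} {point (w μ) (w-nonzero μ)} (t , scalar#0 t≉0 , Z≈)))
        (CF.subset-card (λ μ → Iso? (w μ)) (λ μ≈ν → Iso-resp (λ i → +-congˡ (*-congʳ μ≈ν))))
        where
        ℋ⇒Iso : ∀ Z → ℋ Z → Iso (coord Z)
        ℋ⇒Iso Z hz = trans (sym (H-B≈B (coord Z) (coord Z))) hz

      tangent⇒meets-1 : holds T x y → LineMeetsℋIn 1 X Y
      tangent⇒meets-1 txy = ≡.subst (HasCardinality _) (#isotropic-tangent txy) line-card

      secant⇒meets-q+1 : ¬ holds T x y → LineMeetsℋIn (q ℕ.+ 1) X Y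
      secant⇒meets-q+1 ¬txy = ≡.subst (HasCardinality _) (≡.trans (#isotropic-secant ¬txy) (ℕ.+-comm 1 q)) line-card

      private
        1≢q+1 : 1 ≢ q ℕ.+ 1
        1≢q+1 1≡q+1 = ℕ.<⇒≢ (ℕ.<-trans (s≤s z≤n) 2≤q) (ℕ.suc-injective (≡.trans 1≡q+1 (ℕ.+-comm q 1)))

      -- Tangency is decidable, and a line that is not tangent would have q + 1 isotropic points
      -- instead.
      meets-1⇒tangent : LineMeetsℋIn 1 X Y → holds T x y
      meets-1⇒tangent meets with dec T x y
      ... | yes txy = txy
      ... | no ¬txy = contradiction (HasCardinality-unique meets (secant⇒meets-q+1 ¬txy)) 1≢q+1

      meets-q+1⇒secant : LineMeetsℋIn (q ℕ.+ 1) X Y → ¬ holds T x y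
      meets-q+1⇒secant meets txy = 1≢q+1 (HasCardinality-unique (tangent⇒meets-1 txy) meets)

    vec : Setoid.Carrier 𝒫 → V
    vec (X , _) = coord X

    aniso : ∀ X → ¬ Iso (vec X)
    aniso (X , ¬hX) iX = ¬hX (trans (H-B≈B (coord X) (coord X)) iX)

    anisotropicPoint : ∀ x → ¬ Iso x → Setoid.Carrier 𝒫
    anisotropicPoint x ax = point x (¬Iso⇒Nonzero ax) , λ hx → ax (trans (sym (H-B≈B x x)) hx)

    ∼⇒E : ∀ X Y → proj₁ X ∼ proj₁ Y → holds E (vec X) (vec Y)
    ∼⇒E X Y (s , _ , X≈sY) = sym-rel E (aniso Y) (aniso X) (multiple⇒E s X≈sY)

    E⇒∼ : ∀ X Y → holds E (vec X) (vec Y) → proj₁ X ∼ proj₁ Y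
    E⇒∼ X Y exy = let (s , s≉0 , X≈sY) = proportional (aniso Y) (aniso X) (sym-rel E (aniso X) (aniso Y) exy) in s , scalar#0 s≉0 , X≈sY

    ⊥⇒∈⟪⟫⊥ : ∀ X Y → holds O (vec X) (vec Y) → proj₁ X ∈ pointsOf (⟪ proj₁ Y ⟫ H.⊥)
    ⊥⇒∈⟪⟫⊥ X Y oxy v (s , v≈sY) = begin
      H.B (vec X) v                ≈⟨ H-B≈B _ _ ⟩
      B (vec X) v                  ≈⟨ B-cong (λ _ → refl) v≈sY ⟩
      B (vec X) (s ⊙ vec Y)        ≈⟨ B-⊙ʳ s (vec Y) (vec X) ⟩
      conj s * B (vec X) (vec Y)   ≈⟨ *-congˡ (B-sym-≈0 {vec Y} {vec X} oxy) ⟩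
      conj s * 0#                  ≈⟨ zeroʳ _ ⟩
      0#                           ∎

    R⇒relation : ∀ k {X Y} → (R₀ ∷ R₁ ∷ R₂⊥ ∷ R₂⊥̸ ∷ []) k X Y → holds (relation k) (vec X) (vec Y)
    R⇒relation 0F {X} {Y} x∼y = ∼⇒E X Y x∼y
    R⇒relation 1F {X} {Y} (x≁y , meets) = Line.meets-1⇒tangent (proj₁ X) (proj₁ Y) (aniso X) (aniso Y)
        (x≁y ∘ E⇒∼ X Y) meets , x≁y ∘ E⇒∼ X Y
    R⇒relation 2F {X} {Y} (_ , _ , x⊥y) = B-sym-≈0 {vec X} {vec Y} (trans (sym (H-B≈B _ _)) (x⊥y (vec Y) (1# , λ i → sym
        (*-identityˡ _))))
    R⇒relation 3F {X} {Y} (x≁y , meets , x⊥̸y) =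
      (refl , Line.meets-q+1⇒secant (proj₁ X) (proj₁ Y) (aniso X) (aniso Y) (x≁y ∘ E⇒∼ X Y) meets) ,
      λ oxy → x⊥̸y (⊥⇒∈⟪⟫⊥ X Y oxy)

    relation⇒R : ∀ k {X Y} → holds (relation k) (vec X) (vec Y) → (R₀ ∷ R₁ ∷ R₂⊥ ∷ R₂⊥̸ ∷ []) k X Y
    relation⇒R 0F {X} {Y} exy = E⇒∼ X Y exy
    relation⇒R 1F {X} {Y} (txy , ¬exy) = ¬exy ∘ ∼⇒E X Y , Line.tangent⇒meets-1 (proj₁ X) (proj₁ Y) (aniso X) (aniso Y) ¬exy txy
    -- Orthogonal anisotropic vectors are neither proportional nor tangent, so orthogonality alone
    -- implies that the line is secant.
    relation⇒R 2F {X} {Y} oxy = ¬exy ∘ ∼⇒E X Y , Line.secant⇒meets-q+1 (proj₁ X) (proj₁ Y) (aniso X)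
        (aniso Y) ¬exy ¬txy , ⊥⇒∈⟪⟫⊥ X Y oxy
      where
      ¬txy : ¬ holds T (vec X) (vec Y)
      ¬txy = O⇒¬T (aniso X) (aniso Y) oxy
      ¬exy : ¬ holds E (vec X) (vec Y)
      ¬exy = ¬txy ∘ E⇒T
    relation⇒R 3F {X} {Y} ((_ , ¬txy) , ¬oxy) = ¬txy ∘ E⇒T ∘ ∼⇒E X Y ,
      Line.secant⇒meets-q+1 (proj₁ X) (proj₁ Y) (aniso X) (aniso Y) (¬txy ∘ E⇒T) ¬txy ,
      λ x⊥y → ¬oxy (R⇒relation 2F {X} {Y} (¬txy ∘ E⇒T ∘ ∼⇒E X Y , Line.secant⇒meets-q+1 (proj₁ X) (proj₁ Y) (aniso X)
          (aniso Y) (¬txy ∘ E⇒T) ¬txy , x⊥y))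

    -- `E` is tested before `T`, which contains it.
    classify : V → V → Fin 4
    classify x y with dec E x y | dec T x y | dec O x y
    ... | yes _ | _     | _     = 0F
    ... | no _  | yes _ | _     = 1F
    ... | no _  | no _  | yes _ = 2F
    ... | no _  | no _  | no _  = 3F

    classify-holds : ∀ x y → holds (relation (classify x y)) x y
    classify-holds x y with dec E x y | dec T x y | dec O x y
    ... | yes e | _     | _     = e
    ... | no ¬e | yes t | _     = t , ¬e
    ... | no _  | no _  | yes o = o
    ... | no _  | no ¬t | no ¬o = (refl , ¬t) , ¬o

    classify-unique : ∀ k {x y} → Related k x y → classify x y ≡ k
    classify-unique k {x} {y} (ax , ay , r) with dec E x y | dec T x y | dec O x y
    classify-unique 0F (_ , _ , _)              | yes _ | _     | _     = ≡.refl
    classify-unique 1F (_ , _ , _ , ¬e)         | yes e | _     | _     = contradiction e ¬e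
    classify-unique 2F (ax , ay , o)            | yes e | _     | _     = contradiction (E⇒T e) (O⇒¬T ax ay o)
    classify-unique 3F (_ , _ , (_ , ¬t) , _)   | yes e | _     | _     = contradiction (E⇒T e) ¬t
    classify-unique 0F (_ , _ , e)              | no ¬e | _     | _     = contradiction e ¬e
    classify-unique 1F (_ , _ , _)              | no _  | yes _ | _     = ≡.refl
    classify-unique 2F (ax , ay , o)            | no _  | yes t | _     = contradiction t (O⇒¬T ax ay o)
    classify-unique 3F (_ , _ , (_ , ¬t) , _)   | no _  | yes t | _     = contradiction t ¬t
    classify-unique 1F (_ , _ , t , _)          | no _  | no ¬t | _     = contradiction t ¬t
    classify-unique 2F (_ , _ , _)              | no _  | no _  | yes _ = ≡.refl
    classify-unique 3F (_ , _ , _ , ¬o)         | no _  | no _  | yes o = contradiction o ¬o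
    classify-unique 2F (_ , _ , o)              | no _  | no _  | no ¬o = contradiction o ¬o
    classify-unique 3F (_ , _ , _)              | no _  | no _  | no _  = ≡.refl

    private
      ¬Iso-resp : (¬_ ∘ Iso) Respects _≋_
      ¬Iso-resp x≋y ax = ax ∘ Iso-resp (sym ∘ x≋y)

      ¬Iso-homogeneous : Homogeneous (¬_ ∘ Iso)
      ¬Iso-homogeneous {x} {s} s≉0 ax isx = *≉0 (norm-≉0 s≉0) ax (trans (sym (B-⊙-⊙ s x)) isx)

    anisotropic-finite : ∃ λ m → HasCardinality 𝒫 m
    anisotropic-finite = _ , points-card (λ x → ¬? (Iso? x)) ¬Iso-resp ¬Iso-homogeneous ¬Iso⇒Nonzero
      (λ {X} ¬hX → aniso (X , ¬hX)) (λ {X} aX hX → aX (trans (sym (H-B≈B _ _)) hX))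

    -- The relations of the scheme, of which the last one is left out when q = 2, are
    -- those indexed by ι.
    module _ {d : ℕ} (R′ : Fin (suc d) → Rel (Setoid.Carrier 𝒫) (c ⊔ ℓ₁ ⊔ ℓ₂)) (ι : Fin (suc d) → Fin 4)
             (ι-injective : ∀ {i j} → ι i ≡ ι j → i ≡ j) (ι-zero : ι zero ≡ zero)
             (R′⇒ : ∀ i {X Y} → R′ i X Y → holds (relation (ι i)) (vec X) (vec Y))
             (⇒R′ : ∀ i {X Y} → holds (relation (ι i)) (vec X) (vec Y) → R′ i X Y)
             (ι-exhaustive : ∀ {x y} → ¬ Iso x → ¬ Iso y → ∃ λ i → ι i ≡ classify x y)
             (ι-nonEmpty : ∀ i → ∃₂ (Related (ι i))) where

      isAssociationScheme : IsAssociationScheme 𝒫 R′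
      isAssociationScheme = record
        { finite       = anisotropic-finite
        ; respects     = λ i →
            (λ {X} {Y} {Z} Y∼Z r → ⇒R′ i (E-invariantʳ (relation (ι i)) (vec X) (aniso Y) (aniso Z) (∼⇒E Y Z Y∼Z) (R′⇒ i r))) ,
            (λ {X} {Y} {Z} Y∼Z r → ⇒R′ i (E-invariantˡ (relation (ι i)) (aniso Y) (aniso Z) (aniso X) (∼⇒E Y Z Y∼Z) (R′⇒ i r)))
        ; exhaustive   = λ X Y → let (i , ιi≡) = ι-exhaustive (aniso X) (aniso Y) in
            i , ⇒R′ i (≡.subst (λ k → holds (relation k) (vec X) (vec Y)) (≡.sym ιi≡) (classify-holds (vec X) (vec Y)))
        ; disjoint     = λ {i} {j} {X} {Y} rᵢ rⱼ → ι-injective (≡.trans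
            (≡.sym (classify-unique (ι i) (aniso X , aniso Y , R′⇒ i rᵢ))) (classify-unique (ι j) (aniso X , aniso Y , R′⇒ j rⱼ)))
        ; nonEmpty     = λ i → let (x , y , ax , ay , r) = ι-nonEmpty i in
            anisotropicPoint x ax , anisotropicPoint y ay , ⇒R′ i r
        ; symmetric    = λ i {X} {Y} r → ⇒R′ i (sym-rel (relation (ι i)) (aniso X) (aniso Y) (R′⇒ i r))
        ; identity     = λ X Y → mk⇔
            (λ r → E⇒∼ X Y (≡.subst (λ k → holds (relation k) (vec X) (vec Y)) ι-zero (R′⇒ zero r)))
            (λ X∼Y → ⇒R′ zero (≡.subst (λ k → holds (relation k) (vec X) (vec Y)) (≡.sym ι-zero) (∼⇒E X Y X∼Y)))
        ; intersection = λ i j k → let (m , count≡m) = constant-points i j k in m , λ X Y r →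
            ≡.subst (HasCardinality _) (count≡m (aniso X , aniso Y , R′⇒ k r))
              (Compose.inverse Subset-Subset (points-card (P? i j (vec X) (vec Y)) (P-resp i j) (P-hom i j) P⇒Nonzero
                (λ {Z} (¬hZ , rᵢ , rⱼ) → aniso (Z , ¬hZ) , R′⇒ i rᵢ , R′⇒ j rⱼ)
                (λ {Z} (aZ , rᵢ , rⱼ) → (λ hZ → aZ (trans (sym (H-B≈B _ _)) hZ)) , ⇒R′ i rᵢ , ⇒R′ j rⱼ)))
        }
        where
        P : ∀ i j x y → Pred V ℓ₁
        P i j x y z = ¬ Iso z × holds (relation (ι i)) x z × holds (relation (ι j)) y z
        P? : ∀ i j x y → Decidable (P i j x y)
        P? i j x y z = ¬? (Iso? z) ×-dec (dec (relation (ι i)) x z ×-dec dec (relation (ι j)) y z)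
        P-resp : ∀ i j {x y} → P i j x y Respects _≋_
        P-resp i j {x} {y} z≋z′ (az , rᵢ , rⱼ) = ¬Iso-resp z≋z′ az , resp (relation (ι i)) x z≋z′ rᵢ , resp
            (relation (ι j)) y z≋z′ rⱼ
        P-hom : ∀ i j {x y} → Homogeneous (P i j x y)
        P-hom i j {x} {y} {z} s≉0 (az , rᵢ , rⱼ) = ¬Iso-homogeneous {z} s≉0 az , hom (relation (ι i)) x {z} s≉0 rᵢ , hom
            (relation (ι j)) y {z} s≉0 rⱼ
        P⇒Nonzero : ∀ {i j x y z} → P i j x y z → Nonzero z
        P⇒Nonzero (az , _) = ¬Iso⇒Nonzero az
        constant-points : ∀ i j k → Constant (Related (ι k)) (λ x y → #points (P? i j x y) (P-resp i j) (P-hom i j) P⇒Nonzero)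
        constant-points i j k = constant-/ #units (constant-count (ι k) (ι i) (ι j))
          λ {x} {y} _ → #vectors (P? i j x y) (P-resp i j) (P-hom i j) P⇒Nonzero

    module Witnesses (2≤n : 2 ≤ n) where
      private
        two : ∀ {n} → 2 ≤ n → ∃₂ λ (i j : Fin n) → i ≢ j
        two (s≤s (s≤s _)) = 0F , 1F , λ ()

        i₁′ i₂′ : Fin (suc n)
        i₁′ = suc (proj₁ (two 2≤n))
        i₂′ = suc (proj₁ (proj₂ (two 2≤n)))

        i₁≢i₂ : i₁′ ≢ i₂′
        i₁≢i₂ = proj₂ (proj₂ (two 2≤n)) ∘ Fin.suc-injective

        e₀ e₁ e₂ : V
        e₀ = basis zero
        e₁ = basis i₁′
        e₂ = basis i₂′

        B-basis-≡ : ∀ i → B (basis i) (basis i) ≈ 1#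
        B-basis-≡ i = trans (B-basis i (basis i)) (basis-≡ i)

        B-basis-≢ : ∀ {i j} → i ≢ j → B (basis i) (basis j) ≈ 0#
        B-basis-≢ {i} {j} i≢j = trans (B-basis j (basis i)) (basis-≢ i≢j)

        basis-aniso : ∀ i → ¬ Iso (basis i)
        basis-aniso i ie = 1≉0 (trans (sym (B-basis-≡ i)) ie)

        -1≉0 : ¬ - 1# ≈ 0#
        -1≉0 -1≈0 = 1≉0 (trans (sym (-‿involutive 1#)) (trans (-‿cong -1≈0) -0#≈0#))

        -1-real : Real (- 1#)
        -1-real = Real-neg conj-1

        norm-basis : ∀ {i j} s → i ≢ j → B (basis i ⊕ s ⊙ basis j) (basis i ⊕ s ⊙ basis j) ≈ 1# + norm s
        norm-basis {i} {j} s i≢j = trans (B-⊕-⊥ (basis i) s (basis j) (B-basis-≢ i≢j))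
          (+-cong (B-basis-≡ i) (trans (*-congˡ (B-basis-≡ j)) (*-identityʳ _)))

        B-e₀ : ∀ {x} s i → x ≈ 0# → x + s * basis (suc i) zero ≈ 0#
        B-e₀ s i x≈0 = trans (+-cong x≈0 (trans (*-congˡ (basis-≢ {suc i} {zero} λ ())) (zeroʳ s))) (+-identityʳ 0#)

      equal : ∃₂ (Related 0F)
      equal = e₀ , e₀ , basis-aniso zero , basis-aniso zero , λ _ → refl

      orthogonal : ∃₂ (Related 2F)
      orthogonal = e₀ , e₁ , basis-aniso zero , basis-aniso i₁′ , B-basis-≢ {i₁′} {zero} λ ()

      -- If norm t = -1, then e₁ + t e₂ is isotropic and orthogonal to e₀, so adding it to e₀ gives
      -- a vector tangent to e₀. This takes three basis vectors, whence n ≥ 2.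
      tangent : ∃₂ (Related 1F)
      tangent with CF.#-witness (λ t → norm t ≟ - 1#) (λ #≡0 → ℕ.1+n≢0 (≡.trans (≡.sym (#norm≈ -1-real -1≉0)) #≡0))
      ... | t , Nt≈-1 = e₀ , y , basis-aniso zero , (λ iy → 1≉0 (trans (sym Byy≈1) iy)) ,
          trans (norm-cong Bye₀≈1) (trans (*-congˡ conj-1) (*-cong (sym (B-basis-≡ zero)) (sym Byy≈1))) ,
          λ e → 1≉0 (begin
            1#                            ≈⟨ *-identityˡ 1# ⟨
            1# * 1#                       ≈⟨ *-cong (B-basis-≡ zero) y₁≈1 ⟨
            B e₀ e₀ * y i₁′               ≈⟨ e i₁′ ⟩
            B y e₀ * e₀ i₁′               ≈⟨ *-congˡ (basis-≢ {zero} {i₁′} λ ()) ⟩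
            B y e₀ * 0#                   ≈⟨ zeroʳ _ ⟩
            0#                            ∎)
        where
        u y : V
        u = e₁ ⊕ t ⊙ e₂
        y = u ⊕ 1# ⊙ e₀
        u₀≈0 : u zero ≈ 0#
        u₀≈0 = B-e₀ t (proj₁ (proj₂ (two 2≤n))) (basis-≢ {i₁′} {zero} λ ())
        Byy≈1 : B y y ≈ 1#
        Byy≈1 = trans (B-u+x u (trans (B-basis zero u) u₀≈0)) (trans (+-cong (B-basis-≡ zero)
          (trans (norm-basis t i₁≢i₂) (trans (+-congˡ Nt≈-1) (-‿inverseʳ 1#)))) (+-identityʳ 1#))
        Bye₀≈1 : B y e₀ ≈ 1#
        Bye₀≈1 = trans (B-basis zero y) (trans (+-cong u₀≈0 (trans (*-identityˡ _) (basis-≡ zero))) (+-identityˡ 1#))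
        y₁≈1 : y i₁′ ≈ 1#
        y₁≈1 = trans (+-cong (trans (+-cong (basis-≡ i₁′) (trans (*-congˡ (basis-≢ (i₁≢i₂ ∘ ≡.sym))) (zeroʳ t))) (+-identityʳ 1#))
          (trans (*-identityˡ _) (basis-≢ {zero} {i₁′} λ ()))) (+-identityʳ 1#)

      -- For y = e₀ + s e₁, s ≠ 0 excludes tangency to e₀, norm s ≠ -1 makes y anisotropic, and y is
      -- never orthogonal to e₀. If there were no such s, all q² - 1 nonzero scalars would be among
      -- the q + 1 of norm -1, forcing q ≤ 2.
      secant : q ≢ 2 → ∃₂ (Related 3F)
      secant q≢2 with CF.search (λ s → ¬? (s ≟ 0#) ×-dec ¬? (norm s ≟ - 1#))
                      (λ s≈t (s≉0 , Ns≉-1) → s≉0 ∘ trans s≈t , Ns≉-1 ∘ trans (norm-cong s≈t))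
      ... | no ∄s = contradiction (ℕ.≤-antisym q≤2 2≤q) q≢2
        where
        #units≤ : #units ≤ suc q
        #units≤ = ℕ.≤-trans (CF.#-mono _ (λ s → norm s ≟ - 1#) norm≈-1) (ℕ.≤-reflexive (#norm≈ -1-real -1≉0))
          where
          norm≈-1 : ∀ s → ¬ s ≈ 0# → norm s ≈ - 1#
          norm≈-1 s s≉0 with norm s ≟ - 1#
          ... | yes Ns≈-1 = Ns≈-1
          ... | no Ns≉-1  = contradiction (s , s≉0 , Ns≉-1) ∄s
        q*q≤2+q : q ℕ.* q ≤ 2 ℕ.+ q
        q*q≤2+q = ≡.subst (_≤ 2 ℕ.+ q) (≡.trans #≉0 (≡.cong (q ℕ.*_) (ℕ.*-identityʳ q))) (s≤s #units≤)
        q≤2 : q ≤ 2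
        q≤2 with q ℕ.≤? 2
        ... | yes q≤2 = q≤2
        ... | no q≰2  = contradiction (ℕ.≤-trans (ℕ.*-monoˡ-≤ q (ℕ.≰⇒> q≰2)) q*q≤2+q) (ℕ.<⇒≱
          (≡.subst (2 ℕ.+ q <_) (≡.cong (q ℕ.+_) (≡.cong (q ℕ.+_) (≡.sym (ℕ.+-identityʳ q))))
            (ℕ.≤-trans (ℕ.+-monoˡ-≤ q (ℕ.≰⇒> q≰2)) (ℕ.+-monoʳ-≤ q (ℕ.m≤m+n q q)))))
      ... | yes (s , s≉0 , Ns≉-1) = e₀ , y , basis-aniso zero ,
          (λ iy → Ns≉-1 (trans (solve 2 (λ o m → m := o :+ m :- o) refl 1# (norm s)) (trans (+-congʳ (trans (sym Byy≈) iy)) (+-identityˡ _)))) ,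
          (refl , λ t → norm-≉0 s≉0 (+-cancelˡ 1# _ _ (begin
            1# + norm s          ≈⟨ Byy≈ ⟨
            B y y                ≈⟨ *-identityˡ _ ⟨
            1# * B y y           ≈⟨ *-congʳ (B-basis-≡ zero) ⟨
            B e₀ e₀ * B y y      ≈⟨ t ⟨
            norm (B y e₀)        ≈⟨ norm-cong Bye₀≈1 ⟩
            1# * conj 1#         ≈⟨ trans (*-identityˡ _) conj-1 ⟩
            1#                   ≈⟨ +-identityʳ 1# ⟨
            1# + 0#              ∎))) ,
          λ o → 1≉0 (trans (sym Bye₀≈1) o)
        where
        y : V
        y = e₀ ⊕ s ⊙ e₁
        Byy≈ : B y y ≈ 1# + norm s
        Byy≈ = norm-basis {zero} {i₁′} s λ ()
        Bye₀≈1 : B y e₀ ≈ 1#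
        Bye₀≈1 = trans (B-basis zero y) (trans (+-cong (basis-≡ zero)
          (trans (*-congˡ (basis-≢ {i₁′} {zero} λ ())) (zeroʳ s))) (+-identityʳ 1#))

    module _ (q≡2 : q ≡ 2) where

      -- For q = 2 reality of r reads r² = r.
      real≉0⇒≈1 : ∀ {r} → Real r → ¬ r ≈ 0# → r ≈ 1#
      real≉0⇒≈1 {r} real r≉0 = *-cancelˡ-≉0 r≉0 (trans (*-congˡ (sym (*-identityʳ r)))
        (trans (sym (^-congʳ r q≡2)) (trans real (sym (*-identityʳ r)))))

      -- Both sides of the tangency equation are nonzero and real, hence equal to 1.
      q≡2⇒¬Related3 : ∀ {x y} → ¬ Related 3F x y
      q≡2⇒¬Related3 {x} {y} (ax , ay , (_ , ¬t) , ¬o) = ¬t (trans (real≉0⇒≈1 (norm-real _) (norm-≉0 ¬o))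
        (sym (real≉0⇒≈1 (Real-* (B-real x) (B-real y)) (*≉0 ax ay))))

      q≡2⇒classify≢3 : ∀ {x y} → ¬ Iso x → ¬ Iso y → ∃ λ i → inject₁ i ≡ classify x y
      q≡2⇒classify≢3 {x} {y} ax ay = lower (classify x y) λ class≡3 →
          q≡2⇒¬Related3 (ax , ay , ≡.subst (λ k → holds (relation k) x y) class≡3 (classify-holds x y))
        where
        lower : ∀ k → k ≢ 3F → ∃ λ i → inject₁ i ≡ k
        lower 0F _   = 0F , ≡.refl
        lower 1F _   = 1F , ≡.refl
        lower 2F _   = 2F , ≡.refl
        lower 3F 3≢3 = contradiction ≡.refl 3≢3

-- The association scheme, for q different from 2 and for q = 2.

open import Defs
open import Algebra.Apartness.Bundles using (HeytingField)
open import Data.Fin.Base using (inject₁)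
open import Data.Fin.Patterns using (0F; 1F; 2F; 3F)
open import Data.Fin.Properties using (inject₁-injective)
open import Data.Nat.Base using (ℕ; _≤_; _^_)
open import Data.Product.Base using (_×_; _,_)
open import Data.Vec.Functional using (_∷_; [])
open import Function.Base using (id)
open import Relation.Binary.Definitions using (Empty)
open import Relation.Binary.PropositionalEquality.Core as ≡ using (_≡_; _≢_)

proposition3p2 : ∀ {c ℓ₁ ℓ₂} (F : HeytingField c ℓ₁ ℓ₂) (q n : ℕ) →
  IsPrimePower q → HasCardinality (HeytingField.setoid F) (q ^ 2) → 2 ≤ n →
  let open Hermitian F q n in
    (q ≢ 2 → IsAssociationScheme 𝒫 (R₀ ∷ R₁ ∷ R₂⊥ ∷ R₂⊥̸ ∷ []))
    × (q ≡ 2 → Empty R₂⊥̸ × IsAssociationScheme 𝒫 (R₀ ∷ R₁ ∷ R₂⊥ ∷ []))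
proposition3p2 F q n pp card 2≤n = q≢2-case , λ q≡2 → (λ {X} {Y} → empty q≡2 {X} {Y}) , q≡2-case q≡2
  where
  open Hermitian F q n
  open Points.Projective F q n pp card
  open Witnesses 2≤n

  q≢2-case : q ≢ 2 → IsAssociationScheme 𝒫 (R₀ ∷ R₁ ∷ R₂⊥ ∷ R₂⊥̸ ∷ [])
  q≢2-case q≢2 = isAssociationScheme _ id id ≡.refl R⇒relation relation⇒R (λ _ _ → _ , ≡.refl) λ where
    0F → equal
    1F → tangent
    2F → orthogonal
    3F → secant q≢2

  empty : q ≡ 2 → Empty R₂⊥̸
  empty q≡2 {X} {Y} r = q≡2⇒¬Related3 q≡2 (aniso X , aniso Y , R⇒relation 3F {X} {Y} r)

  q≡2-case : q ≡ 2 → IsAssociationScheme 𝒫 (R₀ ∷ R₁ ∷ R₂⊥ ∷ [])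
  q≡2-case q≡2 = isAssociationScheme _ inject₁ inject₁-injective ≡.refl
    (λ { 0F {X} {Y} → R⇒relation 0F {X} {Y} ; 1F {X} {Y} → R⇒relation 1F {X} {Y} ; 2F {X} {Y} → R⇒relation 2F {X} {Y} })
    (λ { 0F {X} {Y} → relation⇒R 0F {X} {Y} ; 1F {X} {Y} → relation⇒R 1F {X} {Y} ; 2F {X} {Y} → relation⇒R 2F {X} {Y} })
    (q≡2⇒classify≢3 q≡2)
    λ { 0F → equal ; 1F → tangent ; 2F → orthogonal }
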